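{- Let $k\ge2$ and let $\mathbf F$ be a $k$-CNF formula on $n$ variables. For each $0<\delta\le\min\left\{1,\frac{4}{k-1}\right\}$, there exists a randomized algorithm taking $\mathbf F$ as input and running in time $O^*(\tau_1(\delta,k,n))$, where $$\tau_1(\delta,k,n)=\frac{2^nk^{R_1}}{\binom n{R_1}},\qquad R_1=\left\lfloor\frac{\delta n}{2(2+\delta)}\right\rfloor,$$ that, if $\mathbf F$ is satisfiable, outputs with probability $1-o(1)$ assignments $z_1^*,z_2^*\in\Omega_{\mathbf F}$ such that $d_H(z_1^*,z_2^*)\ge\frac12(1-\delta)\,\mathrm{Diam}(\mathbf F)$.
   Context: $\Omega_{\mathbf F}\subseteq\{0,1\}^n$ is the set of satisfying assignments of $\mathbf F$; $d_H$ is Hamming distance; $\mathrm{Diam}(\mathbf F)=\max_{z_1,z_2\in\Omega_{\mathbf F}}d_H(z_1,z_2)$ for satisfiable $\mathbf F$. A $k$-CNF formula is a conjunction of clauses, each a disjunction of at most $k$ literals; formulas have $n^{O(1)}$ clauses. $k,\delta$ are constants and $O^*$ hides factors polynomial in $n$; $o(1)$ is as $n\to\infty$. -}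

module Defs where

open import Data.Bool using (Bool; true; false; T; T?; _xor_; if_then_else_)
import Data.Bool.Properties as Bool
open import Data.Empty using (⊥; ⊥-elim)
open import Data.Fin using (Fin; toℕ)
open import Data.Integer using (ℤ; +_; 0ℤ; _⊖_)
import Data.Integer as ℤ
open import Data.List using (List; []; _∷_; _++_; map; filter; length; cartesianProductWith)
open import Data.List.Extrema.Nat using (max)
open import Data.List.Membership.Propositional using (_∈_)
open import Data.List.Membership.Propositional.Properties using (∈-map⁺; ∈-++⁺ˡ; ∈-++⁺ʳ)
open import Data.List.Relation.Unary.All as All using (All)
open import Data.List.Relation.Unary.Any as Any using (Any; here)
open import Data.Maybe using (Maybe; just; nothing; _>>=_)
import Data.Maybe.Relation.Unary.Any as Maybe
open import Data.Nat using (ℕ; zero; suc; _+_; _*_; _∸_; _^_; _≤_; _<_; z≤n; s≤s; NonZero; >-nonZero; _≡ᵇ_)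
open import Data.Nat.Combinatorics using (_C_; nCk+nC[k+1]≡[n+1]C[k+1])
import Data.Nat.Properties as ℕ
open import Data.Product using (∃; _×_; _,_; proj₁; proj₂)
open import Data.Rational using (ℚ; 0ℚ; 1ℚ; ½; _/_; _⊓_)
import Data.Rational as ℚ
import Data.Rational.Properties as ℚ
open import Data.Unit using (⊤)
open import Data.Vec using (Vec; []; _∷_; lookup; zipWith; countᵇ)
open import Function using (id)
open import Relation.Binary.PropositionalEquality using (_≡_; refl; subst)
open import Relation.Nullary using (¬_; Dec; yes; no; does; _×-dec_)
open import Relation.Unary using (Decidable)

-- A real δ is given by its closed lower Dedekind cut { q ∈ ℚ ∣ q ≤ δ }.
-- The cut is Boolean-valued, so that ⌊_⌋ is a function; classically every
-- real number has such a cut.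
record ℝ : Set where
  field
    cut       : ℚ → Bool
    inhabited : ∃ λ q → T (cut q)
    bounded   : ∃ λ q → ¬ T (cut q)
    lower     : ∀ {p q} → p ℚ.≤ q → T (cut q) → T (cut p)
    closed    : ∀ {q} → (∀ p → p ℚ.< q → T (cut p)) → T (cut q)

infix 4 _≤ʳ_ _ʳ≤_ _≤[_·_]

_≤ʳ_ : ℚ → ℝ → Set
q ≤ʳ δ = T (ℝ.cut δ q)

_ʳ≤_ : ℝ → ℚ → Set
δ ʳ≤ q = ∀ p → p ≤ʳ δ → p ℚ.≤ q

Positive : ℝ → Set
Positive δ = ∃ λ q → 0ℚ ℚ.< q × q ≤ʳ δ

fromℚ : ℚ → ℝ
fromℚ q = record
  { cut       = ℚ._≤ᵇ q
  ; inhabited = q , ℚ.≤⇒≤ᵇ {q} {q} ℚ.≤-refl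
  ; bounded   = q ℚ.+ 1ℚ , λ t → ℚ.<-irrefl refl (ℚ.<-≤-trans q<q+1 (ℚ.≤ᵇ⇒≤ t))
  ; lower     = λ p≤r t → ℚ.≤⇒≤ᵇ {q = q} (ℚ.≤-trans p≤r (ℚ.≤ᵇ⇒≤ {q = q} t))
  ; closed    = λ below → ℚ.≤⇒≤ᵇ (sup below)
  }
  where
  q<q+1 : q ℚ.< q ℚ.+ 1ℚ
  q<q+1 = subst (ℚ._< q ℚ.+ 1ℚ) (ℚ.+-identityʳ q) (ℚ.+-monoʳ-< q (ℚ.positive⁻¹ 1ℚ))

  sup : ∀ {r} → (∀ p → p ℚ.< r → T (p ℚ.≤ᵇ q)) → r ℚ.≤ q
  sup {r} below with r ℚ.≤? q
  ... | yes r≤q = r≤q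
  ... | no  r≰q with ℚ.<-dense (ℚ.≰⇒> r≰q)
  ...   | m , q<m , m<r = ⊥-elim (ℚ.<-irrefl refl (ℚ.<-≤-trans q<m (ℚ.≤ᵇ⇒≤ (below m m<r))))

_≤[_·_] : ℤ → ℝ → ℕ → Set
a ≤[ δ · zero  ] = a ℤ.≤ 0ℤ
a ≤[ δ · suc b ] = a / suc b ≤ʳ δ

_≤[_·_]? : ∀ a δ b → Dec (a ≤[ δ · b ])
a ≤[ δ · zero  ]? = a ℤ.≤? 0ℤ
a ≤[ δ · suc b ]? = T? (ℝ.cut δ (a / suc b))

-- (i , true) is the literal xᵢ and (i , false) its negation.
Literal : ℕ → Set
Literal n = Fin n × Bool

Clause : ℕ → Set
Clause n = List (Literal n)

CNF : ℕ → Set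
CNF n = List (Clause n)

IsKCNF : ∀ {n} → ℕ → CNF n → Set
IsKCNF k F = All (λ C → length C ≤ k) F

Assignment : ℕ → Set
Assignment n = Vec Bool n

infix 4 _⊨_ _⊨?_

_⊨_ : ∀ {n} → Assignment n → CNF n → Set
z ⊨ F = All (Any (λ l → lookup z (proj₁ l) ≡ proj₂ l)) F

_⊨?_ : ∀ {n} (z : Assignment n) (F : CNF n) → Dec (z ⊨ F)
z ⊨? F = All.all? (Any.any? λ l → lookup z (proj₁ l) Bool.≟ proj₂ l) F

Satisfiable : ∀ {n} → CNF n → Set
Satisfiable F = ∃ λ z → z ⊨ F

d-H : ∀ {n} → Assignment n → Assignment n → ℕ
d-H z₁ z₂ = countᵇ id (zipWith _xor_ z₁ z₂)

assignments : ∀ n → List (Assignment n)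
assignments zero    = [] ∷ []
assignments (suc n) = map (false ∷_) (assignments n) ++ map (true ∷_) (assignments n)

∈-assignments : ∀ {n} (z : Assignment n) → z ∈ assignments n
∈-assignments []                = here refl
∈-assignments (false ∷ z)       = ∈-++⁺ˡ (∈-map⁺ (false ∷_) (∈-assignments z))
∈-assignments {suc n} (true ∷ z) = ∈-++⁺ʳ (map (false ∷_) (assignments n)) (∈-map⁺ (true ∷_) (∈-assignments z))

Ω : ∀ {n} → CNF n → List (Assignment n)
Ω {n} F = filter (_⊨? F) (assignments n)

-- The default value 0 of max plays no role when F is satisfiable.
Diam : ∀ {n} → CNF n → ℕ
Diam F = max 0 (cartesianProductWith d-H (Ω F) (Ω F))

largest : {P : ℕ → Set} → Decidable P → ℕ → ℕ
largest P? zero    = 0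
largest P? (suc m) = if does (P? (suc m)) then suc m else largest P? m

largest≤ : ∀ {P} (P? : Decidable P) m → largest P? m ≤ m
largest≤ P? zero = z≤n
largest≤ P? (suc m) with does (P? (suc m))
... | true  = ℕ.≤-refl
... | false = ℕ.m≤n⇒m≤1+n (largest≤ P? m)

-- For δ > 0 and R ∈ ℕ, R ≤ δn / (2(2+δ)) iff 4R ≤ δ(n − 2R).  Truncated
-- subtraction is harmless: if n < 2R then R > 0 and both sides are false.
-- Since δn / (2(2+δ)) < n, the search may stop at n.
R₁ : ℝ → ℕ → ℕ
R₁ δ n = largest (λ R → (+ (4 * R)) ≤[ δ · n ∸ 2 * R ]?) n

0<nCr : ∀ {n r} → r ≤ n → 0 < n C r
0<nCr {n} z≤n = s≤s z≤n
0<nCr {suc n} {suc r} (s≤s r≤n) =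
  subst (0 <_) (nCk+nC[k+1]≡[n+1]C[k+1] n r) (ℕ.≤-trans (0<nCr r≤n) (ℕ.m≤m+n (n C r) _))

τ₁ : ℝ → ℕ → ℕ → ℚ
τ₁ δ k n = + (2 ^ n * k ^ R₁ δ n) / (n C R₁ δ n)
  where instance
    _ : NonZero (n C R₁ δ n)
    _ = >-nonZero (0<nCr (largest≤ _ n))

min[1,4/[_-1]] : (k : ℕ) → 2 ≤ k → ℚ
min[1,4/[ k -1]] 2≤k = 1ℚ ⊓ (+ 4 / (k ∸ 1))
  where instance
    _ : NonZero (k ∸ 1)
    _ = >-nonZero (ℕ.m<n⇒0<n∸m 2≤k)

-- Every n^O(1) bound is dominated by some poly c.
poly : ℕ → ℕ → ℕ
poly c n = c * suc n ^ c

_∈O*_ : (ℕ → ℕ) → (ℕ → ℚ) → Set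
t ∈O* τ = ∃ λ c → ∀ n → (+ t n / 1) ℚ.≤ (+ poly c n / 1) ℚ.* τ n

_∈o1 : (ℕ → ℚ) → Set
ε ∈o1 = ∀ η → 0ℚ ℚ.< η → ∃ λ n₀ → ∀ n → n₀ ≤ n → ℚ.∣ ε n ∣ ℚ.≤ η

-- Programs are those of the WHILE language over binary trees (N. D. Jones,
-- "Computability and Complexity"), extended with coin tosses.  An
-- expression has constant size in a fixed program and cons, hd and tl are
-- pointer operations, so each step takes constant time on a pointer machine.
infixr 5 _∙_

data Tree : Set where
  nil : Tree
  _∙_ : Tree → Tree → Tree

Var : Set
Var = ℕ

data Expr : Set where
  nil   : Expr
  var   : Var → Expr
  cons  : Expr → Expr → Expr
  hd tl : Expr → Expr

-- compare x y z sets x to the truth value of y ≤ δ · z, for natural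
-- numbers y and z in unary.  See Presentation below.
infixr 5 _⨾_

data Cmd : Set where
  _≔_     : Var → Expr → Cmd
  toss    : Var → Cmd
  compare : Var → Expr → Expr → Cmd
  _⨾_     : Cmd → Cmd → Cmd
  ifte    : Expr → Cmd → Cmd → Cmd
  while   : Expr → Cmd → Cmd

encBool : Bool → Tree
encBool false = nil
encBool true  = nil ∙ nil

decBool : Tree → Bool
decBool nil     = false
decBool (_ ∙ _) = true

encℕ : ℕ → Tree
encℕ zero    = nil
encℕ (suc n) = nil ∙ encℕ n

decℕ : Tree → ℕ
decℕ nil     = zero
decℕ (_ ∙ t) = suc (decℕ t)

encList : ∀ {A : Set} → (A → Tree) → List A → Tree
encList enc []       = nil
encList enc (x ∷ xs) = enc x ∙ encList enc xs

encLiteral : ∀ {n} → Literal n → Tree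
encLiteral (i , b) = encBool b ∙ encℕ (toℕ i)

encCNF : ∀ {n} → CNF n → Tree
encCNF {n} F = encℕ n ∙ encList (encList encLiteral) F

decAssignment : ∀ n → Tree → Maybe (Assignment n)
decAssignment zero    nil     = just []
decAssignment zero    (_ ∙ _) = nothing
decAssignment (suc n) nil     = nothing
decAssignment (suc n) (b ∙ t) = decAssignment n t >>= λ z → just (decBool b ∷ z)

decPair : ∀ n → Tree → Maybe (Assignment n × Assignment n)
decPair n nil     = nothing
decPair n (s ∙ t) = decAssignment n s >>= λ z₁ → decAssignment n t >>= λ z₂ → just (z₁ , z₂)

Store : Set
Store = Var → Tree

_[_↦_] : Store → Var → Tree → Store
(σ [ x ↦ t ]) y = if y ≡ᵇ x then t else σ y

⟦_⟧ : Expr → Store → Tree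
⟦ nil ⟧      σ = nil
⟦ var x ⟧    σ = σ x
⟦ cons e f ⟧ σ = ⟦ e ⟧ σ ∙ ⟦ f ⟧ σ
⟦ hd e ⟧     σ with ⟦ e ⟧ σ
... | nil   = nil
... | s ∙ _ = s
⟦ tl e ⟧     σ with ⟦ e ⟧ σ
... | nil   = nil
... | _ ∙ t = t

-- The list is the stack of commands still to be executed.
Config : Set
Config = List Cmd × Store

-- Input and output are in variable 0; all other variables start as nil.
start : Cmd → Tree → Config
start p t = p ∷ [] , (λ _ → nil) [ 0 ↦ t ]

-- How an algorithm may depend on the constant δ.  If δ is rational, it is
-- part of the program and compare is a dummy.  An arbitrary real δ need not
-- have a finite description; the program then accesses δ by comparing it
-- with rationals.
data Presentation : Set where
  rational : ℚ → Presentation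
  oracle   : ℝ → Presentation

value : Presentation → ℝ
value (rational q) = fromℚ q
value (oracle δ)   = δ

module Run (δ : Presentation) where

  answer : Presentation → ℕ → ℕ → Bool
  answer (rational _) a b = false
  answer (oracle δ)   a b = does ((+ a) ≤[ δ · b ]?)

  -- A fresh fair coin is supplied at every step; only toss looks at it.
  step : Bool → Cmd → List Cmd → Store → Config
  step b (x ≔ e)         K σ = K , σ [ x ↦ ⟦ e ⟧ σ ]
  step b (toss x)        K σ = K , σ [ x ↦ encBool b ]
  step b (compare x e f) K σ = K , σ [ x ↦ encBool (answer δ (decℕ (⟦ e ⟧ σ)) (decℕ (⟦ f ⟧ σ))) ]
  step b (c ⨾ d)         K σ = c ∷ d ∷ K , σ
  step b (ifte e c d)    K σ = (if decBool (⟦ e ⟧ σ) then c else d) ∷ K , σ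
  step b (while e c)     K σ = (if decBool (⟦ e ⟧ σ) then c ∷ while e c ∷ K else K) , σ

  HaltsWithin : ℕ → Config → Set
  HaltsWithin t       ([]    , σ) = ⊤
  HaltsWithin zero    (c ∷ K , σ) = ⊥
  HaltsWithin (suc t) (c ∷ K , σ) = ∀ b → HaltsWithin t (step b c K σ)

  -- The probability that, within t steps, the run halts with output in P.
  Pr : ∀ {P : Tree → Set} → ℕ → Config → Decidable P → ℚ
  Pr t       ([]    , σ) P? = if does (P? (σ 0)) then 1ℚ else 0ℚ
  Pr zero    (c ∷ K , σ) P? = 0ℚ
  Pr (suc t) (c ∷ K , σ) P? =
    ½ ℚ.* (Pr t (step false c K σ) P? ℚ.+ Pr t (step true c K σ) P?)

open Run public using (HaltsWithin; Pr)

-- ½(1−δ)D ≤ d iff D − 2d ≤ δD.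
FarApart : ∀ {n} → ℝ → CNF n → Assignment n × Assignment n → Set
FarApart δ F (z₁ , z₂) =
  z₁ ⊨ F × z₂ ⊨ F × (Diam F ⊖ 2 * d-H z₁ z₂) ≤[ δ · Diam F ]

Success : ∀ {n} → ℝ → CNF n → Tree → Set
Success {n} δ F t = Maybe.Any (FarApart δ F) (decPair n t)

success? : ∀ {n} (δ : ℝ) (F : CNF n) → Decidable (Success δ F)
success? {n} δ F t = Maybe.dec far? (decPair n t)
  where
  far? : Decidable (FarApart δ F)
  far? (z₁ , z₂) =
    (z₁ ⊨? F) ×-dec (z₂ ⊨? F) ×-dec ((Diam F ⊖ 2 * d-H z₁ z₂) ≤[ δ · Diam F ]?)

module Submission where

open import Defs
open import Data.Bool using (Bool; true; false; T; T?; not; if_then_else_; _xor_; _∨_)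
open import Data.Bool.ListAction using (any)
import Data.Bool.Properties as Bool
open import Data.Empty using (⊥-elim)
open import Data.Fin using (Fin; zero; suc; toℕ; _↑ʳ_)
open import Data.Fin.Patterns using (0F; 1F; 2F; 3F; 5F)
import Data.Fin.Properties as Fin
open import Data.Integer using (_⊖_)
import Data.Integer as ℤ
import Data.Integer.Properties as ℤ
open import Data.List using (List; []; _∷_; length; foldl; cartesianProductWith)
open import Data.List.Extrema.Nat using (xs≤max; argmax-sel)
open import Data.List.Membership.Propositional using (_∈_)
open import Data.List.Membership.Propositional.Properties using (∈-filter⁺; ∈-filter⁻; ∈-cartesianProductWith⁺; ∈-cartesianProductWith⁻)
open import Data.List.Relation.Unary.All as All using (All; []; _∷_)
open import Data.List.Relation.Unary.Any using (Any; here; there)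
open import Data.Maybe using (Maybe; just; nothing)
import Data.Maybe.Relation.Unary.Any as Maybe
open import Data.Nat using (ℕ; zero; suc; pred; _+_; _*_; _⊔_; _∸_; _^_; _≤_; _<_; z≤n; s≤s; NonZero; >-nonZero)
open import Data.Nat.Combinatorics using (nCk+nC[k+1]≡[n+1]C[k+1]; k>n⇒nCk≡0) renaming (_C_ to infixl 8 _choose_)
open import Data.Nat.Coprimality using (1-coprimeTo) renaming (sym to coprime-sym)
import Data.Nat.Properties as ℕ
open import Data.Nat.Tactic.RingSolver using (solve-∀)
open import Data.Product using (∃; _×_; _,_; proj₁; proj₂)
open import Data.Rational using (ℚ; 0ℚ; 1ℚ; ½; mkℚ; _-_) renaming (_≤_ to _≤ℚ_)
import Data.Rational as ℚ
import Data.Rational.Properties as ℚ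
open import Data.Rational.Unnormalised using (mkℚᵘ)
import Data.Rational.Unnormalised as ℚᵘ
import Data.Rational.Unnormalised.Properties as ℚᵘ
open import Data.Sum using (_⊎_; inj₁; inj₂)
open import Data.Unit using (⊤; tt)
open import Data.Vec using (Vec; []; _∷_; lookup; _[_]≔_)
import Data.Vec.Properties as Vec
open import Data.Vec.Relation.Binary.Pointwise.Inductive as Pointwise using (Pointwise; []; _∷_)
open import Data.Vec.Relation.Unary.All as VecAll using ([]; _∷_) renaming (All to VecAll)
open import Function using (_∘_; case_of_)
open import Relation.Binary.PropositionalEquality using (_≡_; _≢_; refl; sym; trans; cong; cong₂; subst)
import Relation.Binary.PropositionalEquality as Eq
open import Relation.Nullary using (yes; no; does)
open import Relation.Nullary.Decidable using (dec-true)
open import Relation.Unary using (Decidable)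

-- Local search:  while some clause is falsified, branch over its literals
-- and make one of them true.  If z is a solution at distance at most R from
-- the starting point y, some branch of depth at most R moves straight from y
-- towards z and ends in a solution w that agrees with z wherever y does.
--
-- Fix any solution r; some solution z has distance a ≥ Diam / 2 from r.  A
-- random y deviates from z in about R of the n places, hence, with
-- probability at least C(n, R) / 2ⁿ up to a polynomial factor, in at most
-- a R / n of the a places where z differs from r.  Then the w found from y
-- satisfies d(r, w) ≥ a (1 - R / n), which is more than is needed.  So the
-- program keeps the first solution r it finds, and the solution farthest
-- from r that it finds among poly(n) 2ⁿ / C(n, R) trials.
--
-- The radius is R = ⌊ n / m ⌋, where m - 2 is an integer s with
-- 4 / (s + 1) ≤ δ ≤ 4 / s.  Hence R₁ ≤ R, and k ^ r / C(n, r) is decreasing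
-- for r ≤ n / (k + 1), so this choice is within the time bound.  Since m is a
-- constant, the program need not consult δ.

-- The reference r depends on the run, and the distance d of its target z is unknown. So a sample
-- point counts as good if it differs from z in exactly ⌊ d / m ⌋ of the d places where z and r
-- differ and in exactly ⌊ (n - d) / m ⌋ of the others. Because the proportion is the same on both
-- sides, the number of good points is, up to a polynomial factor, at least m ^ n / p ^ (n - R) with
-- p = m - 1, whatever d is. One lower bound g therefore serves every r. The trials come in two
-- halves: the first has to find some solution, the second a good point for the r so found. Each
-- half fails with probability at most 1 / (n + 1).
--
-- The program has to compute the number of trials in unary, and cheaply. As C(n, R) is about m ^ n
-- / p ^ (n - R) and n is about m R, the number 2 ^ n / C(n, R) is about the R-th power of the
-- constant 2 ^ m p ^ p / m ^ m. It is reached by R rounded multiplications.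
--
-- The parts without coin tosses are terms of a total language in which running time is a function
-- of the environment. Execution is analysed once, for an abstract judgement, which is then read as
-- halting in time and as a lower bound on probability.

-- A first-order language of total functions on trees.  A term with s free
-- variables, newest first, is compiled to a command that leaves its value
-- in register r and preserves the registers below r.
data Term (s : ℕ) : Set where
  leaf    : Term s
  ref     : Fin s → Term s
  pair    : Term s → Term s → Term s
  fst snd : Term s → Term s
  cond    : Term s → Term s → Term s → Term s
  bind    : Term s → Term (suc s) → Term s
  fold    : Term s → Term s → Term (2 + s) → Term s

left right : Tree → Tree
left nil      = nil
left (s ∙ _)  = s
right nil     = nil
right (_ ∙ t) = t

foldTree : (Tree → Tree → Tree) → Tree → Tree → Tree
foldTree f nil      a = a
foldTree f (x ∙ xs) a = foldTree f xs (f x a)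

-- Besides its body, a round of the compiled loop takes seven steps: the test, three sequencings and
-- three assignments. The final test takes one.
foldCost : (Tree → Tree → Tree) → (Tree → Tree → ℕ) → Tree → Tree → ℕ
foldCost f c nil      a = 1
foldCost f c (x ∙ xs) a = 7 + c x a + foldCost f c xs (f x a)

eval : ∀ {s} → Term s → Vec Tree s → Tree
eval leaf         ρ = nil
eval (ref i)      ρ = lookup ρ i
eval (pair t u)   ρ = eval t ρ ∙ eval u ρ
eval (fst t)      ρ = left (eval t ρ)
eval (snd t)      ρ = right (eval t ρ)
eval (cond c t u) ρ = if decBool (eval c ρ) then eval t ρ else eval u ρ
eval (bind t u)   ρ = eval u (eval t ρ ∷ ρ)
eval (fold l a b) ρ = foldTree (λ x y → eval b (x ∷ y ∷ ρ)) (eval l ρ) (eval a ρ)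

-- Both branches of a conditional are charged, so that the cost is not
-- defined by cases.
cost : ∀ {s} → Term s → Vec Tree s → ℕ
cost leaf         ρ = 1
cost (ref i)      ρ = 1
cost (pair t u)   ρ = 3 + (cost t ρ + cost u ρ)
cost (fst t)      ρ = 2 + cost t ρ
cost (snd t)      ρ = 2 + cost t ρ
cost (cond c t u) ρ = 2 + (cost c ρ + (cost t ρ + cost u ρ))
cost (bind t u)   ρ = 3 + (cost t ρ + cost u (eval t ρ ∷ ρ))
cost (fold l a b) ρ = 2 + (cost l ρ + cost a ρ) +
  foldCost (λ x y → eval b (x ∷ y ∷ ρ)) (λ x y → cost b (x ∷ y ∷ ρ)) (eval l ρ) (eval a ρ)

-- Compilation and its correctness

compile : ∀ {s} → Vec Var s → Var → Term s → Cmd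
compile γ r leaf         = r ≔ nil
compile γ r (ref i)      = r ≔ var (lookup γ i)
compile γ r (pair t u)   = compile γ r t ⨾ compile γ (1 + r) u ⨾ r ≔ cons (var r) (var (1 + r))
compile γ r (fst t)      = compile γ r t ⨾ r ≔ hd (var r)
compile γ r (snd t)      = compile γ r t ⨾ r ≔ tl (var r)
compile γ r (cond c t u) = compile γ r c ⨾ ifte (var r) (compile γ r t) (compile γ r u)
compile γ r (bind t u)   = compile γ r t ⨾ compile (r ∷ γ) (1 + r) u ⨾ r ≔ var (1 + r)
-- Register r holds the accumulator, 1 + r the rest of the list, 2 + r its head and 3 + r the value
-- of the body.
compile γ r (fold l a b) =
  compile γ r a ⨾ compile γ (1 + r) l ⨾
  while (var (1 + r))
    ((2 + r) ≔ hd (var (1 + r)) ⨾ compile ((2 + r) ∷ r ∷ γ) (3 + r) b ⨾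
     r ≔ var (3 + r) ⨾ (1 + r) ≔ tl (var (1 + r)))

-- J m a t c: all runs from c halt within t steps, and of the 2 ^ m outcomes
-- of the tosses that matter, at least a are favourable.
record Judgement (δ : Presentation) : Set₁ where
  open Run δ using (step)
  field
    J    : ℕ → ℕ → ℕ → Config → Set
    -- A coin is supplied at every step. This rule is for the steps whose coin does not count: both
    -- of its values must then meet the same m and a.
    det  : ∀ {m a t c K σ} → (∀ b → J m a t (step b c K σ)) → J m a (suc t) (c ∷ K , σ)
    coin : ∀ {m t c K σ} (a : Bool → ℕ) → (∀ b → J m (a b) t (step b c K σ)) →
           J (suc m) (a false + a true) (suc t) (c ∷ K , σ)
    mono : ∀ {m a t t′ c} → t ≤ t′ → J m a t c → J m a t′ c

update-same : ∀ (σ : Store) x t → (σ [ x ↦ t ]) x ≡ t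
update-same σ zero    t = refl
update-same σ (suc x) t = update-same (λ y → σ (suc y)) x t

update-other : ∀ (σ : Store) x t y → y ≢ x → (σ [ x ↦ t ]) y ≡ σ y
update-other σ zero    t zero    ne = ⊥-elim (ne refl)
update-other σ zero    t (suc y) ne = refl
update-other σ (suc x) t zero    ne = refl
update-other σ (suc x) t (suc y) ne = update-other (λ y → σ (suc y)) x t y (ne ∘ cong suc)

⟦hd⟧ : ∀ e σ → ⟦ hd e ⟧ σ ≡ left (⟦ e ⟧ σ)
⟦hd⟧ e σ with ⟦ e ⟧ σ
... | nil   = refl
... | _ ∙ _ = refl

⟦tl⟧ : ∀ e σ → ⟦ tl e ⟧ σ ≡ right (⟦ e ⟧ σ)
⟦tl⟧ e σ with ⟦ e ⟧ σ
... | nil   = refl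
... | _ ∙ _ = refl

module Compile {δ : Presentation} (judgement : Judgement δ) where
  open Judgement judgement

  Agree : Var → Store → Store → Set
  Agree r σ σ′ = ∀ x → x < r → σ′ x ≡ σ x

  Implements : ∀ {s} → Vec Var s → Store → Vec Tree s → Set
  Implements γ σ ρ = Pointwise (λ x t → σ x ≡ t) γ ρ

  Below : ∀ {s} → Vec Var s → Var → Set
  Below γ r = VecAll (_< r) γ

  agree-trans : ∀ {r σ₁ σ₂ σ₃} → Agree r σ₁ σ₂ → Agree r σ₂ σ₃ → Agree r σ₁ σ₃
  agree-trans p q x x<r = trans (q x x<r) (p x x<r)

  agree-≤ : ∀ {r r′ σ σ′} → r ≤ r′ → Agree r′ σ σ′ → Agree r σ σ′
  agree-≤ le p x x<r = p x (ℕ.<-≤-trans x<r le)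

  agree-update : ∀ {r} σ x t → r ≤ x → Agree r σ (σ [ x ↦ t ])
  agree-update σ x t r≤x y y<r = update-other σ x t y (ℕ.<⇒≢ (ℕ.<-≤-trans y<r r≤x))

  implements-agree : ∀ {s r} {γ : Vec Var s} {σ σ′ ρ} → Below γ r →
    Agree r σ σ′ → Implements γ σ ρ → Implements γ σ′ ρ
  implements-agree []            ag []         = []
  implements-agree (x<r ∷ below) ag (eq ∷ eqs) = trans (ag _ x<r) eq ∷ implements-agree below ag eqs

  below-suc : ∀ {s r} {γ : Vec Var s} → Below γ r → Below γ (suc r)
  below-suc = VecAll.map ℕ.m≤n⇒m≤1+n

  step-≔ : ∀ {m a u K} x e σ → J m a u (K , σ [ x ↦ ⟦ e ⟧ σ ]) → J m a (1 + u) (x ≔ e ∷ K , σ)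
  step-≔ x e σ j = det λ _ → j

  step-⨾ : ∀ {m a u K} c d σ → J m a u (c ∷ d ∷ K , σ) → J m a (1 + u) ((c ⨾ d) ∷ K , σ)
  step-⨾ c d σ j = det λ _ → j

  -- In continuation form: whatever is known about running K from every store that holds the value
  -- and agrees below r extends backwards over the compiled term. Step counts then add up under
  -- composition, and one induction serves every judgement.
  compile-correct : ∀ {s} (t : Term s) (γ : Vec Var s) r (ρ : Vec Tree s) σ →
    Below γ r → Implements γ σ ρ → ∀ {m a u K} →
    (∀ σ′ → σ′ r ≡ eval t ρ → Agree r σ σ′ → J m a u (K , σ′)) →
    J m a (cost t ρ + u) (compile γ r t ∷ K , σ)

  fold-correct : ∀ {s} (b : Term (2 + s)) (γ : Vec Var s) r (ρ : Vec Tree s) →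
    Below γ r → ∀ {m a u K} xs acc σ → Implements γ σ ρ → σ (1 + r) ≡ xs → σ r ≡ acc →
    (∀ σ′ → σ′ r ≡ foldTree (λ x y → eval b (x ∷ y ∷ ρ)) xs acc → Agree r σ σ′ → J m a u (K , σ′)) →
    J m a (foldCost (λ x y → eval b (x ∷ y ∷ ρ)) (λ x y → cost b (x ∷ y ∷ ρ)) xs acc + u)
      (while (var (1 + r))
        ((2 + r) ≔ hd (var (1 + r)) ⨾ compile ((2 + r) ∷ r ∷ γ) (3 + r) b ⨾
         r ≔ var (3 + r) ⨾ (1 + r) ≔ tl (var (1 + r))) ∷ K , σ)

  compile-correct leaf γ r ρ σ below im k =
    step-≔ r nil σ (k _ (update-same σ r nil) (agree-update σ r nil ℕ.≤-refl))
  compile-correct (ref i) γ r ρ σ below im k =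
    step-≔ r (var (lookup γ i)) σ
      (k _ (trans (update-same σ r _) (Pointwise.lookup im i)) (agree-update σ r _ ℕ.≤-refl))
  compile-correct (pair t u) γ r ρ σ below im {u = w} k =
    mono (ℕ.≤-reflexive (eq (cost t ρ) (cost u ρ) w)) (step-⨾ _ _ σ
    (compile-correct t γ r ρ σ below im λ σ₁ e₁ ag₁ →
     step-⨾ _ _ σ₁
    (compile-correct u γ (1 + r) ρ σ₁ (below-suc below) (implements-agree below ag₁ im) λ σ₂ e₂ ag₂ →
     step-≔ r (cons (var r) (var (1 + r))) σ₂
       (k _ (trans (update-same σ₂ r _) (cong₂ _∙_ (trans (ag₂ r ℕ.≤-refl) e₁) e₂))
          (agree-trans ag₁ (agree-trans (agree-≤ (ℕ.n≤1+n r) ag₂) (agree-update σ₂ r _ ℕ.≤-refl)))))))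
    where
    eq : ∀ x y w → 1 + (x + (1 + (y + (1 + w)))) ≡ 3 + (x + y) + w
    eq = solve-∀
  compile-correct (fst t) γ r ρ σ below im {u = w} k =
    mono (ℕ.≤-reflexive (cong suc (ℕ.+-suc (cost t ρ) w))) (step-⨾ _ _ σ
    (compile-correct t γ r ρ σ below im λ σ₁ e₁ ag₁ →
     step-≔ r (hd (var r)) σ₁
       (k _ (trans (update-same σ₁ r _) (trans (⟦hd⟧ (var r) σ₁) (cong left e₁)))
          (agree-trans ag₁ (agree-update σ₁ r _ ℕ.≤-refl)))))
  compile-correct (snd t) γ r ρ σ below im {u = w} k =
    mono (ℕ.≤-reflexive (cong suc (ℕ.+-suc (cost t ρ) w))) (step-⨾ _ _ σ
    (compile-correct t γ r ρ σ below im λ σ₁ e₁ ag₁ →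
     step-≔ r (tl (var r)) σ₁
       (k _ (trans (update-same σ₁ r _) (trans (⟦tl⟧ (var r) σ₁) (cong right e₁)))
          (agree-trans ag₁ (agree-update σ₁ r _ ℕ.≤-refl)))))
  compile-correct (cond c t u) γ r ρ σ below im {m} {a} {w} {K} k =
    mono (ℕ.≤-reflexive (eq (cost c ρ) (cost t ρ + cost u ρ) w)) (step-⨾ _ _ σ
    (compile-correct c γ r ρ σ below im λ σ₁ e₁ ag₁ →
     det λ _ → branch σ₁ e₁ ag₁))
    where
    eq : ∀ x y w → 1 + (x + (1 + (y + w))) ≡ 2 + (x + y) + w
    eq = solve-∀

    branch : ∀ σ₁ → σ₁ r ≡ eval c ρ → Agree r σ σ₁ →
      J m a (cost t ρ + cost u ρ + w)
        ((if decBool (σ₁ r) then compile γ r t else compile γ r u) ∷ K , σ₁)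
    branch σ₁ e₁ ag₁ rewrite e₁ with decBool (eval c ρ)
    ... | true  = mono (ℕ.+-monoˡ-≤ w (ℕ.m≤m+n (cost t ρ) (cost u ρ)))
      (compile-correct t γ r ρ σ₁ below (implements-agree below ag₁ im) λ σ₂ e₂ ag₂ →
        k σ₂ e₂ (agree-trans ag₁ ag₂))
    ... | false = mono (ℕ.+-monoˡ-≤ w (ℕ.m≤n+m (cost u ρ) (cost t ρ)))
      (compile-correct u γ r ρ σ₁ below (implements-agree below ag₁ im) λ σ₂ e₂ ag₂ →
        k σ₂ e₂ (agree-trans ag₁ ag₂))
  compile-correct (bind t u) γ r ρ σ below im {u = w} k =
    mono (ℕ.≤-reflexive (eq (cost t ρ) (cost u (eval t ρ ∷ ρ)) w)) (step-⨾ _ _ σ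
    (compile-correct t γ r ρ σ below im λ σ₁ e₁ ag₁ →
     step-⨾ _ _ σ₁
    (compile-correct u (r ∷ γ) (1 + r) (eval t ρ ∷ ρ) σ₁
       (ℕ.≤-refl ∷ below-suc below)
       (e₁ ∷ implements-agree below ag₁ im) λ σ₂ e₂ ag₂ →
     step-≔ r (var (1 + r)) σ₂
       (k _ (trans (update-same σ₂ r _) e₂)
          (agree-trans ag₁ (agree-trans (agree-≤ (ℕ.n≤1+n r) ag₂) (agree-update σ₂ r _ ℕ.≤-refl)))))))
    where
    eq : ∀ x y w → 1 + (x + (1 + (y + (1 + w)))) ≡ 3 + (x + y) + w
    eq = solve-∀
  compile-correct (fold l a b) γ r ρ σ below im {u = w} k =
    mono (ℕ.≤-reflexive (eq (cost a ρ) (cost l ρ) _ w)) (step-⨾ _ _ σ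
    (compile-correct a γ r ρ σ below im λ σ₁ e₁ ag₁ →
     step-⨾ _ _ σ₁
    (compile-correct l γ (1 + r) ρ σ₁ (below-suc below) (implements-agree below ag₁ im) λ σ₂ e₂ ag₂ →
     let ag = agree-trans ag₁ (agree-≤ (ℕ.n≤1+n r) ag₂) in
     fold-correct b γ r ρ below (eval l ρ) (eval a ρ) σ₂
       (implements-agree below ag im) e₂ (trans (ag₂ r ℕ.≤-refl) e₁)
       λ σ₃ e₃ ag₃ → k σ₃ e₃ (agree-trans ag ag₃))))
    where
    eq : ∀ x y f w → 1 + (x + (1 + (y + (f + w)))) ≡ 2 + (y + x) + f + w
    eq = solve-∀

  fold-correct b γ r ρ below nil acc σ im e₁ e₀ k = det λ _ →
    subst (λ v → J _ _ _ ((if decBool v then _ else _) , σ)) (sym e₁) (k σ e₀ λ _ _ → refl)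
  fold-correct b γ r ρ below {m} {a} {u} {K} (x ∙ xs) acc σ im e₁ e₀ k =
    det λ _ → subst (λ v → J m a _ ((if decBool v then body ∷ loop ∷ K else K) , σ)) (sym e₁) enter
    where
    body = (2 + r) ≔ hd (var (1 + r)) ⨾ compile ((2 + r) ∷ r ∷ γ) (3 + r) b ⨾
           r ≔ var (3 + r) ⨾ (1 + r) ≔ tl (var (1 + r))
    loop = while (var (1 + r)) body

    f : Tree → Tree → Tree
    f x y = eval b (x ∷ y ∷ ρ)
    g : Tree → Tree → ℕ
    g x y = cost b (x ∷ y ∷ ρ)

    eq : ∀ x f w → 3 + (x + (3 + (f + w))) ≡ 6 + x + f + w
    eq = solve-∀

    r<1+r : r < 1 + r
    r<1+r = ℕ.≤-refl
    r<2+r : r < 2 + r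
    r<2+r = ℕ.m≤n⇒m≤1+n r<1+r

    enter : J m a (6 + g x acc + foldCost f g xs (f x acc) + u) (body ∷ loop ∷ K , σ)
    enter =
      mono (ℕ.≤-reflexive (eq (g x acc) _ u)) (step-⨾ _ _ σ (step-≔ (2 + r) (hd (var (1 + r))) σ (step-⨾ _ _ _
      (compile-correct b ((2 + r) ∷ r ∷ γ) (3 + r) (x ∷ acc ∷ ρ) σ₁
        (ℕ.≤-refl ∷ ℕ.m≤n⇒m≤1+n r<2+r ∷ below-suc (below-suc (below-suc below)))
        (trans (update-same σ (2 + r) _) (trans (⟦hd⟧ (var (1 + r)) σ) (cong left e₁))
          ∷ trans (ag₁ r r<2+r) e₀
          ∷ implements-agree below (agree-≤ (ℕ.m≤n+m r 2) ag₁) im)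
        λ σ₂ e₂ ag₂ →
       let σ₃ = σ₂ [ r ↦ σ₂ (3 + r) ]
           σ₄ = σ₃ [ 1 + r ↦ ⟦ tl (var (1 + r)) ⟧ σ₃ ]
           ag₄ : Agree r σ₂ σ₄
           ag₄ = agree-trans (agree-update σ₂ r _ ℕ.≤-refl) (agree-update σ₃ (1 + r) _ (ℕ.n≤1+n r))
           ag = agree-trans (agree-trans (agree-≤ (ℕ.m≤n+m r 2) ag₁) (agree-≤ (ℕ.m≤n+m r 3) ag₂)) ag₄
           tail = trans (update-same σ₃ (1 + r) _) (trans (⟦tl⟧ (var (1 + r)) σ₃)
             (cong right (trans (update-other σ₂ r _ (1 + r) (ℕ.<⇒≢ r<1+r ∘ sym))
               (trans (ag₂ (1 + r) (ℕ.m≤n⇒m≤1+n ℕ.≤-refl)) (trans (ag₁ (1 + r) ℕ.≤-refl) e₁)))))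
           head = trans (update-other σ₃ (1 + r) _ r (ℕ.<⇒≢ r<1+r)) (trans (update-same σ₂ r _) e₂) in
       step-⨾ _ _ σ₂ (step-≔ r (var (3 + r)) σ₂ (step-≔ (1 + r) (tl (var (1 + r))) σ₃
         (fold-correct b γ r ρ below xs (f x acc) σ₄ (implements-agree below ag im) tail head
           λ σ₅ e₅ ag₅ → k σ₅ e₅ (agree-trans ag ag₅))))))))
      where
      σ₁ = σ [ 2 + r ↦ ⟦ hd (var (1 + r)) ⟧ σ ]
      ag₁ : Agree (2 + r) σ σ₁
      ag₁ = agree-update σ (2 + r) _ ℕ.≤-refl

-- Folds over encoded data

foldTree-enc : ∀ {A B : Set} (enc : A → Tree) (rep : B → Tree) (f : Tree → Tree → Tree) (g : B → A → B) →
  (∀ x b → f (enc x) (rep b) ≡ rep (g b x)) →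
  ∀ xs b → foldTree f (encList enc xs) (rep b) ≡ rep (foldl g b xs)
foldTree-enc enc rep f g step []       b = refl
foldTree-enc enc rep f g step (x ∷ xs) b rewrite step x b = foldTree-enc enc rep f g step xs (g b x)

-- A round has bounded cost only at accumulators that encode something, so the simulation by g is
-- carried along. Q restricts the elements, for instance to clauses of length at most k.
foldCost-enc : ∀ {A B : Set} (enc : A → Tree) (rep : B → Tree) (f : Tree → Tree → Tree)
  (c : Tree → Tree → ℕ) (g : B → A → B) (Q : A → Set) (w : ℕ) →
  (∀ x b → f (enc x) (rep b) ≡ rep (g b x)) → (∀ x b → Q x → c (enc x) (rep b) ≤ w) →
  ∀ xs b → All Q xs → foldCost f c (encList enc xs) (rep b) ≤ 1 + length xs * (7 + w)
foldCost-enc enc rep f c g Q w step bound []       b []       = ℕ.≤-refl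
foldCost-enc enc rep f c g Q w step bound (x ∷ xs) b (q ∷ qs) rewrite step x b =
  ℕ.≤-trans (ℕ.+-mono-≤ (ℕ.+-monoʳ-≤ 7 (bound x b q)) (foldCost-enc enc rep f c g Q w step bound xs (g b x) qs))
    (ℕ.≤-reflexive (ℕ.+-suc (7 + w) _))

foldCost-const : (f : Tree → Tree → Tree) (c : Tree → Tree → ℕ) (w : ℕ) →
  (∀ x a → c x a ≤ w) → ∀ xs a → foldCost f c xs a ≤ 1 + decℕ xs * (7 + w)
foldCost-const f c w bound nil      a = ℕ.≤-refl
foldCost-const f c w bound (x ∙ xs) a =
  ℕ.≤-trans (ℕ.+-mono-≤ (ℕ.+-monoʳ-≤ 7 (bound x a)) (foldCost-const f c w bound xs (f x a)))
    (ℕ.≤-reflexive (ℕ.+-suc (7 + w) _))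

decBool-encBool : ∀ b → decBool (encBool b) ≡ b
decBool-encBool false = refl
decBool-encBool true  = refl

decℕ-encℕ : ∀ n → decℕ (encℕ n) ≡ n
decℕ-encℕ zero    = refl
decℕ-encℕ (suc n) = cong suc (decℕ-encℕ n)

decℕ-encList : ∀ {A : Set} (enc : A → Tree) xs → decℕ (encList enc xs) ≡ length xs
decℕ-encList enc []       = refl
decℕ-encList enc (x ∷ xs) = cong suc (decℕ-encList enc xs)

encAssignment : ∀ {n} → Assignment n → Tree
encAssignment []      = nil
encAssignment (b ∷ z) = encBool b ∙ encAssignment z

decℕ-encAssignment : ∀ {n} (z : Assignment n) → decℕ (encAssignment z) ≡ n
decℕ-encAssignment []      = refl
decℕ-encAssignment (b ∷ z) = cong suc (decℕ-encAssignment z)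

one : ∀ {s} → Term s
one = pair leaf leaf

-- Literals and clauses

holds : ∀ {n} → Assignment n → Literal n → Bool
holds z (i , b) = if b then lookup z i else not (lookup z i)

opaque
  literalTerm : ∀ {s} → Fin s → Fin s → Term s
  literalTerm l y =
    bind (fst (fold (snd (ref l)) (ref y) (snd (ref 1F))))
      (cond (fst (ref (suc l))) (ref 0F) (cond (ref 0F) leaf one))

lookup-fold : ∀ {n} (z : Assignment n) i →
  left (foldTree (λ _ t → right t) (encℕ (toℕ i)) (encAssignment z)) ≡ encBool (lookup z i)
lookup-fold (b ∷ z) zero    = refl
lookup-fold (b ∷ z) (suc i) = lookup-fold z i

literalCost : ℕ → ℕ
literalCost n = 11 + (1 + n * 10 + 15)

module _ {n s} (ρ : Vec Tree s) (l y : Fin s) (z : Assignment n) (x : Literal n)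
         (l≡ : lookup ρ l ≡ encLiteral x) (y≡ : lookup ρ y ≡ encAssignment z) where

  opaque
    unfolding literalTerm
    eval-literal : eval (literalTerm l y) ρ ≡ encBool (holds z x)
    eval-literal rewrite l≡ | y≡ | lookup-fold z (proj₁ x) | decBool-encBool (proj₂ x)
                       | decBool-encBool (lookup z (proj₁ x)) with proj₂ x | lookup z (proj₁ x)
    ... | true  | true  = refl
    ... | true  | false = refl
    ... | false | true  = refl
    ... | false | false = refl

  opaque
    unfolding literalTerm
    cost-literal : cost (literalTerm l y) ρ ≤ literalCost n
    cost-literal rewrite l≡ | y≡ = ℕ.+-monoʳ-≤ 11 (ℕ.+-monoˡ-≤ 15
      (ℕ.≤-trans (foldCost-const _ _ 3 (λ _ _ → ℕ.≤-refl) (encℕ (toℕ (proj₁ x))) (encAssignment z))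
        (s≤s (ℕ.*-monoˡ-≤ 10 (ℕ.≤-trans (ℕ.≤-reflexive (decℕ-encℕ _)) (ℕ.<⇒≤ (Fin.toℕ<n (proj₁ x))))))))

clauseHolds : ∀ {n} → Assignment n → Clause n → Bool
clauseHolds z = any (holds z)

opaque
  clauseTerm : ∀ {s} → Fin s → Fin s → Term s
  clauseTerm c y = fold (ref c) leaf (cond (literalTerm 0F (2 ↑ʳ y)) one (ref 1F))

clauseCost : ℕ → ℕ → ℕ
clauseCost k n = 4 + (1 + k * (7 + (2 + (literalCost n + 6))))

encClause : ∀ {n} → Clause n → Tree
encClause = encList encLiteral

module _ {n s} (ρ : Vec Tree s) (c y : Fin s) (z : Assignment n) (C : Clause n)
         (c≡ : lookup ρ c ≡ encClause C) (y≡ : lookup ρ y ≡ encAssignment z) where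

  opaque
    unfolding clauseTerm
    eval-clause : eval (clauseTerm c y) ρ ≡ encBool (clauseHolds z C)
    eval-clause rewrite c≡ = go C false
      where
      go : ∀ C b → foldTree (λ x a → eval (cond (literalTerm 0F (2 ↑ʳ y)) one (ref 1F)) (x ∷ a ∷ ρ))
             (encClause C) (encBool b) ≡ encBool (b ∨ clauseHolds z C)
      go []      b = cong encBool (sym (Bool.∨-identityʳ b))
      go (l ∷ C) b rewrite eval-literal (encLiteral l ∷ encBool b ∷ ρ) 0F (2 ↑ʳ y) z l refl y≡
                         | decBool-encBool (holds z l) with holds z l
      ... | true  = trans (go C true) (cong encBool (sym (Bool.∨-zeroʳ b)))
      ... | false = go C b

  opaque
    unfolding clauseTerm
    cost-clause : ∀ {k} → length C ≤ k → cost (clauseTerm c y) ρ ≤ clauseCost k n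
    cost-clause {k} C≤k rewrite c≡ = ℕ.+-monoʳ-≤ 4 (ℕ.≤-trans
      (foldCost-enc encLiteral (λ t → t) _ _ (λ a x → _) (λ _ → ⊤) (2 + (literalCost n + 6)) (λ _ _ → refl)
        (λ x a _ → ℕ.+-monoʳ-≤ 2 (ℕ.+-monoˡ-≤ 6 (cost-literal (encLiteral x ∷ a ∷ ρ) 0F (2 ↑ʳ y) z x refl y≡)))
        C nil (All.universal _ C))
      (s≤s (ℕ.*-monoˡ-≤ _ C≤k)))

-- The first falsified clause.  The result [] stands for "none"; an empty
-- clause of an unsatisfiable formula is overlooked.
falsified : ∀ {n} → Assignment n → CNF n → Clause n
falsified z []            = []
falsified z ([]      ∷ F) = falsified z F
falsified z ((l ∷ C) ∷ F) = if clauseHolds z (l ∷ C) then falsified z F else l ∷ C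

opaque
  falsifiedTerm : ∀ {s} → Fin s → Fin s → Term s
  falsifiedTerm f y =
    fold (snd (ref f)) leaf (cond (ref 1F) (ref 1F) (cond (clauseTerm 0F (2 ↑ʳ y)) leaf (ref 0F)))

falsifiedCost : ℕ → ℕ → ℕ → ℕ
falsifiedCost k L n = 6 + (1 + L * (7 + (6 + (clauseCost k n + 2))))

length-falsified : ∀ {n k} (z : Assignment n) F → IsKCNF k F → length (falsified z F) ≤ k
length-falsified z []            []         = z≤n
length-falsified z ([]      ∷ F) (_ ∷ ps)   = length-falsified z F ps
length-falsified z ((l ∷ C) ∷ F) (p ∷ ps) with clauseHolds z (l ∷ C)
... | true  = length-falsified z F ps
... | false = p

module _ {n s} (ρ : Vec Tree s) (f y : Fin s) (z : Assignment n) (F : CNF n)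
         (f≡ : lookup ρ f ≡ encCNF F) (y≡ : lookup ρ y ≡ encAssignment z) where

  opaque
    unfolding falsifiedTerm
    eval-falsified : eval (falsifiedTerm f y) ρ ≡ encClause (falsified z F)
    eval-falsified rewrite f≡ = go F
      where
      step : Tree → Tree → Tree
      step x a = eval (cond (ref 1F) (ref 1F) (cond (clauseTerm 0F (2 ↑ʳ y)) leaf (ref 0F))) (x ∷ a ∷ ρ)

      keep : ∀ (F : CNF n) s t → foldTree step (encList encClause F) (s ∙ t) ≡ s ∙ t
      keep []      s t = refl
      keep (C ∷ F) s t = keep F s t

      go : ∀ (F : CNF n) → foldTree step (encList encClause F) nil ≡ encClause (falsified z F)
      go []            = refl
      go ([]      ∷ F) rewrite eval-clause (nil ∷ nil ∷ ρ) 0F (2 ↑ʳ y) z [] refl y≡ = go F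
      go ((l ∷ C) ∷ F) rewrite eval-clause (encClause (l ∷ C) ∷ nil ∷ ρ) 0F (2 ↑ʳ y) z (l ∷ C) refl y≡
                             | decBool-encBool (clauseHolds z (l ∷ C)) with clauseHolds z (l ∷ C)
      ... | true  = go F
      ... | false = keep F (encLiteral l) (encClause C)

  opaque
    unfolding falsifiedTerm
    cost-falsified : ∀ {k L} → IsKCNF k F → length F ≤ L → cost (falsifiedTerm f y) ρ ≤ falsifiedCost k L n
    cost-falsified {k} {L} kF F≤L rewrite f≡ = ℕ.+-monoʳ-≤ 6 (ℕ.≤-trans
      (foldCost-enc encClause (λ t → t) _ _ (λ a x → _) (λ C → length C ≤ k) (6 + (clauseCost k n + 2)) (λ _ _ → refl)
        (λ C a C≤k → ℕ.+-monoʳ-≤ 6 (ℕ.+-monoˡ-≤ 2 (cost-clause (encClause C ∷ a ∷ ρ) 0F (2 ↑ʳ y) z C refl y≡ C≤k)))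
        F nil kF)
      (s≤s (ℕ.*-monoˡ-≤ _ F≤L)))

assign : ∀ {n} → Assignment n → Literal n → Assignment n
assign z (i , b) = z [ i ]≔ b

-- A zipper moves along y, keeping the reversed prefix in its left component.
opaque
  assignTerm : ∀ {s} → Fin s → Fin s → Term s
  assignTerm l y =
    bind (fold (snd (ref l)) (pair leaf (ref y))
           (pair (pair (fst (snd (ref 1F))) (fst (ref 1F))) (snd (snd (ref 1F)))))
      (fold (fst (ref 0F)) (pair (fst (ref (suc l))) (snd (snd (ref 0F)))) (pair (ref 0F) (ref 1F)))

zipStep : Tree → Tree → Tree
zipStep _ t = (left (right t) ∙ left t) ∙ right (right t)

zip-fold : ∀ {n} (z : Assignment n) i b p →
  let t = foldTree zipStep (encℕ (toℕ i)) (p ∙ encAssignment z) in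
  foldTree _∙_ (left t) (encBool b ∙ right (right t)) ≡ foldTree _∙_ p (encAssignment (z [ i ]≔ b))
zip-fold (x ∷ z) zero    b p = refl
zip-fold (x ∷ z) (suc i) b p = zip-fold z i b (encBool x ∙ p)

zip-length : ∀ i p q → decℕ (left (foldTree zipStep (encℕ i) (p ∙ q))) ≡ i + decℕ p
zip-length zero    p q = refl
zip-length (suc i) p q = trans (zip-length i (left q ∙ p) (right q)) (ℕ.+-suc i (decℕ p))

assignCost : ℕ → ℕ
assignCost n = 3 + (10 + (1 + n * (7 + 19)) + (2 + (3 + 11) + (1 + n * (7 + 5))))

module _ {n s} (ρ : Vec Tree s) (l y : Fin s) (z : Assignment n) (x : Literal n)
         (l≡ : lookup ρ l ≡ encLiteral x) (y≡ : lookup ρ y ≡ encAssignment z) where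

  opaque
    unfolding assignTerm
    eval-assign : eval (assignTerm l y) ρ ≡ encAssignment (assign z x)
    eval-assign rewrite l≡ | y≡ = zip-fold z (proj₁ x) (proj₂ x) nil

  opaque
    unfolding assignTerm
    cost-assign : cost (assignTerm l y) ρ ≤ assignCost n
    cost-assign rewrite l≡ | y≡ = ℕ.+-monoʳ-≤ 3 (ℕ.+-mono-≤
      (ℕ.+-monoʳ-≤ 10 (ℕ.≤-trans
        (foldCost-const _ _ 19 (λ _ _ → ℕ.≤-refl) (encℕ (toℕ (proj₁ x))) (nil ∙ encAssignment z))
        (s≤s (ℕ.*-monoˡ-≤ 26 (ℕ.≤-trans (ℕ.≤-reflexive (decℕ-encℕ _)) i≤n)))))
      (ℕ.+-monoʳ-≤ 16 (ℕ.≤-trans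
        (foldCost-const _∙_ _ 5 (λ _ _ → ℕ.≤-refl)
          (left (foldTree zipStep (encℕ (toℕ (proj₁ x))) (nil ∙ encAssignment z))) _)
        (s≤s (ℕ.*-monoˡ-≤ 12 (ℕ.≤-trans (ℕ.≤-reflexive (zip-length (toℕ (proj₁ x)) nil (encAssignment z)))
          (ℕ.≤-trans (ℕ.≤-reflexive (ℕ.+-identityʳ _)) i≤n)))))))
      where
      i≤n : toℕ (proj₁ x) ≤ n
      i≤n = ℕ.<⇒≤ (Fin.toℕ<n (proj₁ x))

encAssignments : ∀ {n} → List (Assignment n) → Tree
encAssignments = encList encAssignment

expand : ∀ {n} → Assignment n → List (Assignment n) → Clause n → List (Assignment n)
expand z = foldl (λ ys l → assign z l ∷ ys)

opaque
  expandTerm : ∀ {s} → Fin s → Fin s → Term s → Term s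
  expandTerm c y a = fold (ref c) a (pair (assignTerm 0F (2 ↑ʳ y)) (ref 1F))

expandCost : ℕ → ℕ → ℕ → ℕ
expandCost k n a = 3 + a + (1 + k * (7 + (3 + (assignCost n + 1))))

module _ {n s} (ρ : Vec Tree s) (c y : Fin s) (a : Term s) (z : Assignment n) (C : Clause n)
         (c≡ : lookup ρ c ≡ encClause C) (y≡ : lookup ρ y ≡ encAssignment z) where

  opaque
    unfolding expandTerm
    eval-expand : ∀ ys → eval a ρ ≡ encAssignments ys →
      eval (expandTerm c y a) ρ ≡ encAssignments (expand z ys C)
    eval-expand ys a≡ rewrite c≡ | a≡ = foldTree-enc encLiteral encAssignments _ _
      (λ l b → cong (_∙ encAssignments b) (eval-assign (encLiteral l ∷ encAssignments b ∷ ρ) 0F (2 ↑ʳ y) z l refl y≡))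
      C ys

  opaque
    unfolding expandTerm
    cost-expand : ∀ {k} → length C ≤ k → cost (expandTerm c y a) ρ ≤ expandCost k n (cost a ρ)
    cost-expand {k} C≤k rewrite c≡ = ℕ.+-monoʳ-≤ (3 + cost a ρ) (ℕ.≤-trans
      (foldCost-enc encLiteral (λ t → t) _ _ (λ a x → _) (λ _ → ⊤) (3 + (assignCost n + 1)) (λ _ _ → refl)
        (λ x b _ → ℕ.+-monoʳ-≤ 3 (ℕ.+-monoˡ-≤ 1 (cost-assign (encLiteral x ∷ b ∷ ρ) 0F (2 ↑ʳ y) z x refl y≡)))
        C (eval a ρ) (All.universal _ C))
      (s≤s (ℕ.*-monoˡ-≤ _ C≤k)))

-- Recording solutions

distanceStep : Tree → Tree → Tree
distanceStep x a = right (left a) ∙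
  (if decBool (left (left a)) then (if decBool x then right a else nil ∙ right a)
   else (if decBool x then nil ∙ right a else right a))

opaque
  distanceTerm : ∀ {s} → Fin s → Fin s → Term s
  distanceTerm z w = snd (fold (ref z) (pair (ref w) leaf) (pair (snd (fst (ref 1F)))
    (cond (fst (fst (ref 1F))) (cond (ref 0F) (snd (ref 1F)) (pair leaf (snd (ref 1F))))
                               (cond (ref 0F) (pair leaf (snd (ref 1F))) (snd (ref 1F))))))

distance-fold : ∀ {n} (z w : Assignment n) c →
  right (foldTree distanceStep (encAssignment z) (encAssignment w ∙ encℕ c)) ≡ encℕ (d-H z w + c)
distance-fold []          []          c = refl
distance-fold (false ∷ z) (false ∷ w) c = distance-fold z w c
distance-fold (false ∷ z) (true  ∷ w) c = trans (distance-fold z w (suc c)) (cong encℕ (ℕ.+-suc (d-H z w) c))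
distance-fold (true  ∷ z) (false ∷ w) c = trans (distance-fold z w (suc c)) (cong encℕ (ℕ.+-suc (d-H z w) c))
distance-fold (true  ∷ z) (true  ∷ w) c = distance-fold z w c

d-H≤n : ∀ {n} (z w : Assignment n) → d-H z w ≤ n
d-H≤n []          []          = z≤n
d-H≤n (false ∷ z) (false ∷ w) = ℕ.m≤n⇒m≤1+n (d-H≤n z w)
d-H≤n (false ∷ z) (true  ∷ w) = s≤s (d-H≤n z w)
d-H≤n (true  ∷ z) (false ∷ w) = s≤s (d-H≤n z w)
d-H≤n (true  ∷ z) (true  ∷ w) = ℕ.m≤n⇒m≤1+n (d-H≤n z w)

distanceCost : ℕ → ℕ
distanceCost n = 10 + (1 + n * (7 + 41))

opaque
  unfolding distanceTerm
  cost-distance : ∀ {n s} (ρ : Vec Tree s) (z w : Fin s) → decℕ (lookup ρ z) ≤ n →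
    cost (distanceTerm z w) ρ ≤ distanceCost n
  cost-distance ρ z w len = ℕ.+-monoʳ-≤ 10 (ℕ.≤-trans
    (foldCost-const distanceStep _ 41 (λ _ _ → ℕ.≤-refl) (lookup ρ z) (lookup ρ w ∙ nil))
    (s≤s (ℕ.*-monoˡ-≤ 48 len)))

opaque
  unfolding distanceTerm
  eval-distance : ∀ {n s} (ρ : Vec Tree s) (i j : Fin s) (z w : Assignment n) →
    lookup ρ i ≡ encAssignment z → lookup ρ j ≡ encAssignment w →
    eval (distanceTerm i j) ρ ≡ encℕ (d-H z w)
  eval-distance ρ i j z w i≡ j≡ rewrite i≡ | j≡ =
    trans (distance-fold z w 0) (cong encℕ (ℕ.+-identityʳ _))

monusTerm : ∀ {s} → Fin s → Fin s → Term s
monusTerm a b = fold (ref b) (ref a) (snd (ref 1F))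

monus-fold : ∀ a b → foldTree (λ _ t → right t) (encℕ b) (encℕ a) ≡ encℕ (a ∸ b)
monus-fold a       zero    = refl
monus-fold zero    (suc b) = trans (monus-fold zero b) (cong encℕ (ℕ.0∸n≡0 b))
monus-fold (suc a) (suc b) = monus-fold a b

-- In `just (r , b)`, r is the first solution recorded, which never changes, and b the farthest from
-- r so far.
State : ℕ → Set
State n = Maybe (Assignment n × Assignment n)

encState : ∀ {n} → State n → Tree
encState nothing        = nil
encState (just (r , b)) = encAssignment r ∙ encAssignment b

ifZero_then_else_ : ∀ {A : Set} → ℕ → A → A → A
ifZero zero  then x else y = x
ifZero suc _ then x else y = y

improve : ∀ {n} → Assignment n → State n → State n
improve z nothing        = just (z , z)
improve z (just (r , b)) = ifZero (d-H r z ∸ d-H r b) then just (r , b) else just (r , z)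

opaque
  recordTerm : ∀ {s} → Fin s → Fin s → Term s
  recordTerm t y = cond (ref t)
    (bind (fst (ref t)) (bind (snd (ref (suc t)))
    (bind (distanceTerm 1F (2 ↑ʳ y)) (bind (distanceTerm 2F 1F)
    (cond (monusTerm 1F 0F) (pair (ref 3F) (ref (4 ↑ʳ y))) (ref (4 ↑ʳ t)))))))
    (pair (ref y) (ref y))

recordCost : ℕ → ℕ
recordCost n = 18 + (distanceCost n + (3 + (distanceCost n + (6 + (1 + n * (7 + 3) + 6)))) + 5)

opaque
  unfolding recordTerm
  eval-record : ∀ {n s} (ρ : Vec Tree s) (t y : Fin s) (st : State n) (z : Assignment n) →
    lookup ρ t ≡ encState st → lookup ρ y ≡ encAssignment z →
    eval (recordTerm t y) ρ ≡ encState (improve z st)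
  eval-record ρ t y nothing        z t≡ y≡ rewrite t≡ = cong₂ _∙_ y≡ y≡
  eval-record ρ t y (just (r , b)) z t≡ y≡
    rewrite t≡
          | eval-distance (encAssignment b ∷ encAssignment r ∷ ρ) 1F (2 ↑ʳ y) r z refl y≡
          | eval-distance (encℕ (d-H r z) ∷ encAssignment b ∷ encAssignment r ∷ ρ) 2F 1F r b refl refl
          | monus-fold (d-H r z) (d-H r b) | y≡
    with d-H r z ∸ d-H r b
  ... | zero  = refl
  ... | suc _ = refl

opaque
  unfolding recordTerm
  -- Both branches of a conditional are charged, so the comparison of distances has to be bounded in
  -- the state `nothing` too, where it is evaluated on `nil` and amounts to measuring empty
  -- assignments.
  cost-record : ∀ {n s} (ρ : Vec Tree s) (t y : Fin s) (st : State n) →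
    lookup ρ t ≡ encState st → cost (recordTerm t y) ρ ≤ recordCost n
  cost-record {n} ρ t y st t≡ = ℕ.+-monoʳ-≤ 18 (ℕ.+-monoˡ-≤ 5 (ℕ.+-mono-≤
    (cost-distance (right (lookup ρ t) ∷ left (lookup ρ t) ∷ ρ) 1F (2 ↑ʳ y) (ref≤n st t≡))
    (ℕ.+-monoʳ-≤ 3 (ℕ.+-mono-≤
      (cost-distance (new ∷ right (lookup ρ t) ∷ left (lookup ρ t) ∷ ρ) 2F 1F (ref≤n st t≡))
      (ℕ.+-monoʳ-≤ 6 (ℕ.+-monoˡ-≤ 6 (ℕ.≤-trans
        (foldCost-const (λ _ → right) _ 3 (λ _ _ → ℕ.≤-refl) (distance new) new)
        (s≤s (ℕ.*-monoˡ-≤ 10 (distance≤n st t≡ new))))))))))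
    where
    new : Tree
    new = eval (distanceTerm 1F (2 ↑ʳ y)) (right (lookup ρ t) ∷ left (lookup ρ t) ∷ ρ)

    ref≤n : ∀ (st : State n) → lookup ρ t ≡ encState st → decℕ (left (lookup ρ t)) ≤ n
    ref≤n nothing        t≡ rewrite t≡ = z≤n
    ref≤n (just (r , b)) t≡ rewrite t≡ = ℕ.≤-reflexive (decℕ-encAssignment r)

    distance : Tree → Tree
    distance d = eval (distanceTerm 2F 1F) (d ∷ right (lookup ρ t) ∷ left (lookup ρ t) ∷ ρ)

    distance≤n : ∀ (st : State n) → lookup ρ t ≡ encState st → ∀ d → decℕ (distance d) ≤ n
    distance≤n nothing        t≡ d
      rewrite t≡ | eval-distance (d ∷ nil ∷ nil ∷ ρ) 2F 1F [] [] refl refl = z≤n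
    distance≤n (just (r , b)) t≡ d
      rewrite t≡ | eval-distance (d ∷ encAssignment b ∷ encAssignment r ∷ ρ) 2F 1F r b refl refl
            | decℕ-encℕ (d-H r b) = d-H≤n r b

-- Local search, by breadth-first levels

encLevel : ∀ {n} → State n × List (Assignment n) → Tree
encLevel (st , ys) = encState st ∙ encAssignments ys

visit : ∀ {n} → CNF n → State n × List (Assignment n) → Assignment n → State n × List (Assignment n)
visit F (st , ys) z with falsified z F
... | []    = improve z st , ys
... | l ∷ C = st , expand z ys (l ∷ C)

opaque
  visitTerm : ∀ {s} → Fin s → Term (2 + s)
  visitTerm f =
    bind (falsifiedTerm (2 ↑ʳ f) 0F) (bind (fst (ref 2F))
    (cond (ref 1F) (pair (ref 0F) (expandTerm 1F 2F (snd (ref 3F))))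
                   (pair (recordTerm 0F 2F) (snd (ref 3F)))))

visitCost : ℕ → ℕ → ℕ → ℕ
visitCost k L n = 3 + (falsifiedCost k L n + (9 + (4 + expandCost k n 3 + (3 + (recordCost n + 3)))))

module _ {n s} (ρ : Vec Tree s) (f : Fin s) (F : CNF n) (f≡ : lookup ρ f ≡ encCNF F) where

  opaque
    unfolding visitTerm
    eval-visit : ∀ z x → eval (visitTerm f) (encAssignment z ∷ encLevel x ∷ ρ) ≡ encLevel (visit F x z)
    eval-visit z (st , ys)
      rewrite eval-falsified (encAssignment z ∷ encLevel (st , ys) ∷ ρ) (2 ↑ʳ f) 0F z F f≡ refl
      with falsified z F
    ... | [] = cong (_∙ encAssignments ys)
      (eval-record (encState st ∷ nil ∷ encAssignment z ∷ encLevel (st , ys) ∷ ρ) 0F 2F st z refl refl)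
    ... | l ∷ C = cong (encState st ∙_)
      (eval-expand (encState st ∷ encClause (l ∷ C) ∷ encAssignment z ∷ encLevel (st , ys) ∷ ρ)
        1F 2F (snd (ref 3F)) z (l ∷ C) refl refl ys refl)

  opaque
    unfolding visitTerm
    cost-visit : ∀ {k L} → IsKCNF k F → length F ≤ L → ∀ (z : Assignment n) (x : State n × List (Assignment n)) →
      cost (visitTerm f) (encAssignment z ∷ encLevel x ∷ ρ) ≤ visitCost k L n
    cost-visit {k} {L} kF F≤L z (st , ys) = ℕ.+-monoʳ-≤ 3 (ℕ.+-mono-≤
      (cost-falsified ρ₀ (2 ↑ʳ f) 0F z F f≡ refl kF F≤L)
      (ℕ.+-monoʳ-≤ 9 (ℕ.+-mono-≤
        (ℕ.+-monoʳ-≤ 4 (cost-expand ρ₁ 1F 2F (snd (ref 3F)) z (falsified z F)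
          (eval-falsified ρ₀ (2 ↑ʳ f) 0F z F f≡ refl) refl (length-falsified z F kF)))
        (ℕ.+-monoʳ-≤ 3 (ℕ.+-monoˡ-≤ 3 (cost-record ρ₁ 0F 2F st refl))))))
      where
      ρ₀ : Vec Tree (2 + s)
      ρ₀ = encAssignment z ∷ encLevel (st , ys) ∷ ρ
      ρ₁ : Vec Tree (4 + s)
      ρ₁ = encState st ∷ eval (falsifiedTerm (2 ↑ʳ f) 0F) ρ₀ ∷ ρ₀

nextLevel : ∀ {n} → CNF n → State n × List (Assignment n) → State n × List (Assignment n)
nextLevel F (st , ys) = foldl (visit F) (st , []) ys

opaque
  levelTerm : ∀ {s} → Fin s → Term (2 + s)
  levelTerm f = fold (snd (ref 1F)) (pair (fst (ref 1F)) leaf) (visitTerm (2 ↑ʳ f))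

levelCost : ℕ → ℕ → ℕ → ℕ → ℕ
levelCost k L n w = 12 + (1 + w * (7 + visitCost k L n))

module _ {n s} (ρ : Vec Tree s) (f : Fin s) (F : CNF n) (f≡ : lookup ρ f ≡ encCNF F) where

  opaque
    unfolding levelTerm
    eval-level : ∀ x lv → eval (levelTerm f) (x ∷ encLevel lv ∷ ρ) ≡ encLevel (nextLevel F lv)
    eval-level x (st , ys) = foldTree-enc encAssignment encLevel _ (visit F)
      (λ z lv → eval-visit (x ∷ encLevel (st , ys) ∷ ρ) (2 ↑ʳ f) F f≡ z lv) ys (st , [])

  opaque
    unfolding levelTerm
    cost-level : ∀ {k L} → IsKCNF k F → length F ≤ L → ∀ x (lv : State n × List (Assignment n)) →
      cost (levelTerm f) (x ∷ encLevel lv ∷ ρ) ≤ levelCost k L n (length (proj₂ lv))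
    cost-level {k} {L} kF F≤L x (st , ys) = ℕ.+-monoʳ-≤ 12
      (foldCost-enc encAssignment encLevel
        (λ u v → eval (visitTerm (2 ↑ʳ f)) (u ∷ v ∷ ρ₁)) (λ u v → cost (visitTerm (2 ↑ʳ f)) (u ∷ v ∷ ρ₁))
        (visit F) (λ _ → ⊤) (visitCost k L n)
        (λ z lv → eval-visit ρ₁ (2 ↑ʳ f) F f≡ z lv)
        (λ z lv _ → cost-visit ρ₁ (2 ↑ʳ f) F f≡ kF F≤L z lv)
        ys (st , []) (All.universal _ ys))
      where
      ρ₁ : Vec Tree (2 + s)
      ρ₁ = x ∷ encLevel (st , ys) ∷ ρ

search : ∀ {n} → CNF n → ℕ → State n × List (Assignment n) → State n × List (Assignment n)
search F zero    lv = lv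
search F (suc i) lv = search F i (nextLevel F lv)

length-expand : ∀ {n} (z : Assignment n) ys C → length (expand z ys C) ≡ length C + length ys
length-expand z ys []      = refl
length-expand z ys (l ∷ C) = trans (length-expand z (assign z l ∷ ys) C) (ℕ.+-suc (length C) (length ys))

length-nextLevel : ∀ {n k} (F : CNF n) → IsKCNF k F → ∀ (st : State n) ys →
  length (proj₂ (nextLevel F (st , ys))) ≤ length ys * k
length-nextLevel {n} {k} F kF st ys = ℕ.≤-trans (go st [] ys) (ℕ.≤-reflexive (ℕ.+-identityʳ _))
  where
  visit-length : ∀ (st : State n) next z → length (proj₂ (visit F (st , next) z)) ≤ k + length next
  visit-length st next z with falsified z F | length-falsified z F kF
  ... | []    | _  = ℕ.m≤n+m _ k
  ... | l ∷ C | C≤k = ℕ.≤-trans (ℕ.≤-reflexive (length-expand z next (l ∷ C))) (ℕ.+-monoˡ-≤ (length next) C≤k)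

  go : ∀ (st : State n) next ys → length (proj₂ (foldl (visit F) (st , next) ys)) ≤ length ys * k + length next
  go st next []       = ℕ.≤-refl
  go st next (z ∷ ys) = ℕ.≤-trans (go _ _ ys) (ℕ.≤-trans
    (ℕ.+-monoʳ-≤ (length ys * k) (visit-length st next z))
    (ℕ.≤-reflexive (eq (length ys * k) k (length next))))
    where
    eq : ∀ x y w → x + (y + w) ≡ y + x + w
    eq = solve-∀

levelCost-mono : ∀ k L n {w w′} → w ≤ w′ → levelCost k L n w ≤ levelCost k L n w′
levelCost-mono k L n w≤w′ = ℕ.+-monoʳ-≤ 13 (ℕ.*-monoˡ-≤ _ w≤w′)

module _ {n s} (ρ : Vec Tree s) (f : Fin s) (F : CNF n) (f≡ : lookup ρ f ≡ encCNF F) where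

  eval-search : ∀ i (lv : State n × List (Assignment n)) →
    foldTree (λ x y → eval (levelTerm f) (x ∷ y ∷ ρ)) (encℕ i) (encLevel lv) ≡ encLevel (search F i lv)
  eval-search zero    lv = refl
  eval-search (suc i) lv rewrite eval-level ρ f F f≡ nil lv = eval-search i (nextLevel F lv)

  -- As 1 ≤ k, the bound `length ys * k ^ i` on the width after the remaining levels also bounds the
  -- width of every level before, so each level is charged at the same w.
  cost-search : ∀ {k L} → IsKCNF k F → length F ≤ L → 1 ≤ k → ∀ w i (st : State n) ys → length ys * k ^ i ≤ w →
    foldCost (λ x y → eval (levelTerm f) (x ∷ y ∷ ρ)) (λ x y → cost (levelTerm f) (x ∷ y ∷ ρ))
      (encℕ i) (encLevel (st , ys)) ≤ 1 + i * (7 + levelCost k L n w)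
  cost-search kF F≤L 1≤k w zero    st ys len = ℕ.≤-refl
  cost-search {k} {L} kF F≤L 1≤k w (suc i) st ys len rewrite eval-level ρ f F f≡ nil (st , ys) =
    ℕ.≤-trans (ℕ.+-mono-≤
      (ℕ.+-monoʳ-≤ 7 (ℕ.≤-trans (cost-level ρ f F f≡ kF F≤L nil (st , ys)) (levelCost-mono k L n here≤w)))
      (cost-search kF F≤L 1≤k w i (proj₁ (nextLevel F (st , ys))) (proj₂ (nextLevel F (st , ys))) next≤w))
    (ℕ.≤-reflexive (ℕ.+-suc (7 + levelCost k L n w) _))
    where
    here≤w : length ys ≤ w
    here≤w = ℕ.≤-trans (ℕ.≤-trans (ℕ.≤-reflexive (sym (ℕ.*-identityʳ _)))
      (ℕ.*-monoʳ-≤ (length ys) (ℕ.≤-trans (ℕ.≤-reflexive (sym (ℕ.^-zeroˡ (suc i)))) (ℕ.^-monoˡ-≤ (suc i) 1≤k)))) len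

    next≤w : length (proj₂ (nextLevel F (st , ys))) * k ^ i ≤ w
    next≤w = ℕ.≤-trans (ℕ.*-monoˡ-≤ (k ^ i) (length-nextLevel F kF st ys))
      (ℕ.≤-trans (ℕ.≤-reflexive (ℕ.*-assoc (length ys) k (k ^ i))) len)

-- Unary arithmetic

num : ∀ {s} → ℕ → Term s
num zero    = leaf
num (suc c) = pair leaf (num c)

eval-num : ∀ {s} c (ρ : Vec Tree s) → eval (num c) ρ ≡ encℕ c
eval-num zero    ρ = refl
eval-num (suc c) ρ = cong (nil ∙_) (eval-num c ρ)

cost-num : ∀ {s} c (ρ : Vec Tree s) → cost (num c) ρ ≡ c * 4 + 1
cost-num zero    ρ = refl
cost-num (suc c) ρ = cong (4 +_) (cost-num c ρ)

conses : ∀ {s} → ℕ → Term s → Term s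
conses zero    t = t
conses (suc e) t = pair leaf (conses e t)

eval-conses : ∀ {s} e (t : Term s) ρ x → eval t ρ ≡ encℕ x → eval (conses e t) ρ ≡ encℕ (e + x)
eval-conses zero    t ρ x t≡ = t≡
eval-conses (suc e) t ρ x t≡ = cong (nil ∙_) (eval-conses e t ρ x t≡)

cost-conses : ∀ {s} e (t : Term s) ρ → cost (conses e t) ρ ≡ e * 4 + cost t ρ
cost-conses zero    t ρ = refl
cost-conses (suc e) t ρ = cong (4 +_) (cost-conses e t ρ)

-- groups b c n counts the elements of index c, c + (1 + b), c + 2 (1 + b), …
-- in a list of length n.  So groups b b n = ⌊ n / (1 + b) ⌋ and
-- groups b 0 n = ⌈ n / (1 + b) ⌉.
groups : ℕ → ℕ → ℕ → ℕ
groups b c       zero    = 0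
groups b zero    (suc n) = suc (groups b b n)
groups b (suc c) (suc n) = groups b c n

-- The accumulator pairs a countdown with the output. When the countdown is at zero, it is reset to
-- b and the output grows by e; thus division and multiplication by a constant happen in one pass.
groupsBody : ∀ {s} → ℕ → ℕ → Term (2 + s)
groupsBody b e = cond (fst (ref 1F)) (pair (snd (fst (ref 1F))) (snd (ref 1F)))
                                     (pair (num b) (conses e (snd (ref 1F))))

opaque
  groupsTerm : ∀ {s} → ℕ → ℕ → ℕ → Fin s → Term s
  groupsTerm b c e l = snd (fold (ref l) (pair (num c) leaf) (groupsBody b e))

groupsCost : ℕ → ℕ → ℕ → ℕ → ℕ
groupsCost b c e n = 8 + (c * 4 + 1 + 1) + (1 + n * (7 + (16 + (3 + ((b * 4 + 1) + (e * 4 + 3))))))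

groups-fold : ∀ {s} (ρ : Vec Tree s) b e c n o →
  right (foldTree (λ x y → eval (groupsBody b e) (x ∷ y ∷ ρ)) (encℕ n) (encℕ c ∙ encℕ o)) ≡ encℕ (groups b c n * e + o)
groups-fold ρ b e c       zero    o = refl
groups-fold ρ b e zero    (suc n) o
  rewrite eval-num b (nil ∷ (nil ∙ encℕ o) ∷ ρ)
        | eval-conses e (snd (ref 1F)) (nil ∷ (nil ∙ encℕ o) ∷ ρ) o refl =
  trans (groups-fold ρ b e b n (e + o)) (cong encℕ (eq (groups b b n * e) e o))
  where
  eq : ∀ x y w → x + (y + w) ≡ y + x + w
  eq = solve-∀
groups-fold ρ b e (suc c) (suc n) o = groups-fold ρ b e c n o

module _ {s} (ρ : Vec Tree s) (b c e : ℕ) (l : Fin s) (n : ℕ) (l≡ : lookup ρ l ≡ encℕ n) where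
  opaque
    unfolding groupsTerm

    eval-groups : eval (groupsTerm b c e l) ρ ≡ encℕ (groups b c n * e)
    eval-groups rewrite l≡ | eval-num c ρ = trans (groups-fold ρ b e c n 0) (cong encℕ (ℕ.+-identityʳ _))

    cost-groups : cost (groupsTerm b c e l) ρ ≤ groupsCost b c e n
    cost-groups rewrite l≡ | cost-num c ρ = ℕ.+-monoʳ-≤ (8 + (c * 4 + 1 + 1)) (ℕ.≤-trans
      (foldCost-const _ _ _ (λ x a → ℕ.≤-reflexive (body x a)) (encℕ n) _)
      (s≤s (ℕ.*-monoˡ-≤ _ (ℕ.≤-reflexive (decℕ-encℕ n)))))
      where
      body : ∀ x a → cost (groupsBody b e) (x ∷ a ∷ ρ) ≡ 16 + (3 + ((b * 4 + 1) + (e * 4 + 3)))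
      body x a rewrite cost-num b (x ∷ a ∷ ρ) | cost-conses e (snd (ref 1F)) (x ∷ a ∷ ρ) = refl

groupsCost-mono : ∀ b c e {n n′} → n ≤ n′ → groupsCost b c e n ≤ groupsCost b c e n′
groupsCost-mono b c e n≤n′ = ℕ.+-monoʳ-≤ (8 + (c * 4 + 1 + 1)) (s≤s (ℕ.*-monoˡ-≤ _ n≤n′))

opaque
  productTerm : ∀ {s} → Fin s → Fin s → Term s
  productTerm i j = fold (ref i) leaf (fold (ref (2 ↑ʳ j)) (ref 1F) (pair leaf (ref 1F)))

productCost : ℕ → ℕ → ℕ
productCost a b = 4 + (1 + a * (7 + (4 + (1 + b * 12))))

plus-fold : ∀ a b → foldTree (λ _ t → nil ∙ t) (encℕ a) (encℕ b) ≡ encℕ (a + b)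
plus-fold zero    b = refl
plus-fold (suc a) b = trans (plus-fold a (suc b)) (cong encℕ (ℕ.+-suc a b))

module _ {s} (ρ : Vec Tree s) (i j : Fin s) (a b : ℕ)
         (i≡ : lookup ρ i ≡ encℕ a) (j≡ : lookup ρ j ≡ encℕ b) where
  opaque
    unfolding productTerm

    eval-product : eval (productTerm i j) ρ ≡ encℕ (a * b)
    eval-product rewrite i≡ | j≡ = trans (go a 0) (cong encℕ (ℕ.+-identityʳ _))
      where
      go : ∀ a o → foldTree (λ _ y → foldTree (λ _ t → nil ∙ t) (encℕ b) y) (encℕ a) (encℕ o) ≡ encℕ (a * b + o)
      go zero    o = refl
      go (suc a) o rewrite plus-fold b o = trans (go a (b + o)) (cong encℕ (eq (a * b) b o))
        where
        eq : ∀ x y w → x + (y + w) ≡ y + x + w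
        eq = solve-∀

    cost-product : cost (productTerm i j) ρ ≤ productCost a b
    cost-product rewrite i≡ | j≡ = ℕ.+-monoʳ-≤ 4 (ℕ.≤-trans
      (foldCost-const _ _ (4 + (1 + b * 12)) (λ _ y → ℕ.+-monoʳ-≤ 4 (ℕ.≤-trans
        (foldCost-const _ _ 5 (λ _ _ → ℕ.≤-refl) (encℕ b) y) (s≤s (ℕ.*-monoˡ-≤ 12 (ℕ.≤-reflexive (decℕ-encℕ b))))))
        (encℕ a) nil)
      (s≤s (ℕ.*-monoˡ-≤ _ (ℕ.≤-reflexive (decℕ-encℕ a)))))

-- The parameters of the algorithm, for m = 1 + p and B = 1 + b:  the radius
-- of the local search, and half the number of trials.

radius : ℕ → ℕ → ℕ
radius p n = groups p p n * 1

-- ⌈ h / B ⌉ A, a multiplication by A / B that rounds up.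
stage : ℕ → ℕ → ℕ → ℕ
stage b A h = groups b 0 h * A

stages : ℕ → ℕ → ℕ → ℕ → ℕ
stages b A zero    h = h
stages b A (suc i) h = stages b A i (stage b A h)

-- Two factors n + 1 make up for the loss in the two applications of `largest-term`, the third for
-- the demand that each half of the trials fail with probability at most 1 / (n + 1). The constant
-- pays for rounding in exponents.
initial : ℕ → ℕ → ℕ
initial c₀ n = suc n * (suc n * (suc n * c₀))

trials : ℕ → ℕ → ℕ → ℕ → ℕ → ℕ
trials p b A c₀ n = stages b A (radius p n) (initial c₀ n)

opaque
  searchTerm : ℕ → Term 3
  searchTerm p = bind (fst (ref 0F)) (fst (fold (pair leaf (groupsTerm p p 1 0F))
    (pair (ref 2F) (pair (ref 3F) leaf)) (levelTerm 1F)))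

  trialsTerm : ℕ → ℕ → ℕ → ℕ → Term 1
  trialsTerm p b A c₀ =
    bind (fst (ref 0F)) (bind (pair leaf (ref 0F)) (bind (num c₀)
    (bind (productTerm 1F 0F) (bind (productTerm 2F 0F) (bind (productTerm 3F 0F)
    (bind (groupsTerm p p 1 5F)
    (bind (fold (ref 0F) (ref 1F) (groupsTerm b 0 A 1F))
    (fold (ref 0F) leaf (pair leaf (pair leaf (ref 1F)))))))))))

searchCost : ℕ → ℕ → ℕ → ℕ → ℕ
searchCost k L p n = 14 + (groupsCost p p 1 n + 9 +
  (1 + suc (radius p n) * (7 + levelCost k L n (1 * k ^ suc (radius p n)))))

-- One level more than the radius: a solution at depth R is recognised only when its own level is
-- visited.
trial : ∀ {n} → ℕ → CNF n → State n → Assignment n → State n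
trial {n} p F st z = proj₁ (search F (suc (radius p n)) (st , z ∷ []))

module _ {n} (p : ℕ) (F : CNF n) (st : State n) (z : Assignment n) where

  ρ₃ : Vec Tree 3
  ρ₃ = encCNF F ∷ encState st ∷ encAssignment z ∷ []

  opaque
    unfolding searchTerm

    eval-trial : eval (searchTerm p) ρ₃ ≡ encState (trial p F st z)
    eval-trial rewrite eval-groups (encℕ n ∷ ρ₃) p p 1 0F n refl
                     | eval-search (encℕ n ∷ ρ₃) 1F F refl (suc (radius p n)) (st , z ∷ []) = refl

    cost-trial : ∀ {k L} → IsKCNF k F → length F ≤ L → 1 ≤ k → cost (searchTerm p) ρ₃ ≤ searchCost k L p n
    cost-trial {k} {L} kF F≤L 1≤k = ℕ.+-monoʳ-≤ 14 (ℕ.+-mono-≤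
      (ℕ.+-monoˡ-≤ 9 (cost-groups (encℕ n ∷ ρ₃) p p 1 0F n refl)) levels)
      where
      levels : foldCost (λ x y → eval (levelTerm 1F) (x ∷ y ∷ encℕ n ∷ ρ₃))
        (λ x y → cost (levelTerm 1F) (x ∷ y ∷ encℕ n ∷ ρ₃))
        (nil ∙ eval (groupsTerm p p 1 0F) (encℕ n ∷ ρ₃)) (encLevel (st , z ∷ [])) ≤
        1 + suc (radius p n) * (7 + levelCost k L n (1 * k ^ suc (radius p n)))
      levels rewrite eval-groups (encℕ n ∷ ρ₃) p p 1 0F n refl =
        cost-search (encℕ n ∷ ρ₃) 1F F refl kF F≤L 1≤k _ (suc (radius p n)) st (z ∷ []) ℕ.≤-refl

eval-stages : ∀ {s} (ρ : Vec Tree s) b A i h →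
  foldTree (λ x y → eval (groupsTerm b 0 A 1F) (x ∷ y ∷ ρ)) (encℕ i) (encℕ h) ≡ encℕ (stages b A i h)
eval-stages ρ b A zero    h = refl
eval-stages ρ b A (suc i) h rewrite eval-groups (nil ∷ encℕ h ∷ ρ) b 0 A 1F h refl = eval-stages ρ b A i (stage b A h)

-- By `incr` the final number bounds all intermediate ones, so every stage can be charged at w.
cost-stages : ∀ {s} (ρ : Vec Tree s) b A → (∀ h → h ≤ stage b A h) → ∀ i h w → stages b A i h ≤ w →
  foldCost (λ x y → eval (groupsTerm b 0 A 1F) (x ∷ y ∷ ρ)) (λ x y → cost (groupsTerm b 0 A 1F) (x ∷ y ∷ ρ))
    (encℕ i) (encℕ h) ≤ 1 + i * (7 + groupsCost b 0 A w)
cost-stages ρ b A incr zero    h w h≤w = ℕ.≤-refl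
cost-stages ρ b A incr (suc i) h w h≤w rewrite eval-groups (nil ∷ encℕ h ∷ ρ) b 0 A 1F h refl =
  ℕ.≤-trans (ℕ.+-mono-≤
    (ℕ.+-monoʳ-≤ 7 (ℕ.≤-trans (cost-groups (nil ∷ encℕ h ∷ ρ) b 0 A 1F h refl)
      (groupsCost-mono b 0 A (ℕ.≤-trans (below (suc i) h) h≤w))))
    (cost-stages ρ b A incr i (stage b A h) w h≤w))
  (ℕ.≤-reflexive (ℕ.+-suc (7 + groupsCost b 0 A w) _))
  where
  below : ∀ i h → h ≤ stages b A i h
  below zero    h = ℕ.≤-refl
  below (suc i) h = ℕ.≤-trans (incr h) (below i (stage b A h))

double-fold : ∀ h x → foldTree (λ _ y → nil ∙ (nil ∙ y)) (encℕ h) (encℕ x) ≡ encℕ (h + h + x)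
double-fold zero    x = refl
double-fold (suc h) x = trans (double-fold h (2 + x)) (cong encℕ (eq h x))
  where
  eq : ∀ h x → h + h + (2 + x) ≡ suc h + suc h + x
  eq = solve-∀

trialsCost : ℕ → ℕ → ℕ → ℕ → ℕ → ℕ
trialsCost p b A c₀ n = 17 + (c₀ * 4 + 1 + (3 +
  (productCost (suc n) c₀ + (3 +
  (productCost (suc n) (suc n * c₀) + (3 +
  (productCost (suc n) (suc n * (suc n * c₀)) + (3 +
  (groupsCost p p 1 n + (3 +
  (4 + (1 + radius p n * (7 + groupsCost b 0 A (trials p b A c₀ n))) +
  (4 + (1 + trials p b A c₀ n * (7 + 9))))))))))))))

module _ {n} (p b A c₀ : ℕ) (F : CNF n) where

  private
    h₁ = suc n * c₀
    h₂ = suc n * h₁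
    h₃ = suc n * h₂

    ρ₁ : Vec Tree 2
    ρ₁ = encℕ n ∷ encCNF F ∷ []
    ρ₂ : Vec Tree 3
    ρ₂ = encℕ (suc n) ∷ ρ₁
    ρ₄ : Vec Tree 4
    ρ₄  = encℕ c₀ ∷ ρ₂
    ρ₅ : Vec Tree 5
    ρ₅ = encℕ h₁ ∷ ρ₄
    ρ₆ : Vec Tree 6
    ρ₆ = encℕ h₂ ∷ ρ₅
    ρ₇ : Vec Tree 7
    ρ₇ = encℕ h₃ ∷ ρ₆
    ρ₈ : Vec Tree 8
    ρ₈ = encℕ (radius p n) ∷ ρ₇

  opaque
    unfolding trialsTerm

    eval-trials : eval (trialsTerm p b A c₀) (encCNF F ∷ []) ≡ encℕ (trials p b A c₀ n + trials p b A c₀ n)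
    eval-trials rewrite eval-num c₀ ρ₂ | eval-product ρ₄ 1F 0F (suc n) c₀ refl refl
                      | eval-product ρ₅ 2F 0F (suc n) h₁ refl refl
                      | eval-product ρ₆ 3F 0F (suc n) h₂ refl refl
                      | eval-groups ρ₇ p p 1 5F n refl
                      | eval-stages ρ₈ b A (radius p n) h₃
                      | double-fold (trials p b A c₀ n) 0 = cong encℕ (ℕ.+-identityʳ _)

    cost-trials : (∀ h → h ≤ stage b A h) → cost (trialsTerm p b A c₀) (encCNF F ∷ []) ≤ trialsCost p b A c₀ n
    cost-trials incr rewrite cost-num c₀ ρ₂ | eval-num c₀ ρ₂
                      | eval-product ρ₄ 1F 0F (suc n) c₀ refl refl
                      | eval-product ρ₅ 2F 0F (suc n) h₁ refl refl
                      | eval-product ρ₆ 3F 0F (suc n) h₂ refl refl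
                      | eval-groups ρ₇ p p 1 5F n refl
                      | eval-stages ρ₈ b A (radius p n) h₃ =
      ℕ.+-monoʳ-≤ 17 (ℕ.+-monoʳ-≤ (c₀ * 4 + 1) (ℕ.+-monoʳ-≤ 3
        (ℕ.+-mono-≤ (cost-product ρ₄ 1F 0F (suc n) c₀ refl refl) (ℕ.+-monoʳ-≤ 3
        (ℕ.+-mono-≤ (cost-product ρ₅ 2F 0F (suc n) h₁ refl refl) (ℕ.+-monoʳ-≤ 3
        (ℕ.+-mono-≤ (cost-product ρ₆ 3F 0F (suc n) h₂ refl refl) (ℕ.+-monoʳ-≤ 3
        (ℕ.+-mono-≤ (cost-groups ρ₇ p p 1 5F n refl) (ℕ.+-monoʳ-≤ 3
        (ℕ.+-mono-≤ (ℕ.+-monoʳ-≤ 4 (cost-stages ρ₈ b A incr (radius p n) h₃ _ ℕ.≤-refl))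
        (ℕ.+-monoʳ-≤ 4 (ℕ.≤-trans (foldCost-const _ _ 9 (λ _ _ → ℕ.≤-refl) (encℕ (trials p b A c₀ n)) nil)
          (s≤s (ℕ.*-monoˡ-≤ 16 (ℕ.≤-reflexive (decℕ-encℕ (trials p b A c₀ n))))))))))))))))))

-- The main loop

sum : ∀ n → (Assignment n → ℕ) → ℕ
sum zero    f = f []
sum (suc n) f = sum n (λ y → f (false ∷ y) + f (true ∷ y))

-- The same sum in the order in which the program tosses its coins: the last
-- toss becomes the head.
sumFrom : ∀ {n} r {j} → r + j ≡ n → (Assignment n → ℕ) → Assignment j → ℕ
sumFrom zero    refl f y = f y
sumFrom (suc r) {j} eq f y =
  sumFrom r (trans (ℕ.+-suc r j) eq) f (false ∷ y) + sumFrom r (trans (ℕ.+-suc r j) eq) f (true ∷ y)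

-- Matches the recursion of `sum`, which splits off the head, that is, the last toss.
sumFrom-suc : ∀ {n} r {j} (eq : suc r + j ≡ suc n) (eq′ : r + j ≡ n) f (y : Assignment j) →
  sumFrom (suc r) eq f y ≡ sumFrom r eq′ (λ x → f (false ∷ x) + f (true ∷ x)) y
sumFrom-suc zero    refl refl f y = refl
sumFrom-suc (suc r) {j} eq eq′ f y = cong₂ _+_
  (sumFrom-suc r (trans (ℕ.+-suc (suc r) j) eq) (trans (ℕ.+-suc r j) eq′) f (false ∷ y))
  (sumFrom-suc r (trans (ℕ.+-suc (suc r) j) eq) (trans (ℕ.+-suc r j) eq′) f (true ∷ y))

sumFrom-[] : ∀ n (eq : n + 0 ≡ n) f → sumFrom n eq f [] ≡ sum n f
sumFrom-[] zero    refl f = refl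
sumFrom-[] (suc n) eq   f = trans (sumFrom-suc n eq (ℕ.+-identityʳ n) f []) (sumFrom-[] n (ℕ.+-identityʳ n) _)

-- Registers of the loop: 0 the formula, 1 the trials left, 2 the state, 3 the tosses left, 4 the
-- sample point, 5 the coin and later the result of the local search.
tossBody : Cmd
tossBody = toss 5 ⨾ 4 ≔ cons (var 5) (var 4) ⨾ 3 ≔ tl (var 3)

trialBody : ℕ → Cmd
trialBody p = 3 ≔ hd (var 0) ⨾ 4 ≔ nil ⨾ while (var 3) tossBody ⨾
  compile (0 ∷ 2 ∷ 4 ∷ []) 5 (searchTerm p) ⨾ 2 ≔ var 5 ⨾ 1 ≔ tl (var 1)

program : ℕ → ℕ → ℕ → ℕ → Cmd
program p b A c₀ = compile (0 ∷ []) 1 (trialsTerm p b A c₀) ⨾ 2 ≔ nil ⨾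
  while (var 1) (trialBody p) ⨾ 0 ≔ var 2

trialTime : ℕ → ℕ → ℕ → ℕ → ℕ
trialTime k L p n = 7 + n * 6 + (searchCost k L p n + 4)

programTime : ℕ → ℕ → ℕ → ℕ → ℕ → ℕ → ℕ → ℕ
programTime k L p b A c₀ n = 1 + (trialsCost p b A c₀ n +
  (4 + (trials p b A c₀ n + trials p b A c₀ n) * trialTime k L p n + 1))

-- When w is the indicator of success, this is the number of successful ones among the 2 ^ (N * n)
-- toss sequences of N trials.
count : ∀ {n} → ℕ → CNF n → (State n → ℕ) → ℕ → State n → ℕ
count     p F w zero    st = w st
count {n} p F w (suc N) st = sum n (λ z → count p F w N (trial p F st z))

module Loop {δ : Presentation} (judgement : Judgement δ) where
  open Judgement judgement
  open Compile judgement

  reweigh : ∀ {m a a′ t c} → a ≡ a′ → J m a t c → J m a′ t c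
  reweigh refl j = j

  while-exit : ∀ {m a u K} x c σ → σ x ≡ nil → J m a u (K , σ) → J m a (1 + u) (while (var x) c ∷ K , σ)
  while-exit x c σ eq j = det λ _ → subst (λ v → J _ _ _ ((if decBool v then _ else _) , σ)) (sym eq) j

  while-enter : ∀ {m a u K s t} x c σ → σ x ≡ s ∙ t →
    J m a u (c ∷ while (var x) c ∷ K , σ) → J m a (1 + u) (while (var x) c ∷ K , σ)
  while-enter x c σ eq j = det λ _ → subst (λ v → J _ _ _ ((if decBool v then _ else _) , σ)) (sym eq) j

  toss-loop : ∀ {n m u K} r {j} (eq : r + j ≡ n) (y : Assignment j) σ (f : Assignment n → ℕ) →
    σ 3 ≡ encℕ r → σ 4 ≡ encAssignment y →
    (∀ z σ′ → σ′ 4 ≡ encAssignment z → Agree 3 σ σ′ → J m (f z) u (K , σ′)) →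
    J (r + m) (sumFrom r eq f y) (1 + r * 6 + u) (while (var 3) tossBody ∷ K , σ)
  toss-loop zero    refl y σ f r≡ y≡ k = while-exit 3 tossBody σ r≡ (k y σ y≡ λ _ _ → refl)
  toss-loop {u = u} (suc r) {j} eq y σ f r≡ y≡ k = while-enter 3 tossBody σ r≡
    (step-⨾ _ _ σ (coin (λ b → sumFrom r (trans (ℕ.+-suc r j) eq) f (b ∷ y)) λ b →
      let σ₁ = σ [ 5 ↦ encBool b ]
          σ₂ = σ₁ [ 4 ↦ encBool b ∙ σ 4 ]
          σ₃ = σ₂ [ 3 ↦ ⟦ tl (var 3) ⟧ σ₂ ] in
      step-⨾ _ _ σ₁ (step-≔ 4 (cons (var 5) (var 4)) σ₁ (step-≔ 3 (tl (var 3)) σ₂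
        (toss-loop r (trans (ℕ.+-suc r j) eq) (b ∷ y) σ₃ f
          (trans (⟦tl⟧ (var 3) σ₂) (cong right r≡)) (cong (encBool b ∙_) y≡)
          λ z σ′ z≡ ag → k z σ′ z≡ (agree-trans
            (agree-trans (agree-update σ 5 _ (ℕ.m≤m+n 3 2)) (agree-update σ₁ 4 _ (ℕ.m≤m+n 3 1)))
            (agree-trans (agree-update σ₂ 3 _ ℕ.≤-refl) ag)))))))

  module _ {n k L} (p : ℕ) (F : CNF n) (kF : IsKCNF k F) (F≤L : length F ≤ L) (1≤k : 1 ≤ k) (w : State n → ℕ) where

    trial-loop : ∀ {u K} N st σ → σ 0 ≡ encCNF F → σ 1 ≡ encℕ N → σ 2 ≡ encState st →
      (∀ st′ σ′ → σ′ 2 ≡ encState st′ → J 0 (w st′) u (K , σ′)) →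
      J (N * n) (count p F w N st) (1 + N * trialTime k L p n + u) (while (var 1) (trialBody p) ∷ K , σ)
    trial-loop zero    st σ F≡ N≡ st≡ cont = while-exit 1 (trialBody p) σ N≡ (cont st σ st≡)
    trial-loop {u} {K} (suc N) st σ F≡ N≡ st≡ cont = mono (ℕ.≤-reflexive (eq n (searchCost k L p n) _ u))
      (while-enter 1 (trialBody p) σ N≡ (step-⨾ _ _ σ (step-≔ 3 (hd (var 0)) σ (step-⨾ _ _ σ₁ (step-≔ 4 nil σ₁
      (step-⨾ _ _ σ₂ (reweigh (sumFrom-[] n (ℕ.+-identityʳ n) _)
      (toss-loop n (ℕ.+-identityʳ n) [] σ₂ (λ z → count p F w N (trial p F st z))
        (trans (⟦hd⟧ (var 0) σ) (cong left F≡)) refl λ z σ₃ z≡ ag₃ →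
      step-⨾ _ _ σ₃ (mono (ℕ.+-monoˡ-≤ _ (cost-trial p F st z kF F≤L 1≤k))
      (compile-correct (searchTerm p) (0 ∷ 2 ∷ 4 ∷ []) 5 (ρ₃ p F st z) σ₃
        (ℕ.m≤m+n 1 4 ∷ ℕ.m≤m+n 3 2 ∷ ℕ.m≤m+n 5 0 ∷ [])
        (trans (ag₃ 0 (ℕ.m≤m+n 1 2)) F≡ ∷ trans (ag₃ 2 (ℕ.m≤m+n 3 0)) st≡ ∷ z≡ ∷ []) λ σ₄ e₄ ag₄ →
      let σ₅ = σ₄ [ 2 ↦ σ₄ 5 ]
          σ₆ = σ₅ [ 1 ↦ ⟦ tl (var 1) ⟧ σ₅ ] in
      step-⨾ _ _ σ₄ (step-≔ 2 (var 5) σ₄ (step-≔ 1 (tl (var 1)) σ₅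
      (trial-loop N (trial p F st z) σ₆
        (trans (ag₄ 0 (ℕ.m≤m+n 1 4)) (trans (ag₃ 0 (ℕ.m≤m+n 1 2)) F≡))
        (trans (⟦tl⟧ (var 1) σ₅) (cong right (trans (ag₄ 1 (ℕ.m≤m+n 2 3)) (trans (ag₃ 1 (ℕ.m≤m+n 2 1)) N≡))))
        (trans e₄ (eval-trial p F st z)) cont)))))))))))))
      where
      σ₁ = σ [ 3 ↦ ⟦ hd (var 0) ⟧ σ ]
      σ₂ = σ₁ [ 4 ↦ nil ]

      eq : ∀ n c x u → 1 + (1 + (1 + (1 + (1 + (1 + (1 + n * 6 + (1 + (c + (1 + (1 + (1 + (1 + x + u))))))))))))
         ≡ 1 + (7 + n * 6 + (c + 4) + x) + u
      eq = solve-∀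

    program-judgement : ∀ b A c₀ → (∀ h → h ≤ stage b A h) →
      (∀ st σ → σ 0 ≡ encState st → J 0 (w st) 0 ([] , σ)) →
      let N = trials p b A c₀ n + trials p b A c₀ n in
      J (N * n) (count p F w N nothing) (programTime k L p b A c₀ n) (start (program p b A c₀) (encCNF F))
    program-judgement b A c₀ incr cont = mono (ℕ.≤-reflexive (cong suc (cong (λ x → trialsCost p b A c₀ n + x) (eq _))))
      (step-⨾ _ _ _ (mono (ℕ.+-monoˡ-≤ _ (cost-trials p b A c₀ F incr))
      (compile-correct (trialsTerm p b A c₀) (0 ∷ []) 1 (encCNF F ∷ []) _ (ℕ.≤-refl ∷ []) (refl ∷ []) λ σ₁ e₁ ag₁ →
      let σ₂ = σ₁ [ 2 ↦ nil ] in
      step-⨾ _ _ σ₁ (step-≔ 2 nil σ₁ (step-⨾ _ _ σ₂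
      (trial-loop _ nothing σ₂ (ag₁ 0 ℕ.≤-refl) (trans e₁ (eval-trials p b A c₀ F)) refl λ st σ₃ st≡ →
      step-≔ 0 (var 2) σ₃ (cont st _ st≡)))))))
      where
      eq : ∀ x → 1 + (1 + (1 + (1 + x + 1))) ≡ 4 + x + 1
      eq = solve-∀

-- Halting and probability

halting : (δ : Presentation) → Judgement δ
halting δ = record
  { J    = λ _ _ t c → HaltsWithin δ t c
  ; det  = λ j → j
  ; coin = λ _ j → j
  ; mono = λ {_} {_} {t} {t′} → go t t′ _
  }
  where
  go : ∀ t t′ c → t ≤ t′ → HaltsWithin δ t c → HaltsWithin δ t′ c
  go t       t′       ([]    , σ) le       h = h
  go (suc t) (suc t′) (c ∷ K , σ) (s≤s le) h = λ b → go t t′ _ le (h b)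

ι : ℕ → ℚ
ι a = ℤ.+ a ℚ./ 1

-- `ι a` in lowest terms, a form on which the operations of ℚ compute.
ιℤ : ℕ → ℚ
ιℤ a = mkℚ (ℤ.+ a) 0 (coprime-sym (1-coprimeTo a))

ι≡ιℤ : ∀ a → ι a ≡ ιℤ a
ι≡ιℤ a = ℚ.↥p/↧p≡p (ιℤ a)

ι-+ : ∀ a b → ι (a + b) ≡ ι a ℚ.+ ι b
ι-+ a b rewrite ι≡ιℤ a | ι≡ιℤ b = cong (ℚ._/ 1) (cong₂ ℤ._+_ (sym (ℤ.*-identityʳ (ℤ.+ a))) (sym (ℤ.*-identityʳ (ℤ.+ b))))

ι-* : ∀ a b → ι (a * b) ≡ ι a ℚ.* ι b
ι-* a b rewrite ι≡ιℤ a | ι≡ιℤ b = cong (ℚ._/ 1) (ℤ.pos-* a b)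

ι-mono : ∀ {a b} → a ≤ b → ι a ℚ.≤ ι b
ι-mono {a} {b} a≤b rewrite ι≡ιℤ a | ι≡ιℤ b =
  ℚ.*≤* (ℤ.*-monoʳ-≤-nonNeg (ℤ.+ 1) (ℤ.+≤+ a≤b))

ι-nonNeg : ∀ a → ℚ.NonNegative (ι a)
ι-nonNeg a = ℚ.normalize-nonNeg a 1

half-double : ∀ p → ½ ℚ.* (p ℚ.+ p) ≡ p
half-double p = trans (ℚ.*-distribˡ-+ ½ p p)
  (trans (sym (ℚ.*-distribʳ-+ p ½ ½)) (ℚ.*-identityˡ p))

double-half : ∀ p → ι 2 ℚ.* (½ ℚ.* p) ≡ p
double-half p = trans (sym (ℚ.*-assoc (ι 2) ½ p)) (ℚ.*-identityˡ p)

half-mono : ∀ {p q} → p ℚ.≤ q → ½ ℚ.* p ℚ.≤ ½ ℚ.* q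
half-mono = ℚ.*-monoˡ-≤-nonNeg ½

module _ (δ : Presentation) {P : Tree → Set} (P? : Decidable P) where
  open Run δ using (step)

  Pr-nonneg : ∀ t c → 0ℚ ℚ.≤ Pr δ t c P?
  Pr-nonneg t ([] , σ) with does (P? (σ 0))
  ... | true  = ℚ.nonNegative⁻¹ 1ℚ
  ... | false = ℚ.≤-refl
  Pr-nonneg zero    (c ∷ K , σ) = ℚ.≤-refl
  Pr-nonneg (suc t) (c ∷ K , σ) = ℚ.≤-trans (ℚ.≤-reflexive (sym (ℚ.*-zeroʳ ½)))
    (half-mono (ℚ.+-mono-≤ (Pr-nonneg t (step false c K σ)) (Pr-nonneg t (step true c K σ))))

  Pr-mono : ∀ t t′ c → t ≤ t′ → Pr δ t c P? ℚ.≤ Pr δ t′ c P?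
  Pr-mono t       t′       ([]    , σ) le       = ℚ.≤-refl
  Pr-mono zero    t′       (c ∷ K , σ) le       = Pr-nonneg t′ (c ∷ K , σ)
  Pr-mono (suc t) (suc t′) (c ∷ K , σ) (s≤s le) = half-mono
    (ℚ.+-mono-≤ (Pr-mono t t′ (step false c K σ) le) (Pr-mono t t′ (step true c K σ) le))

  probability : Judgement δ
  probability = record
    { J    = λ m a t c → ι a ℚ.≤ ι (2 ^ m) ℚ.* Pr δ t c P?
    -- `Pr` halves the sum over both coins. Without a counted coin this averages two equal bounds;
    -- with one, the factor ½ is absorbed by 2 ^ (1 + m) and the favourable outcomes add up.
    ; det  = λ {m} {a} {t} {c} {K} {σ} j → average m a _ _ (j false) (j true)
    ; coin = λ {m} {t} {c} {K} {σ} a j → total m (a false) (a true) _ _ (j false) (j true)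
    ; mono = λ {m} {a} {t} {t′} {c} le j → ℚ.≤-trans j
        (ℚ.*-monoˡ-≤-nonNeg (ι (2 ^ m)) {{ι-nonNeg (2 ^ m)}} (Pr-mono t t′ c le))
    }
    where
    total : ∀ m a b p q → ι a ℚ.≤ ι (2 ^ m) ℚ.* p → ι b ℚ.≤ ι (2 ^ m) ℚ.* q →
      ι (a + b) ℚ.≤ ι (2 ^ suc m) ℚ.* (½ ℚ.* (p ℚ.+ q))
    total m a b p q le₁ le₂ = ℚ.≤-trans (ℚ.≤-reflexive (ι-+ a b)) (ℚ.≤-trans (ℚ.+-mono-≤ le₁ le₂)
      (ℚ.≤-reflexive (trans (sym (ℚ.*-distribˡ-+ (ι (2 ^ m)) p q)) (sym eq))))
      where
      eq : ι (2 ^ suc m) ℚ.* (½ ℚ.* (p ℚ.+ q)) ≡ ι (2 ^ m) ℚ.* (p ℚ.+ q)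
      eq = trans (cong (ℚ._* (½ ℚ.* (p ℚ.+ q))) (trans (ι-* 2 (2 ^ m)) (ℚ.*-comm (ι 2) (ι (2 ^ m)))))
        (trans (ℚ.*-assoc (ι (2 ^ m)) (ι 2) _) (cong (ι (2 ^ m) ℚ.*_) (double-half (p ℚ.+ q))))

    average : ∀ m a p q → ι a ℚ.≤ ι (2 ^ m) ℚ.* p → ι a ℚ.≤ ι (2 ^ m) ℚ.* q →
      ι a ℚ.≤ ι (2 ^ m) ℚ.* (½ ℚ.* (p ℚ.+ q))
    average m a p q le₁ le₂ = ℚ.≤-trans (ℚ.≤-reflexive (sym (half-double (ι a))))
      (ℚ.≤-trans (half-mono (ℚ.+-mono-≤ le₁ le₂)) (ℚ.≤-reflexive
        (trans (cong (½ ℚ.*_) (sym (ℚ.*-distribˡ-+ (ι (2 ^ m)) p q)))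
        (trans (sym (ℚ.*-assoc ½ (ι (2 ^ m)) _)) (trans (cong (ℚ._* (p ℚ.+ q)) (ℚ.*-comm ½ (ι (2 ^ m))))
          (ℚ.*-assoc (ι (2 ^ m)) ½ _))))))

-- Correctness of the local search

¬holds : ∀ {n} → Assignment n → Literal n → Set
¬holds z l = lookup z (proj₁ l) ≢ proj₂ l

holds-true : ∀ {n} (z : Assignment n) l → holds z l ≡ true → lookup z (proj₁ l) ≡ proj₂ l
holds-true z (i , true)  eq = eq
holds-true z (i , false) eq with lookup z i
... | false = refl

holds-false : ∀ {n} (z : Assignment n) l → holds z l ≡ false → ¬holds z l
holds-false z (i , true)  eq with lookup z i
... | false = λ ()
holds-false z (i , false) eq with lookup z i
... | true = λ ()

clauseHolds-true : ∀ {n} (z : Assignment n) C → clauseHolds z C ≡ true →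
  Any (λ l → lookup z (proj₁ l) ≡ proj₂ l) C
clauseHolds-true z (l ∷ C) eq with holds z l in h
... | true  = here (holds-true z l h)
... | false = there (clauseHolds-true z C eq)

clauseHolds-false : ∀ {n} (z : Assignment n) C → clauseHolds z C ≡ false → All (¬holds z) C
clauseHolds-false z []      eq = []
clauseHolds-false z (l ∷ C) eq with holds z l in h
... | false = holds-false z l h ∷ clauseHolds-false z C eq

any-all : ∀ {A : Set} {P Q : A → Set} {xs} → Any P xs → All Q xs → ∃ λ x → x ∈ xs × P x × Q x
any-all (here p)  (q ∷ _)  = _ , here refl , p , q
any-all (there p) (_ ∷ qs) with any-all p qs
... | x , x∈ , px , qx = x , there x∈ , px , qx

-- The solution z excludes empty clauses, so the result [] does mean that w is a solution. A clause
-- that holds at z and fails at w has a literal on which they differ, and making it true moves w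
-- towards z.
falsified-correct : ∀ {n} (w z : Assignment n) F → z ⊨ F →
  (falsified w F ≡ [] × w ⊨ F) ⊎
  (∃ λ l → l ∈ falsified w F × lookup z (proj₁ l) ≡ proj₂ l × ¬holds w l)
falsified-correct w z []            []       = inj₁ (refl , [])
falsified-correct w z ((l ∷ C) ∷ F) (p ∷ ps) with clauseHolds w (l ∷ C) in h
... | false = inj₂ (any-all p (clauseHolds-false w (l ∷ C) h))
... | true with falsified-correct w z F ps
...   | inj₁ (eq , sat) = inj₁ (eq , clauseHolds-true w (l ∷ C) h ∷ sat)
...   | inj₂ found      = inj₂ found

bit : Bool → ℕ
bit false = 0
bit true  = 1

d-H-∷ : ∀ {n} a b (x y : Assignment n) → d-H (a ∷ x) (b ∷ y) ≡ bit (a xor b) + d-H x y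
d-H-∷ false false x y = refl
d-H-∷ false true  x y = refl
d-H-∷ true  false x y = refl
d-H-∷ true  true  x y = refl

d-H-assign : ∀ {n} (w z : Assignment n) l → lookup z (proj₁ l) ≡ proj₂ l → ¬holds w l →
  suc (d-H (assign w l) z) ≡ d-H w z
d-H-assign (a ∷ w) (b ∷ z) (zero , .b) refl a≢b
  rewrite d-H-∷ b b w z | d-H-∷ a b w z = cong (_+ d-H w z) (flip a b a≢b)
  where
  flip : ∀ a b → a ≢ b → suc (bit (b xor b)) ≡ bit (a xor b)
  flip false false ne = ⊥-elim (ne refl)
  flip false true  ne = refl
  flip true  false ne = refl
  flip true  true  ne = ⊥-elim (ne refl)
d-H-assign (a ∷ w) (b ∷ z) (suc i , c) z≡ w≢
  rewrite d-H-∷ a b (assign w (i , c)) z | d-H-∷ a b w z =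
  trans (sym (ℕ.+-suc (bit (a xor b)) _)) (cong (bit (a xor b) +_) (d-H-assign w z (i , c) z≡ w≢))

-- w lies in the subcube spanned by y and z; in particular it agrees with both wherever they agree.
Between : ∀ {n} → Assignment n → Assignment n → Assignment n → Set
Between y w z = ∀ i → lookup w i ≡ lookup z i ⊎ lookup w i ≡ lookup y i

between-assign : ∀ {n} (y w z : Assignment n) l → lookup z (proj₁ l) ≡ proj₂ l →
  Between y w z → Between y (assign w l) z
between-assign y w z (i , b) z≡ btw j with i Fin.≟ j
... | yes refl = inj₁ (trans (Vec.lookup∘updateAt i w) (sym z≡))
... | no  i≢j with btw j
...   | inj₁ eq = inj₁ (trans (Vec.lookup∘updateAt′ j i (i≢j ∘ sym) w) eq)
...   | inj₂ eq = inj₂ (trans (Vec.lookup∘updateAt′ j i (i≢j ∘ sym) w) eq)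

expand-grows : ∀ {n} (z : Assignment n) ys C {w} → w ∈ ys → w ∈ expand z ys C
expand-grows z ys []      w∈ = w∈
expand-grows z ys (l ∷ C) w∈ = expand-grows z (assign z l ∷ ys) C (there w∈)

∈-expand : ∀ {n} (z : Assignment n) ys C {l} → l ∈ C → assign z l ∈ expand z ys C
∈-expand z ys (l ∷ C) (here refl) = expand-grows z (assign z l ∷ ys) C (here refl)
∈-expand z ys (l ∷ C) (there l∈)  = ∈-expand z (assign z l ∷ ys) C l∈

module _ {n} (F : CNF n) (z : Assignment n) (z⊨F : z ⊨ F) where

  Preserved : (State n → Set) → Set
  Preserved P = ∀ w st → w ⊨ F → P st → P (improve w st)

  module _ {P : State n → Set} (preserved : Preserved P) where

    visit-preserves : ∀ st ys w → P st → P (proj₁ (visit F (st , ys) w))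
    visit-preserves st ys w p with falsified w F | falsified-correct w z F z⊨F
    ... | []    | inj₁ (_ , sat) = preserved w st sat p
    ... | _ ∷ _ | _              = p

    level-preserves : ∀ ys st next → P st → P (proj₁ (foldl (visit F) (st , next) ys))
    level-preserves []       st next p = p
    level-preserves (w ∷ ys) st next p = level-preserves ys _ _ (visit-preserves st next w p)

    search-preserves : ∀ i st ys → P st → P (proj₁ (search F i (st , ys)))
    search-preserves zero    st ys p = p
    search-preserves (suc i) st ys p = search-preserves i _ _ (level-preserves ys st [] p)

  -- I is what is known of the state when the search arrives at a solution between y and z; Q is
  -- what recording that solution achieves. Both must survive the other solutions that are recorded
  -- on the way.
  module _ (y : Assignment n) {I Q : State n → Set} (I-preserved : Preserved I) (Q-preserved : Preserved Q)
           (hit : ∀ w st → w ⊨ F → Between y w z → I st → Q (improve w st)) where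

    Close : ℕ → State n × List (Assignment n) → Set
    Close d (st , ys) = Q st ⊎ (∃ λ w → w ∈ ys × Between y w z × d-H w z < d)

    close-visit : ∀ d st ys w → Close d (st , ys) → Close d (visit F (st , ys) w)
    close-visit d st ys w (inj₁ q) = inj₁ (visit-preserves Q-preserved st ys w q)
    close-visit d st ys w (inj₂ (v , v∈ , close)) with falsified w F
    ... | []    = inj₂ (v , v∈ , close)
    ... | l ∷ C = inj₂ (v , expand-grows w ys (l ∷ C) v∈ , close)

    close-level : ∀ d ys lv → Close d lv → Close d (foldl (visit F) lv ys)
    close-level d []       lv        c = c
    close-level d (w ∷ ys) (st , ws) c = close-level d ys _ (close-visit d st ws w c)

    visit-approaches : ∀ st ys w → I st → Between y w z → Close (d-H w z) (visit F (st , ys) w)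
    visit-approaches st ys w p btw with falsified w F | falsified-correct w z F z⊨F
    ... | []     | inj₁ (_ , sat) = inj₁ (hit w st sat btw p)
    ... | l′ ∷ C | inj₂ (l , l∈ , z≡ , w≢) =
      inj₂ (assign w l , ∈-expand w ys (l′ ∷ C) l∈ , between-assign y w z l z≡ btw
        , ℕ.≤-reflexive (d-H-assign w z l z≡ w≢))

    level-approaches : ∀ ys st next w → w ∈ ys → I st → Between y w z →
      Close (d-H w z) (foldl (visit F) (st , next) ys)
    level-approaches (w ∷ ys) st next .w (here refl) p btw =
      close-level (d-H w z) ys _ (visit-approaches st next w p btw)
    level-approaches (v ∷ ys) st next w (there w∈) p btw =
      level-approaches ys _ _ w w∈ (visit-preserves I-preserved st next v p) btw

    -- A level either establishes Q or queues a candidate strictly nearer to z, so the bound i on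
    -- the distance falls with each level. At i = 0 nothing can be nearer, and the visit itself must
    -- have established Q.
    search-hits : ∀ i st ys w → w ∈ ys → I st → Between y w z → d-H w z ≤ i →
      Q (proj₁ (search F (suc i) (st , ys)))
    search-hits i st ys w w∈ p btw d≤i with level-approaches ys st [] w w∈ p btw
    ... | inj₁ q = search-preserves Q-preserved i _ _ q
    search-hits zero    st ys w w∈ p btw d≤i | inj₂ (v , v∈ , btw′ , v<w) =
      ⊥-elim (ℕ.n≮0 (ℕ.≤-trans v<w d≤i))
    search-hits (suc i) st ys w w∈ p btw d≤i | inj₂ (v , v∈ , btw′ , v<w) =
      search-hits i _ _ v v∈ (level-preserves I-preserved ys st [] p) btw′
        (ℕ.≤-pred (ℕ.≤-trans v<w d≤i))

    trial-hits : ∀ p st → d-H y z ≤ radius p n → I st → Q (trial p F st y)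
    trial-hits p st d≤R q = search-hits (radius p n) st (y ∷ []) y (here refl) q (λ _ → inj₂ refl) d≤R

-- Deviations of a sample point

-- Deviates y z r i j: y differs from z in i places where z and r differ and
-- in j places where they agree.
data Deviates : ∀ {n} → Assignment n → Assignment n → Assignment n → ℕ → ℕ → Set where
  []    : Deviates [] [] [] 0 0
  agree : ∀ {n i j a c} {y z r : Assignment n} → Deviates y z r i j → Deviates (a ∷ y) (a ∷ z) (c ∷ r) i j
  far   : ∀ {n i j a b c} {y z r : Assignment n} → Deviates y z r i j → Deviates (a ∷ y) (b ∷ z) (c ∷ r) (suc i) j
  near  : ∀ {n i j a b} {y z r : Assignment n} → Deviates y z r i j → Deviates (a ∷ y) (b ∷ z) (b ∷ r) i (suc j)

bit≤1 : ∀ b → bit b ≤ 1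
bit≤1 false = z≤n
bit≤1 true  = s≤s z≤n

bit-xor-self : ∀ b → bit (b xor b) ≡ 0
bit-xor-self false = refl
bit-xor-self true  = refl

deviates-distance : ∀ {n i j} {y z r : Assignment n} → Deviates y z r i j → d-H y z ≤ i + j
deviates-distance [] = z≤n
deviates-distance (agree {a = a} {y = y} {z} dev) rewrite d-H-∷ a a y z | bit-xor-self a = deviates-distance dev
deviates-distance (far {a = a} {b} {y = y} {z} dev) rewrite d-H-∷ a b y z =
  ℕ.+-mono-≤ (bit≤1 (a xor b)) (deviates-distance dev)
deviates-distance (near {i = i} {j} {a = a} {b} {y} {z} dev) rewrite d-H-∷ a b y z | ℕ.+-suc i j =
  ℕ.+-mono-≤ (bit≤1 (a xor b)) (deviates-distance dev)

-- Only the `far` places can cost w distance from r, one each. At an `agree` place w has the bit of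
-- z, and at a `near` place z does not differ from r anyway.
deviates-between : ∀ {n i j} {y z r : Assignment n} w → Deviates y z r i j → Between y w z →
  d-H r z ≤ d-H r w + i
deviates-between [] [] btw = z≤n
deviates-between (a′ ∷ w) (agree {i = i} {a = a} {c = c} {z = z} {r} dev) btw
  rewrite d-H-∷ c a r z | d-H-∷ c a′ r w with btw 0F
... | inj₁ refl = ℕ.≤-trans (ℕ.+-monoʳ-≤ (bit (c xor a)) (deviates-between w dev (btw ∘ suc)))
                    (ℕ.≤-reflexive (sym (ℕ.+-assoc (bit (c xor a)) (d-H r w) i)))
... | inj₂ refl = ℕ.≤-trans (ℕ.+-monoʳ-≤ (bit (c xor a)) (deviates-between w dev (btw ∘ suc)))
                    (ℕ.≤-reflexive (sym (ℕ.+-assoc (bit (c xor a)) (d-H r w) i)))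
deviates-between (a′ ∷ w) (far {i = i} {b = b} {c} {z = z} {r} dev) btw
  rewrite d-H-∷ c b r z | d-H-∷ c a′ r w | ℕ.+-suc (bit (c xor a′) + d-H r w) i =
  ℕ.+-mono-≤ (bit≤1 (c xor b)) (ℕ.≤-trans (deviates-between w dev (btw ∘ suc))
    (ℕ.+-monoˡ-≤ i (ℕ.m≤n+m (d-H r w) (bit (c xor a′)))))
deviates-between (a′ ∷ w) (near {i = i} {b = b} {z = z} {r} dev) btw
  rewrite d-H-∷ b b r z | d-H-∷ b a′ r w | bit-xor-self b =
  ℕ.≤-trans (deviates-between w dev (btw ∘ suc))
    (ℕ.+-monoˡ-≤ i (ℕ.m≤n+m (d-H r w) (bit (b xor a′))))

-- An indicator with values 0 and 1. It counts actual differences only, so that its sum over y is an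
-- exact product of binomial coefficients.
deviates : ∀ {n} → Assignment n → Assignment n → Assignment n → ℕ → ℕ → ℕ
deviates []      []      []      zero    zero    = 1
deviates []      []      []      zero    (suc _) = 0
deviates []      []      []      (suc _) _       = 0
deviates (a ∷ y) (b ∷ z) (c ∷ r) i       j with a xor b | b xor c
deviates (a ∷ y) (b ∷ z) (c ∷ r) i       j       | false | _     = deviates y z r i j
deviates (a ∷ y) (b ∷ z) (c ∷ r) zero    j       | true  | true  = 0
deviates (a ∷ y) (b ∷ z) (c ∷ r) (suc i) j       | true  | true  = deviates y z r i j
deviates (a ∷ y) (b ∷ z) (c ∷ r) i       zero    | true  | false = 0
deviates (a ∷ y) (b ∷ z) (c ∷ r) i       (suc j) | true  | false = deviates y z r i j

deviates-correct : ∀ {n} (y z r : Assignment n) i j →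
  deviates y z r i j ≡ 0 ⊎ (deviates y z r i j ≡ 1 × Deviates y z r i j)
deviates-correct [] [] [] zero    zero    = inj₂ (refl , [])
deviates-correct [] [] [] zero    (suc _) = inj₁ refl
deviates-correct [] [] [] (suc _) _       = inj₁ refl
deviates-correct (a ∷ y) (b ∷ z) (c ∷ r) i j = go a b c i j
  where
  lift : ∀ {x} {D E : Set} → (D → E) → x ≡ 0 ⊎ (x ≡ 1 × D) → x ≡ 0 ⊎ (x ≡ 1 × E)
  lift f (inj₁ eq)       = inj₁ eq
  lift f (inj₂ (eq , d)) = inj₂ (eq , f d)

  go : ∀ a b c i j → deviates (a ∷ y) (b ∷ z) (c ∷ r) i j ≡ 0 ⊎
    (deviates (a ∷ y) (b ∷ z) (c ∷ r) i j ≡ 1 × Deviates (a ∷ y) (b ∷ z) (c ∷ r) i j)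
  go false false c     i       j       = lift agree (deviates-correct y z r i j)
  go true  true  c     i       j       = lift agree (deviates-correct y z r i j)
  go false true  false zero    j       = inj₁ refl
  go false true  false (suc i) j       = lift far (deviates-correct y z r i j)
  go true  false true  zero    j       = inj₁ refl
  go true  false true  (suc i) j       = lift far (deviates-correct y z r i j)
  go false true  true  i       zero    = inj₁ refl
  go false true  true  i       (suc j) = lift near (deviates-correct y z r i j)
  go true  false false i       zero    = inj₁ refl
  go true  false false i       (suc j) = lift near (deviates-correct y z r i j)

-- Sums over assignments

interchange : ∀ a b c d → (a + b) + (c + d) ≡ (a + c) + (b + d)
interchange = solve-∀

sum-+ : ∀ n (f g : Assignment n → ℕ) → sum n (λ y → f y + g y) ≡ sum n f + sum n g
sum-cong : ∀ n {f g : Assignment n → ℕ} → (∀ y → f y ≡ g y) → sum n f ≡ sum n g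

sum-cong zero    eq = eq []
sum-cong (suc n) eq = sum-cong n (λ y → cong₂ _+_ (eq (false ∷ y)) (eq (true ∷ y)))

sum-+ zero    f g = refl
sum-+ (suc n) f g = trans
  (sum-cong n (λ y → interchange (f (false ∷ y)) (g (false ∷ y)) (f (true ∷ y)) (g (true ∷ y))))
  (sum-+ n _ _)

sum-mono : ∀ n {f g : Assignment n → ℕ} → (∀ y → f y ≤ g y) → sum n f ≤ sum n g
sum-mono zero    le = le []
sum-mono (suc n) le = sum-mono n (λ y → ℕ.+-mono-≤ (le (false ∷ y)) (le (true ∷ y)))

sum-const : ∀ n c → sum n (λ _ → c) ≡ 2 ^ n * c
sum-const zero    c = sym (ℕ.+-identityʳ c)
sum-const (suc n) c = trans (sum-const n (c + c)) (eq (2 ^ n) c)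
  where
  eq : ∀ x c → x * (c + c) ≡ (x + (x + 0)) * c
  eq = solve-∀

sum-*ʳ : ∀ n f c → sum n (λ y → f y * c) ≡ sum n f * c
sum-*ʳ zero    f c = refl
sum-*ʳ (suc n) f c = trans (sum-cong n (λ y → sym (ℕ.*-distribʳ-+ c (f (false ∷ y)) (f (true ∷ y))))) (sum-*ʳ n _ c)

sum-0+ : ∀ n (f : Assignment n → ℕ) → sum n (λ y → f y + 0) ≡ sum n f
sum-0+ n f = sum-cong n (λ y → ℕ.+-identityʳ (f y))

pascal : ∀ n k → suc n choose suc k ≡ n choose k + n choose suc k
pascal n k = sym (nCk+nC[k+1]≡[n+1]C[k+1] n k)

-- A point y is determined by where it differs from z: i of the places where z and r differ and j of
-- the others. The induction is Pascal's rule in one factor or the other, according to the first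
-- place.
sum-deviates : ∀ {n} (z r : Assignment n) i j →
  sum n (λ y → deviates y z r i j) ≡ (d-H r z choose i) * ((n ∸ d-H r z) choose j)
sum-deviates {zero} [] [] zero    zero    = refl
sum-deviates {zero} [] [] zero    (suc _) = refl
sum-deviates {zero} [] [] (suc _) j       = refl
sum-deviates {suc n} (b ∷ z) (c ∷ r) i j = go b c i j
  where
  S : ℕ → ℕ → ℕ
  S i j = sum n (λ y → deviates y z r i j)
  d = d-H r z

  agreements : suc n ∸ d ≡ suc (n ∸ d)
  agreements = ℕ.+-∸-assoc 1 (d-H≤n r z)

  disagree : ∀ i j → S (suc i) j + S i j ≡ (suc d choose suc i) * ((n ∸ d) choose j)
  disagree i j rewrite pascal d i | sum-deviates z r i j | sum-deviates z r (suc i) j =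
    eq (d choose i) (d choose suc i) ((n ∸ d) choose j)
    where
    eq : ∀ x y w → y * w + x * w ≡ (x + y) * w
    eq = solve-∀

  disagree₀ : ∀ j → S 0 j ≡ (suc d choose 0) * ((n ∸ d) choose j)
  disagree₀ j = sum-deviates z r 0 j

  agree′ : ∀ i j → S i (suc j) + S i j ≡ (d choose i) * ((suc n ∸ d) choose suc j)
  agree′ i j rewrite agreements | pascal (n ∸ d) j | sum-deviates z r i j | sum-deviates z r i (suc j) =
    eq (d choose i) ((n ∸ d) choose j) ((n ∸ d) choose suc j)
    where
    eq : ∀ w x y → w * y + w * x ≡ w * (x + y)
    eq = solve-∀

  agree₀ : ∀ i → S i 0 ≡ (d choose i) * ((suc n ∸ d) choose 0)
  agree₀ i = sum-deviates z r i 0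

  go : ∀ b c i j → sum (suc n) (λ y → deviates y (b ∷ z) (c ∷ r) i j) ≡
    (d-H (c ∷ r) (b ∷ z) choose i) * ((suc n ∸ d-H (c ∷ r) (b ∷ z)) choose j)
  go false false i zero    = trans (sum-0+ n _) (agree₀ i)
  go false false i (suc j) = trans (sum-+ n _ _) (agree′ i j)
  go true  true  i zero    = agree₀ i
  go true  true  i (suc j) = trans (sum-+ n _ _) (trans (ℕ.+-comm (S i j) _) (agree′ i j))
  go false true  zero    j = trans (sum-0+ n _) (disagree₀ j)
  go false true  (suc i) j = trans (sum-+ n _ _) (disagree i j)
  go true  false zero    j = disagree₀ j
  go true  false (suc i) j = trans (sum-+ n _ _) (trans (ℕ.+-comm (S i j) _) (disagree i j))

-- The number of successful runs

-- One trial in the count of runs. From a good sample point (e y = 1) the favourable continuations f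
-- y fall short of T by at most D, from a bad one by at most E + D; as at least g points are good, E
-- is lost at most h times. The form with sums avoids subtraction.
sum-step : ∀ n (f e : Assignment n → ℕ) g h E D T → 2 ^ n ≡ g + h → g ≤ sum n e →
  (∀ y → T + e y * E ≤ f y + (E + D)) → 2 ^ n * T ≤ sum n f + (h * E + 2 ^ n * D)
sum-step n f e g h E D T M≡ g≤ le = ℕ.+-cancelʳ-≤ (g * E) _ _ (begin
  2 ^ n * T + g * E                           ≤⟨ ℕ.+-monoʳ-≤ (2 ^ n * T) (ℕ.*-monoˡ-≤ E g≤) ⟩
  2 ^ n * T + sum n e * E                     ≡⟨ cong₂ _+_ (sym (sum-const n T)) (sym (sum-*ʳ n e E)) ⟩
  sum n (λ _ → T) + sum n (λ y → e y * E)     ≡⟨ sum-+ n _ _ ⟨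
  sum n (λ y → T + e y * E)                   ≤⟨ sum-mono n le ⟩
  sum n (λ y → f y + (E + D))                 ≡⟨ sum-+ n _ _ ⟩
  sum n f + sum n (λ _ → E + D)               ≡⟨ cong (sum n f +_) (sum-const n (E + D)) ⟩
  sum n f + 2 ^ n * (E + D)                   ≡⟨ cong (λ x → sum n f + x) (ℕ.*-distribˡ-+ (2 ^ n) E D) ⟩
  sum n f + (2 ^ n * E + 2 ^ n * D)           ≡⟨ cong (λ x → sum n f + (x * E + 2 ^ n * D)) M≡ ⟩
  sum n f + ((g + h) * E + 2 ^ n * D)         ≡⟨ eq (sum n f) g h E (2 ^ n * D) ⟩
  sum n f + (h * E + 2 ^ n * D) + g * E       ∎)
  where
  open ℕ.≤-Reasoning
  eq : ∀ s g h E x → s + ((g + h) * E + x) ≡ s + (h * E + x) + g * E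
  eq = solve-∀

-- The bound g holds for all distances d at once, since the reference point, and with it the target,
-- is known only during the run.
module _ {n} (p : ℕ) (F : CNF n) (w : State n → ℕ)
         (z₀ : Assignment n) (z₀⊨F : z₀ ⊨ F)
         (quota-sum : ∀ d → d ≤ n → groups p p d + groups p p (n ∸ d) ≤ radius p n)
         (far-away : ∀ r → r ⊨ F → ∃ λ z → z ⊨ F ×
           (∀ b → b ⊨ F → d-H r z ≤ d-H r b + groups p p (d-H r z) → 1 ≤ w (just (r , b))))
         (g h : ℕ) (M≡ : 2 ^ n ≡ g + h)
         (g≤ : ∀ d → d ≤ n → g ≤ (d choose groups p p d) * ((n ∸ d) choose groups p p (n ∸ d))) where

  private
    M = 2 ^ n

    quota : ℕ → ℕ
    quota d = groups p p d

    Referring : Assignment n → State n → Set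
    Referring r st = ∃ λ b → b ⊨ F × st ≡ just (r , b)

    Valid : State n → Set
    Valid st = st ≡ nothing ⊎ ∃ λ r → r ⊨ F × Referring r st

    Within : Assignment n → Assignment n → State n → Set
    Within r z st = ∃ λ b → b ⊨ F × d-H r z ≤ d-H r b + quota (d-H r z) × st ≡ just (r , b)

    Found : State n → Set
    Found st = ∃ λ r → r ⊨ F × Referring r st

  record-max : ∀ (r b v : Assignment n) → improve v (just (r , b)) ≡ just (r , b) × d-H r v ≤ d-H r b ⊎
                         improve v (just (r , b)) ≡ just (r , v) × d-H r b ≤ d-H r v
  record-max r b v with d-H r v ∸ d-H r b in eq
  ... | zero  = inj₁ (refl , ℕ.m∸n≡0⇒m≤n eq)
  ... | suc x = inj₂ (refl , ℕ.<⇒≤ (ℕ.m∸n≢0⇒n<m (λ e → case trans (sym eq) e of λ ())))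

  referring-preserved : ∀ r → Preserved F z₀ z₀⊨F (Referring r)
  referring-preserved r v _ v⊨F (b , b⊨F , refl) with record-max r b v
  ... | inj₁ (eq , _) = b , b⊨F , eq
  ... | inj₂ (eq , _) = v , v⊨F , eq

  found-preserved : Preserved F z₀ z₀⊨F Found
  found-preserved v st v⊨F (r , r⊨F , refers) = r , r⊨F , referring-preserved r v st v⊨F refers

  hit-found : ∀ v st → v ⊨ F → Valid st → Found (improve v st)
  hit-found v _  v⊨F (inj₁ refl) = v , v⊨F , v , v⊨F , refl
  hit-found v st v⊨F (inj₂ found) = found-preserved v st v⊨F found

  valid-preserved : Preserved F z₀ z₀⊨F Valid
  valid-preserved v st v⊨F valid = inj₂ (hit-found v st v⊨F valid)

  within-preserved : ∀ r z → Preserved F z₀ z₀⊨F (Within r z)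
  within-preserved r z v _ v⊨F (b , b⊨F , close , refl) with record-max r b v
  ... | inj₁ (eq , _)   = b , b⊨F , close , eq
  ... | inj₂ (eq , b≤v) = v , v⊨F , ℕ.≤-trans close (ℕ.+-monoˡ-≤ _ b≤v) , eq

  hit-within : ∀ r z v st → v ⊨ F → d-H r z ≤ d-H r v + quota (d-H r z) → Referring r st → Within r z (improve v st)
  hit-within r z v _ v⊨F close (b , b⊨F , refl) with record-max r b v
  ... | inj₁ (eq , v≤b) = b , b⊨F , ℕ.≤-trans close (ℕ.+-monoˡ-≤ _ v≤b) , eq
  ... | inj₂ (eq , _)   = v , v⊨F , close , eq

  trial-preserves : ∀ {P} → Preserved F z₀ z₀⊨F P → ∀ st y → P st → P (trial p F st y)
  trial-preserves pres st y = search-preserves F z₀ z₀⊨F pres (suc (radius p n)) st (y ∷ [])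

  deviates-radius : ∀ {y z r} → Deviates y z r (quota (d-H r z)) (quota (n ∸ d-H r z)) → d-H y z ≤ radius p n
  deviates-radius {z = z} {r} dev = ℕ.≤-trans (deviates-distance dev) (quota-sum (d-H r z) (d-H≤n r z))

  g≤deviating : ∀ z r → g ≤ sum n (λ y → deviates y z r (quota (d-H r z)) (quota (n ∸ d-H r z)))
  g≤deviating z r = ℕ.≤-trans (g≤ (d-H r z) (d-H≤n r z)) (ℕ.≤-reflexive (sym (sum-deviates z r _ _)))

  h≤M : h ≤ M
  h≤M = ℕ.≤-trans (ℕ.m≤n+m h g) (ℕ.≤-reflexive (sym M≡))

  count-within : ∀ r → (r⊨F : r ⊨ F) → ∀ N st → Within r (proj₁ (far-away r r⊨F)) st → M ^ N ≤ count p F w N st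
  count-within r r⊨F zero    _  (b , b⊨F , close , refl) = proj₂ (proj₂ (far-away r r⊨F)) b b⊨F close
  count-within r r⊨F (suc N) st within = ℕ.≤-trans (ℕ.≤-reflexive (sym (sum-const n (M ^ N))))
    (sum-mono n λ y → count-within r r⊨F N _ (trial-preserves (within-preserved r _) st y within))

  -- Once r is fixed, so is its target, and at most h points of each trial are bad. At most h ^ N
  -- runs meet no good point at all, and one good point settles the run.
  count-referring : ∀ r → r ⊨ F → ∀ N st → Referring r st → M ^ N ≤ count p F w N st + h ^ N
  count-referring r r⊨F zero    st refers = ℕ.m≤n+m 1 _
  count-referring r r⊨F (suc N) st refers = ℕ.≤-trans
    (sum-step n _ _ g h (h ^ N) 0 (M ^ N) M≡ (g≤deviating z r) pointwise)
    (ℕ.≤-reflexive (cong (sum n (λ y → count p F w N (trial p F st y)) +_)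
      (trans (cong (h * h ^ N +_) (ℕ.*-zeroʳ M)) (ℕ.+-identityʳ _))))
    where
    z = proj₁ (far-away r r⊨F)
    z⊨F = proj₁ (proj₂ (far-away r r⊨F))
    i = quota (d-H r z)
    j = quota (n ∸ d-H r z)

    pointwise : ∀ y → M ^ N + deviates y z r i j * h ^ N ≤ count p F w N (trial p F st y) + (h ^ N + 0)
    pointwise y with deviates-correct y z r i j
    ... | inj₁ eq rewrite eq | ℕ.+-identityʳ (M ^ N) | ℕ.+-identityʳ (h ^ N) =
      count-referring r r⊨F N _ (trial-preserves (referring-preserved r) st y refers)
    ... | inj₂ (eq , dev) rewrite eq = ℕ.+-monoˡ-≤ (h ^ N + 0) (count-within r r⊨F N _
      (trial-hits F z z⊨F y (referring-preserved r) (within-preserved r z)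
        (λ v st v⊨F btw → hit-within r z v st v⊨F (deviates-between v dev btw))
        p st (deviates-radius dev) refers))

  -- The two error terms: no solution appears in the first N₁ trials, or the N₂ trials after that
  -- contain no good point for the reference point then held.
  count-valid : ∀ N₁ N₂ st → Valid st → M ^ (N₁ + N₂) ≤ count p F w (N₁ + N₂) st + (h ^ N₁ * M ^ N₂ + M ^ N₁ * h ^ N₂)
  count-valid zero     N₂ st valid = ℕ.≤-trans (ℕ.m≤m+n (M ^ N₂) 0)
    (ℕ.≤-trans (ℕ.m≤m+n _ (1 * h ^ N₂)) (ℕ.m≤n+m _ (count p F w N₂ st)))
  count-valid (suc N₁) N₂ st valid = ℕ.≤-trans
    (sum-step n _ _ g h (h ^ N₁ * M ^ N₂) (M ^ N₁ * h ^ N₂) (M ^ (N₁ + N₂)) M≡ (g≤deviating z₀ z₀) pointwise)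
    (ℕ.≤-reflexive (cong (sum n (λ y → count p F w (N₁ + N₂) (trial p F st y)) +_)
      (cong₂ _+_ (sym (ℕ.*-assoc h (h ^ N₁) (M ^ N₂))) (sym (ℕ.*-assoc M (M ^ N₁) (h ^ N₂))))))
    where
    -- Until a solution is known, any solution will do. Taking z₀ as its own reference point turns
    -- this into the case of distance 0, so that the same g applies.
    i = quota (d-H z₀ z₀)
    j = quota (n ∸ d-H z₀ z₀)
    E = h ^ N₁ * M ^ N₂
    D = M ^ N₁ * h ^ N₂

    count-found : ∀ st → Found st → M ^ (N₁ + N₂) ≤ count p F w (N₁ + N₂) st + D
    count-found st (r , r⊨F , refers) = ℕ.≤-trans (count-referring r r⊨F (N₁ + N₂) st refers)
      (ℕ.+-monoʳ-≤ _ (ℕ.≤-trans (ℕ.≤-reflexive (ℕ.^-distribˡ-+-* h N₁ N₂))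
        (ℕ.*-monoˡ-≤ (h ^ N₂) (ℕ.^-monoˡ-≤ N₁ h≤M))))

    exchange : ∀ x e d → x + d + (1 * e) ≡ x + (e + d)
    exchange = solve-∀

    pointwise : ∀ y → M ^ (N₁ + N₂) + deviates y z₀ z₀ i j * E ≤ count p F w (N₁ + N₂) (trial p F st y) + (E + D)
    pointwise y with deviates-correct y z₀ z₀ i j
    ... | inj₁ eq rewrite eq | ℕ.+-identityʳ (M ^ (N₁ + N₂)) =
      count-valid N₁ N₂ _ (trial-preserves valid-preserved st y valid)
    ... | inj₂ (eq , dev) rewrite eq = ℕ.≤-trans
      (ℕ.+-monoˡ-≤ (1 * E) (count-found _ (trial-hits F z₀ z₀⊨F y valid-preserved found-preserved
        (λ v st v⊨F _ → hit-found v st v⊨F) p st (deviates-radius dev) valid)))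
      (ℕ.≤-reflexive (exchange (count p F w (N₁ + N₂) (trial p F st y)) E D))

-- Binomial coefficients

absorption : ∀ n k → suc k * (suc n choose suc k) ≡ suc n * (n choose k)
absorption zero    zero    = refl
absorption zero    (suc k) = ℕ.*-zeroʳ (suc (suc k))
absorption (suc n) zero    = trans (cong (1 *_) (pascal (suc n) 0)) (trans (eq₁ (suc n choose 1))
  (trans (cong suc (trans (sym (ℕ.*-identityˡ _)) (absorption n 0))) (eq₂ n)))
  where
  eq₁ : ∀ x → 1 * (1 + x) ≡ suc x
  eq₁ = solve-∀
  eq₂ : ∀ n → suc (suc n * 1) ≡ suc (suc n) * 1
  eq₂ = solve-∀
absorption (suc n) (suc k) = begin
  (2 + k) * (suc (suc n) choose (2 + k))
    ≡⟨ cong ((2 + k) *_) (pascal (suc n) (suc k)) ⟩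
  (2 + k) * (x + y)
    ≡⟨ eq₁ k x y ⟩
  x + (suc k * x + (2 + k) * y)
    ≡⟨ cong (x +_) (cong₂ _+_ (absorption n k) (absorption n (suc k))) ⟩
  x + (suc n * (n choose k) + suc n * (n choose suc k))
    ≡⟨ cong (x +_) (sym (ℕ.*-distribˡ-+ (suc n) (n choose k) (n choose suc k))) ⟩
  x + suc n * (n choose k + n choose suc k)
    ≡⟨ cong (λ w → x + suc n * w) (sym (pascal n k)) ⟩
  x + suc n * x ∎
  where
  open Eq.≡-Reasoning
  x = suc n choose suc k
  y = suc n choose suc (suc k)
  eq₁ : ∀ k x y → (2 + k) * (x + y) ≡ x + ((1 + k) * x + (2 + k) * y)
  eq₁ = solve-∀

absorptionʳ : ∀ k t → suc k * ((k + t) choose suc k) ≡ t * ((k + t) choose k)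
absorptionʳ k t = ℕ.+-cancelˡ-≡ (suc k * c) _ _ (begin
  suc k * c + suc k * c′    ≡⟨ ℕ.*-distribˡ-+ (suc k) c c′ ⟨
  suc k * (c + c′)          ≡⟨ cong (suc k *_) (sym (pascal (k + t) k)) ⟩
  suc k * (suc (k + t) choose suc k) ≡⟨ absorption (k + t) k ⟩
  suc (k + t) * c           ≡⟨ ℕ.*-distribʳ-+ c (suc k) t ⟩
  suc k * c + t * c         ∎)
  where
  open Eq.≡-Reasoning
  c  = (k + t) choose k
  c′ = (k + t) choose suc k

absorptionˡ : ∀ k t → suc t * (suc (k + t) choose k) ≡ suc (k + t) * ((k + t) choose k)
absorptionˡ zero    t = refl
absorptionˡ (suc k) t = ℕ.+-cancelˡ-≡ (suc k * c) _ _ (begin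
  suc k * c + suc t * c                             ≡⟨ ℕ.*-distribʳ-+ c (suc k) (suc t) ⟨
  (suc k + suc t) * c                               ≡⟨ cong (_* c) (ℕ.+-suc (suc k) t) ⟩
  suc n * c                                         ≡⟨ cong (suc n *_) (pascal n k) ⟩
  suc n * (n choose k + n choose suc k)             ≡⟨ ℕ.*-distribˡ-+ (suc n) (n choose k) (n choose suc k) ⟩
  suc n * (n choose k) + suc n * (n choose suc k)   ≡⟨ cong (_+ suc n * (n choose suc k)) (sym (absorption n k)) ⟩
  suc k * c + suc n * (n choose suc k)              ∎)
  where
  open Eq.≡-Reasoning
  n = suc k + t
  c = suc n choose suc k

-- The quotient of consecutive coefficients is (n - r) / (r + 1), which is at least k because r + (r
-- + 1) k is less than (r + 1)(k + 1).
choose-step : ∀ k n r → suc r * suc k ≤ n → k * (n choose r) ≤ n choose suc r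
choose-step k n r le = ℕ.*-cancelˡ-≤ (suc r) (begin
  suc r * (k * (n choose r))    ≡⟨ ℕ.*-assoc (suc r) k _ ⟨
  suc r * k * (n choose r)      ≤⟨ ℕ.*-monoˡ-≤ (n choose r) le′ ⟩
  (n ∸ r) * (n choose r)        ≡⟨ cong (λ x → (n ∸ r) * (x choose r)) (sym n≡) ⟩
  (n ∸ r) * ((r + (n ∸ r)) choose r) ≡⟨ absorptionʳ r (n ∸ r) ⟨
  suc r * ((r + (n ∸ r)) choose suc r) ≡⟨ cong (λ x → suc r * (x choose suc r)) n≡ ⟩
  suc r * (n choose suc r)      ∎)
  where
  open ℕ.≤-Reasoning
  eq : ∀ r k → r + (1 + r) * k + 1 ≡ (1 + r) * (1 + k)
  eq = solve-∀
  le″ : r + suc r * k ≤ n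
  le″ = ℕ.≤-trans (ℕ.≤-trans (ℕ.m≤m+n _ 1) (ℕ.≤-reflexive (eq r k))) le
  n≡ : r + (n ∸ r) ≡ n
  n≡ = ℕ.m+[n∸m]≡n (ℕ.≤-trans (ℕ.m≤m+n r _) le″)
  le′ : suc r * k ≤ n ∸ r
  le′ = ℕ.+-cancelˡ-≤ r _ _ (ℕ.≤-trans le″ (ℕ.≤-reflexive (sym n≡)))

choose-ratio : ∀ k n r t → (r + t) * suc k ≤ n → k ^ (r + t) * (n choose r) ≤ k ^ r * (n choose (r + t))
choose-ratio k n r zero    le rewrite ℕ.+-identityʳ r = ℕ.≤-refl
choose-ratio k n r (suc t) le rewrite ℕ.+-suc r t = begin
  k * k ^ (r + t) * (n choose r)      ≡⟨ ℕ.*-assoc k _ _ ⟩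
  k * (k ^ (r + t) * (n choose r))    ≤⟨ ℕ.*-monoʳ-≤ k (choose-ratio k n r t (ℕ.≤-trans (ℕ.m≤n+m _ (suc k)) le)) ⟩
  k * (k ^ r * (n choose (r + t)))    ≡⟨ eq k (k ^ r) _ ⟩
  k ^ r * (k * (n choose (r + t)))    ≤⟨ ℕ.*-monoʳ-≤ (k ^ r) (choose-step k n (r + t) le) ⟩
  k ^ r * (n choose suc (r + t))      ∎
  where
  open ℕ.≤-Reasoning
  eq : ∀ a b c → a * (b * c) ≡ b * (a * c)
  eq = solve-∀

binomial-term : ∀ p n r → (n choose r) * p ^ (n ∸ r) ≤ suc p ^ n
binomial-term p n       zero    = ℕ.≤-trans (ℕ.≤-reflexive (ℕ.+-identityʳ _)) (ℕ.^-monoˡ-≤ n (ℕ.n≤1+n p))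
binomial-term p zero    (suc r) = z≤n
binomial-term p (suc n) (suc r) = begin
  (suc n choose suc r) * p ^ (n ∸ r)                              ≡⟨ cong (_* p ^ (n ∸ r)) (pascal n r) ⟩
  (n choose r + n choose suc r) * p ^ (n ∸ r)                     ≡⟨ ℕ.*-distribʳ-+ (p ^ (n ∸ r)) (n choose r) _ ⟩
  (n choose r) * p ^ (n ∸ r) + (n choose suc r) * p ^ (n ∸ r)     ≤⟨ ℕ.+-mono-≤ (binomial-term p n r) second ⟩
  suc p ^ n + p * suc p ^ n                                       ∎
  where
  open ℕ.≤-Reasoning
  eq : ∀ a b c → a * (b * c) ≡ b * (a * c)
  eq = solve-∀
  second : (n choose suc r) * p ^ (n ∸ r) ≤ p * suc p ^ n
  second with suc r ℕ.≤? n
  ... | no  r≮n rewrite k>n⇒nCk≡0 (ℕ.≰⇒> r≮n) = z≤n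
  ... | yes r<n rewrite ℕ.+-∸-assoc 1 r<n = ℕ.≤-trans
    (ℕ.≤-reflexive (eq (n choose suc r) p (p ^ (n ∸ suc r)))) (ℕ.*-monoʳ-≤ p (binomial-term p n (suc r)))

-- Among the terms of the expansion of (p + 1) ^ n, the one of index
-- r = ⌊ n / (p + 1) ⌋ is the largest.
largest-term : ∀ p n r → r * suc p ≤ n → n < suc r * suc p → suc p ^ n ≤ suc n * ((n choose r) * p ^ (n ∸ r))
largest-term p zero    zero    lo hi = ℕ.≤-refl
largest-term p (suc n) r       lo hi with r * suc p ℕ.≤? n
-- The floor does not change. Passing from C(n, r) to C(n + 1, r) costs the factor (t + 1) / (n +
-- 1), and `ratio` follows from n + 1 < (r + 1)(p + 1).
... | yes lo′ = begin
  suc p * suc p ^ n                                     ≤⟨ ℕ.*-monoʳ-≤ (suc p) (largest-term p n r lo′ (ℕ.<-trans (ℕ.n<1+n n) hi)) ⟩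
  suc p * (suc n * ((n choose r) * P))                  ≡⟨ eq₁ (suc p) (suc n) (n choose r) P ⟩
  suc p * (suc n * (n choose r)) * P                    ≡⟨ cong (λ x → suc p * x * P) (subst (λ x → suc x * (x choose r) ≡ suc t * (suc x choose r)) n≡ (sym (absorptionˡ r t))) ⟩
  suc p * (suc t * (suc n choose r)) * P                ≡⟨ eq₂ (suc p) (suc t) (suc n choose r) P ⟩
  suc p * suc t * ((suc n choose r) * P)                ≤⟨ ℕ.*-monoˡ-≤ ((suc n choose r) * P) ratio ⟩
  (2 + n) * p * ((suc n choose r) * P)                  ≡⟨ eq₃ (2 + n) p (suc n choose r) P ⟩
  (2 + n) * ((suc n choose r) * (p * P))                ≡⟨ cong (λ x → (2 + n) * ((suc n choose r) * p ^ x)) (sym (ℕ.+-∸-assoc 1 r≤n)) ⟩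
  (2 + n) * ((suc n choose r) * p ^ (suc n ∸ r))        ∎
  where
  open ℕ.≤-Reasoning
  t = n ∸ r
  P = p ^ t
  r≤n : r ≤ n
  r≤n = ℕ.≤-trans (ℕ.m≤m*n r (suc p)) lo′
  n≡ : r + t ≡ n
  n≡ = ℕ.m+[n∸m]≡n r≤n
  eq₁ : ∀ a b c d → a * (b * (c * d)) ≡ a * (b * c) * d
  eq₁ = solve-∀
  eq₂ : ∀ a b c d → a * (b * c) * d ≡ a * b * (c * d)
  eq₂ = solve-∀
  eq₃ : ∀ a b c d → a * b * (c * d) ≡ a * (c * (b * d))
  eq₃ = solve-∀
  eq₄ : ∀ p t r → (1 + p) * (1 + t) + r ≡ p * (1 + t) + (1 + (r + t))
  eq₄ = solve-∀
  eq₅ : ∀ p t r → p * (1 + t) + (p + r * (1 + p)) ≡ (2 + (r + t)) * p + r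
  eq₅ = solve-∀
  ratio : suc p * suc t ≤ (2 + n) * p
  ratio = ℕ.+-cancelʳ-≤ r _ _ (begin
    suc p * suc t + r               ≡⟨ eq₄ p t r ⟩
    p * suc t + suc (r + t)         ≡⟨ cong (λ x → p * suc t + suc x) n≡ ⟩
    p * suc t + suc n               ≤⟨ ℕ.+-monoʳ-≤ (p * suc t) (ℕ.≤-pred hi) ⟩
    p * suc t + (p + r * suc p)     ≡⟨ eq₅ p t r ⟩
    (2 + (r + t)) * p + r           ≡⟨ cong (λ x → (2 + x) * p + r) n≡ ⟩
    (2 + n) * p + r                 ∎)
largest-term p (suc n) zero    lo hi | no  lo≰ = ⊥-elim (lo≰ z≤n)
-- The floor has just increased, so n + 1 = (r + 1)(p + 1). The exponent of p stays the same, and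
-- absorption turns the coefficient for n into the one for n + 1.
largest-term p (suc n) (suc r) lo hi | no  lo≰ = begin
  suc p * suc p ^ n                                     ≤⟨ ℕ.*-monoʳ-≤ (suc p) (largest-term p n r r≤ r<) ⟩
  suc p * (suc n * ((n choose r) * P))                  ≡⟨ eq₁ (suc p) (suc n) (n choose r) P ⟩
  suc p * (suc n * (n choose r)) * P                    ≡⟨ cong (λ x → suc p * x * P) (sym (absorption n r)) ⟩
  suc p * (suc r * (suc n choose suc r)) * P            ≡⟨ eq₂ (suc p) (suc r) (suc n choose suc r) P ⟩
  suc r * suc p * ((suc n choose suc r) * P)            ≤⟨ ℕ.*-monoˡ-≤ _ (ℕ.≤-trans lo (ℕ.n≤1+n (suc n))) ⟩
  (2 + n) * ((suc n choose suc r) * P)                  ∎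
  where
  open ℕ.≤-Reasoning
  P = p ^ (n ∸ r)
  eq₁ : ∀ a b c d → a * (b * (c * d)) ≡ a * (b * c) * d
  eq₁ = solve-∀
  eq₂ : ∀ a b c d → a * (b * c) * d ≡ b * a * (c * d)
  eq₂ = solve-∀
  r< : n < suc r * suc p
  r< = ℕ.≰⇒> lo≰
  r≤ : r * suc p ≤ n
  r≤ = ℕ.≤-trans (ℕ.m≤n+m _ p) (ℕ.≤-pred lo)

-- Floors, ceilings and powers

-- With e = b - c, the count is ⌊ (n + e) / (1 + b) ⌋, as if e elements of the first group had
-- already gone by. This covers floor and ceiling alike.
groups-bounds : ∀ b c e n → c + e ≡ b →
  groups b c n * suc b ≤ n + e × n + e < suc (groups b c n) * suc b
groups-bounds b c       e zero    eq = z≤n , s≤s (ℕ.≤-trans (ℕ.≤-trans (ℕ.m≤n+m e c) (ℕ.≤-reflexive eq)) (ℕ.m≤m+n b 0))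
groups-bounds b zero    e (suc n) refl with groups-bounds b b 0 n (ℕ.+-identityʳ b)
... | lo , hi rewrite ℕ.+-identityʳ n =
  s≤s (ℕ.≤-trans (ℕ.+-monoʳ-≤ b lo) (ℕ.≤-reflexive (ℕ.+-comm b n)))
  , s≤s (ℕ.≤-trans (s≤s (ℕ.≤-reflexive (ℕ.+-comm n b))) (ℕ.≤-trans (ℕ.≤-reflexive (sym (ℕ.+-suc b n))) (ℕ.+-monoʳ-≤ b hi)))
groups-bounds b (suc c) e (suc n) eq with groups-bounds b c (suc e) n (trans (ℕ.+-suc c e) eq)
... | bounds rewrite ℕ.+-suc n e = bounds

floor-≤ : ∀ p n → groups p p n * suc p ≤ n
floor-≤ p n = ℕ.≤-trans (proj₁ (groups-bounds p p 0 n (ℕ.+-identityʳ p))) (ℕ.≤-reflexive (ℕ.+-identityʳ n))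

floor-< : ∀ p n → n < suc (groups p p n) * suc p
floor-< p n = ℕ.≤-<-trans (ℕ.m≤m+n n 0) (proj₂ (groups-bounds p p 0 n (ℕ.+-identityʳ p)))

floor-+ˡ : ∀ p d e → groups p p d + groups p p e ≤ groups p p (d + e)
floor-+ˡ p d e = ℕ.≤-pred (ℕ.*-cancelʳ-< (suc p) _ _ (ℕ.≤-<-trans
  (ℕ.≤-trans (ℕ.≤-reflexive (ℕ.*-distribʳ-+ (suc p) (groups p p d) _)) (ℕ.+-mono-≤ (floor-≤ p d) (floor-≤ p e)))
  (floor-< p (d + e))))

floor-+ʳ : ∀ p d e → groups p p (d + e) ≤ suc (groups p p d + groups p p e)
floor-+ʳ p d e = ℕ.≤-trans (ℕ.≤-pred (ℕ.*-cancelʳ-< (suc p) _ _ (ℕ.≤-<-trans (floor-≤ p (d + e))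
  (ℕ.<-≤-trans (ℕ.+-mono-< (floor-< p d) (floor-< p e)) (ℕ.≤-reflexive (sym (ℕ.*-distribʳ-+ (suc p) (suc (groups p p d)) (suc (groups p p e)))))))))
  (ℕ.≤-reflexive (ℕ.+-suc (groups p p d) (groups p p e)))

-- Bernoulli's inequality for (1 + g / h) ^ N, cleared of denominators.
bernoulli : ∀ h g N → h ^ N * (h + N * g) ≤ h * (h + g) ^ N
bernoulli h g zero    = ℕ.≤-reflexive (eq h)
  where
  eq : ∀ h → 1 * (h + 0) ≡ h * 1
  eq = solve-∀
bernoulli h g (suc N) = begin
  h * h ^ N * (h + (g + N * g))                    ≤⟨ ℕ.m≤m+n _ (h ^ N * (N * g * g)) ⟩
  h * h ^ N * (h + (g + N * g)) + h ^ N * (N * g * g) ≡⟨ eq₁ h g N (h ^ N) ⟩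
  h ^ N * (h + N * g) * (h + g)                    ≤⟨ ℕ.*-monoˡ-≤ (h + g) (bernoulli h g N) ⟩
  h * (h + g) ^ N * (h + g)                        ≡⟨ eq₂ h (h + g) ((h + g) ^ N) ⟩
  h * ((h + g) * (h + g) ^ N)                      ∎
  where
  open ℕ.≤-Reasoning
  eq₁ : ∀ h g N x → h * x * (h + (g + N * g)) + x * (N * g * g) ≡ x * (h + N * g) * (h + g)
  eq₁ = solve-∀
  eq₂ : ∀ h m x → h * x * m ≡ h * (m * x)
  eq₂ = solve-∀

-- The number of trials

module Stages (b A : ℕ) (B<A : suc b < A) where
  B = suc b

  stage-≥ : ∀ h → h * A ≤ stage b A h * B
  stage-≥ h = ℕ.≤-trans (ℕ.*-monoˡ-≤ A h≤) (ℕ.≤-reflexive (eq (groups b 0 h) B A))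
    where
    eq : ∀ x y z → x * y * z ≡ x * z * y
    eq = solve-∀
    h≤ : h ≤ groups b 0 h * B
    h≤ = ℕ.+-cancelʳ-≤ b _ _ (ℕ.≤-trans (ℕ.≤-pred (proj₂ (groups-bounds b 0 b h refl)))
      (ℕ.≤-reflexive (ℕ.+-comm b _)))

  stage-increases : ∀ h → h ≤ stage b A h
  stage-increases h = ℕ.*-cancelʳ-≤ h (stage b A h) B (ℕ.≤-trans (ℕ.*-monoʳ-≤ h (ℕ.<⇒≤ B<A)) (stage-≥ h))

  stages-≥ : ∀ i h → h * A ^ i ≤ stages b A i h * B ^ i
  stages-≥ zero    h = ℕ.≤-refl
  stages-≥ (suc i) h = begin
    h * (A * A ^ i)                              ≡⟨ ℕ.*-assoc h A (A ^ i) ⟨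
    h * A * A ^ i                                ≤⟨ ℕ.*-monoˡ-≤ (A ^ i) (stage-≥ h) ⟩
    stage b A h * B * A ^ i                      ≡⟨ eq₁ (stage b A h) B (A ^ i) ⟩
    stage b A h * A ^ i * B                      ≤⟨ ℕ.*-monoˡ-≤ B (stages-≥ i (stage b A h)) ⟩
    stages b A i (stage b A h) * B ^ i * B       ≡⟨ eq₂ (stages b A i (stage b A h)) (B ^ i) B ⟩
    stages b A i (stage b A h) * (B * B ^ i)     ∎
    where
    open ℕ.≤-Reasoning
    eq₁ : ∀ x y z → x * y * z ≡ x * z * y
    eq₁ = solve-∀
    eq₂ : ∀ x y z → x * y * z ≡ x * (z * y)
    eq₂ = solve-∀

  -- The offset X absorbs the rounding errors.
  X = A * B

  -- Rounding up adds at most A B = X after multiplication by B, and X + X B ≤ X A because B < A. So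
  -- h + X, unlike h, grows by a factor of at most A / B.
  stage-≤ : ∀ h → (stage b A h + X) * B ≤ A * (h + X)
  stage-≤ h = begin
    (groups b 0 h * A + X) * B             ≡⟨ eq₁ (groups b 0 h) A B ⟩
    (groups b 0 h * B) * A + X * B         ≤⟨ ℕ.+-monoˡ-≤ (X * B) (ℕ.*-monoˡ-≤ A G≤) ⟩
    (h + B) * A + X * B                    ≡⟨ eq₂ h A B ⟩
    A * h + X * suc B                      ≤⟨ ℕ.+-monoʳ-≤ (A * h) (ℕ.*-monoʳ-≤ X B<A) ⟩
    A * h + X * A                          ≡⟨ eq₃ A h X ⟩
    A * (h + X)                            ∎
    where
    open ℕ.≤-Reasoning
    eq₁ : ∀ g A B → (g * A + A * B) * B ≡ (g * B) * A + A * B * B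
    eq₁ = solve-∀
    eq₂ : ∀ h A B → (h + B) * A + A * B * B ≡ A * h + A * B * (1 + B)
    eq₂ = solve-∀
    eq₃ : ∀ A h X → A * h + X * A ≡ A * (h + X)
    eq₃ = solve-∀
    G≤ : groups b 0 h * B ≤ h + B
    G≤ = ℕ.≤-trans (proj₁ (groups-bounds b 0 b h refl)) (ℕ.+-monoʳ-≤ h (ℕ.n≤1+n b))

  stages-≤ : ∀ i h → (stages b A i h + X) * B ^ i ≤ (h + X) * A ^ i
  stages-≤ zero    h = ℕ.≤-refl
  stages-≤ (suc i) h = begin
    (N + X) * (B * B ^ i)                  ≡⟨ eq₁ (N + X) B (B ^ i) ⟩
    (N + X) * B ^ i * B                    ≤⟨ ℕ.*-monoˡ-≤ B (stages-≤ i (stage b A h)) ⟩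
    (stage b A h + X) * A ^ i * B          ≡⟨ eq₂ (stage b A h + X) (A ^ i) B ⟩
    (stage b A h + X) * B * A ^ i          ≤⟨ ℕ.*-monoˡ-≤ (A ^ i) (stage-≤ h) ⟩
    A * (h + X) * A ^ i                    ≡⟨ eq₃ A (h + X) (A ^ i) ⟩
    (h + X) * (A * A ^ i)                  ∎
    where
    open ℕ.≤-Reasoning
    N = stages b A i (stage b A h)
    eq₁ : ∀ x y z → x * (y * z) ≡ x * z * y
    eq₁ = solve-∀
    eq₂ : ∀ x y z → x * y * z ≡ x * z * y
    eq₂ = solve-∀
    eq₃ : ∀ x y z → x * y * z ≡ y * (x * z)
    eq₃ = solve-∀

^-distribʳ-* : ∀ x y n → (x * y) ^ n ≡ x ^ n * y ^ n
^-distribʳ-* x y zero    = refl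
^-distribʳ-* x y (suc n) = trans (cong (x * y *_) (^-distribʳ-* x y n)) (eq x y (x ^ n) (y ^ n))
  where
  eq : ∀ x y a b → x * y * (a * b) ≡ x * a * (y * b)
  eq = solve-∀

argmin : ∀ (G : ℕ → ℕ) n → ∃ λ d₀ → d₀ ≤ n × (∀ d → d ≤ n → G d₀ ≤ G d)
argmin G zero = 0 , z≤n , λ where _ z≤n → ℕ.≤-refl
argmin G (suc n) with argmin G n
... | d₀ , d₀≤n , least with G d₀ ℕ.≤? G (suc n)
...   | yes le = d₀ , ℕ.m≤n⇒m≤1+n d₀≤n , λ d d≤ → case ℕ.m≤n⇒m<n∨m≡n d≤ of λ where
        (inj₁ (s≤s d≤n)) → least d d≤n
        (inj₂ refl)      → le
...   | no  gt = suc n , ℕ.≤-refl , λ d d≤ → case ℕ.m≤n⇒m<n∨m≡n d≤ of λ where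
        (inj₁ (s≤s d≤n)) → ℕ.≤-trans (ℕ.<⇒≤ (ℕ.≰⇒> gt)) (least d d≤n)
        (inj₂ refl)      → ℕ.≤-refl

-- A / B with B = 1 + b = m ^ m is the constant 2 ^ m p ^ p / m ^ m whose R-th power approximates 2
-- ^ n / C(n, R). The factors of c₀ pay for n exceeding m R and for the rounding of the quotas.
module Parameters (p : ℕ) (2≤p : 2 ≤ p) where
  m = suc p
  A = 2 ^ m * p ^ p
  b = pred (m ^ m)
  c₀ = p ^ m * 2 ^ m

  instance
    p≢0 : NonZero p
    p≢0 = >-nonZero (ℕ.≤-trans (s≤s z≤n) 2≤p)

  B≡ : suc b ≡ m ^ m
  B≡ = ℕ.suc-pred (m ^ m) {{ℕ.m^n≢0 m m}}

  -- Bernoulli with 2 p = m + (p - 1) reduces m ^ m < 2 ^ m p ^ p to (p + 1)² < 2 (p² + 1), that is,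
  -- to (p - 1)² > 0. For p = 1 both sides are 4.
  B<A : suc b < A
  B<A rewrite B≡ = ℕ.*-cancelˡ-< m _ _ (begin-strict
    m * m ^ m                               ≡⟨ eq₁ p (m ^ p) ⟩
    m ^ p * (suc p * suc p)                 <⟨ ℕ.*-monoʳ-< (m ^ p) {{ℕ.m^n≢0 m p}} (square p 2≤p) ⟩
    m ^ p * (2 * (m + p * pred p))        ≡⟨ eq₂ (m ^ p) (m + p * pred p) ⟩
    2 * (m ^ p * (m + p * pred p))        ≤⟨ ℕ.*-monoʳ-≤ 2 (bernoulli m (pred p) p) ⟩
    2 * (m * (m + pred p) ^ p)            ≡⟨ cong (λ x → 2 * (m * x ^ p)) (sym 2p≡) ⟩
    2 * (m * (2 * p) ^ p)                   ≡⟨ cong (λ x → 2 * (m * x)) (^-distribʳ-* 2 p p) ⟩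
    2 * (m * (2 ^ p * p ^ p))               ≡⟨ eq₃ m (2 ^ p) (p ^ p) ⟩
    m * (2 * 2 ^ p * p ^ p)                 ∎)
    where
    open ℕ.≤-Reasoning
    eq₁ : ∀ p x → (1 + p) * ((1 + p) * x) ≡ x * ((1 + p) * (1 + p))
    eq₁ = solve-∀
    eq₂ : ∀ x y → x * (2 * y) ≡ 2 * (x * y)
    eq₂ = solve-∀
    eq₃ : ∀ m x y → 2 * (m * (x * y)) ≡ m * (2 * x * y)
    eq₃ = solve-∀
    2p≡ : 2 * p ≡ m + pred p
    2p≡ = trans (cong (p +_) (trans (ℕ.+-identityʳ p) (sym (ℕ.suc-pred p)))) (ℕ.+-suc p _)
    square : ∀ q → 2 ≤ q → suc q * suc q < 2 * (suc q + q * pred q)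
    square (suc (suc q)) _ = ℕ.≤-trans (ℕ.m≤m+n _ (q * q + 2 * q)) (ℕ.≤-reflexive (eq q))
      where
      eq : ∀ q → suc ((3 + q) * (3 + q)) + (q * q + 2 * q) ≡ 2 * (3 + q + (2 + q) * (1 + q))
      eq = solve-∀
    square (suc zero) (s≤s ())

  open Stages b A B<A public

  quota : ℕ → ℕ
  quota d = groups p p d

  radius≡ : ∀ n → radius p n ≡ quota n
  radius≡ n = ℕ.*-identityʳ (quota n)

  quota-sum : ∀ {n} d → d ≤ n → quota d + quota (n ∸ d) ≤ radius p n
  quota-sum {n} d d≤n rewrite radius≡ n =
    ℕ.≤-trans (floor-+ˡ p d (n ∸ d)) (ℕ.≤-reflexive (cong quota (ℕ.m+[n∸m]≡n d≤n)))

  A^ : ∀ R → A ^ R ≡ 2 ^ (m * R) * p ^ (p * R)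
  A^ R = trans (^-distribʳ-* (2 ^ m) (p ^ p) R) (cong₂ _*_ (ℕ.^-*-assoc 2 m R) (ℕ.^-*-assoc p p R))

  B^ : ∀ R → suc b ^ R ≡ m ^ (m * R)
  B^ R = trans (cong (_^ R) B≡) (ℕ.^-*-assoc m m R)

  module _ (n : ℕ) where
    private
      R = quota n
      H = initial c₀ n
      N = trials p b A c₀ n
      P = p ^ (p * R)

    -- The number of sample points that deviate from a solution in a way
    -- that suits a reference point at distance d.
    goodness : ℕ → ℕ
    goodness d = (d choose quota d) * ((n ∸ d) choose quota (n ∸ d))

    mR≤n : m * R ≤ n
    mR≤n = ℕ.≤-trans (ℕ.≤-reflexive (ℕ.*-comm m R)) (floor-≤ p n)

    n≤mR+p : n ≤ m * R + p
    n≤mR+p = ℕ.≤-trans (ℕ.≤-pred (floor-< p n)) (ℕ.≤-reflexive (trans (ℕ.+-comm p (R * m)) (cong (_+ p) (ℕ.*-comm R m))))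

    N≡ : stages b A R H ≡ N
    N≡ = cong (λ r → stages b A r H) (sym (radius≡ n))

    -- `largest-term` applies to both parts with the same p, and the two powers of p then combine to
    -- one that hardly depends on d.
    goodness-≥ : ∀ d → d ≤ n → m ^ n ≤ suc n * suc n * (goodness d * (P * p ^ m))
    goodness-≥ d d≤n = begin
      m ^ n                                   ≡⟨ cong (m ^_) (sym n≡) ⟩
      m ^ (d + e)                             ≡⟨ ℕ.^-distribˡ-+-* m d e ⟩
      m ^ d * m ^ e                           ≤⟨ ℕ.*-mono-≤ (largest-term p d (quota d) (floor-≤ p d) (floor-< p d))
                                                            (largest-term p e (quota e) (floor-≤ p e) (floor-< p e)) ⟩
      suc d * (x * p ^ s) * (suc e * (y * p ^ t)) ≡⟨ eq₁ (suc d) x (p ^ s) (suc e) y (p ^ t) ⟩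
      suc d * suc e * (x * y * (p ^ s * p ^ t))   ≤⟨ ℕ.*-mono-≤ (ℕ.*-mono-≤ (s≤s d≤n) (s≤s (ℕ.m∸n≤m n d)))
                                                       (ℕ.*-monoʳ-≤ (x * y) powers) ⟩
      suc n * suc n * (x * y * (P * p ^ m))   ∎
      where
      open ℕ.≤-Reasoning
      e = n ∸ d
      x = d choose quota d
      y = e choose quota e
      s = d ∸ quota d
      t = e ∸ quota e
      n≡ : d + e ≡ n
      n≡ = ℕ.m+[n∸m]≡n d≤n
      eq₁ : ∀ a x u b y v → a * (x * u) * (b * (y * v)) ≡ a * b * (x * y * (u * v))
      eq₁ = solve-∀
      eq₂ : ∀ s t q r → s + t + (q + r) ≡ (q + s) + (r + t)
      eq₂ = solve-∀
      eq₃ : ∀ p R → (1 + p) * R + p + 1 ≡ p * R + (1 + p) + R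
      eq₃ = solve-∀
      quota≤ : ∀ d → quota d ≤ d
      quota≤ d = ℕ.≤-trans (ℕ.m≤m*n (quota d) m) (floor-≤ p d)
      exponent : s + t ≤ p * R + m
      -- The two floors together lose at most 1 against `quota n`, and n exceeds m R by at most p;
      -- hence the slack p + 1 = m.
      exponent = ℕ.+-cancelʳ-≤ R (s + t) (p * R + m) (begin
        s + t + R                                ≤⟨ ℕ.+-monoʳ-≤ (s + t) (ℕ.≤-trans (ℕ.≤-reflexive (cong quota (sym n≡))) (floor-+ʳ p d e)) ⟩
        s + t + suc (quota d + quota e)          ≡⟨ trans (ℕ.+-suc (s + t) _) (cong suc (eq₂ s t (quota d) (quota e))) ⟩
        suc ((quota d + s) + (quota e + t))      ≡⟨ cong suc (cong₂ _+_ (ℕ.m+[n∸m]≡n (quota≤ d)) (ℕ.m+[n∸m]≡n (quota≤ e))) ⟩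
        suc (d + e)                              ≡⟨ cong suc n≡ ⟩
        suc n                                    ≤⟨ s≤s n≤mR+p ⟩
        suc (m * R + p)                          ≡⟨ ℕ.+-comm 1 (m * R + p) ⟩
        m * R + p + 1                            ≡⟨ eq₃ p R ⟩
        p * R + m + R                            ∎)
      powers : p ^ s * p ^ t ≤ P * p ^ m
      powers = begin
        p ^ s * p ^ t        ≡⟨ ℕ.^-distribˡ-+-* p s t ⟨
        p ^ (s + t)          ≤⟨ ℕ.^-monoʳ-≤ p exponent ⟩
        p ^ (p * R + m)      ≡⟨ ℕ.^-distribˡ-+-* p (p * R) m ⟩
        P * p ^ m            ∎

    -- N is at least n + 1 times the expected waiting time 2 ^ n / `goodness d`, as `failure-bound`
    -- requires.
    enough-trials : ∀ d → d ≤ n → suc n * 2 ^ n ≤ N * goodness d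
    enough-trials d d≤n = ℕ.*-cancelʳ-≤ _ _ K {{ℕ.m*n≢0 (suc n * suc n) (P * p ^ m * m ^ n) {{_}} {{ℕ.m*n≢0 (P * p ^ m) (m ^ n) {{ℕ.m*n≢0 P (p ^ m) {{ℕ.m^n≢0 p (p * R)}} {{ℕ.m^n≢0 p m}}}} {{ℕ.m^n≢0 m n}}}}}} (begin
      suc n * 2 ^ n * K                                             ≤⟨ ℕ.*-monoˡ-≤ K (ℕ.*-monoʳ-≤ (suc n) 2^n≤) ⟩
      suc n * (2 ^ (m * R) * 2 ^ m) * K                             ≡⟨ eq₁ (suc n) (2 ^ (m * R)) (2 ^ m) P (p ^ m) (m ^ n) ⟩
      H * (2 ^ (m * R) * P) * m ^ n                                 ≡⟨ cong (λ x → H * x * m ^ n) (A^ R) ⟨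
      H * A ^ R * m ^ n                                             ≤⟨ ℕ.*-monoˡ-≤ (m ^ n) (stages-≥ R H) ⟩
      stages b A R H * suc b ^ R * m ^ n                            ≡⟨ cong₂ (λ x y → x * y * m ^ n) N≡ (B^ R) ⟩
      N * m ^ (m * R) * m ^ n                                       ≤⟨ ℕ.*-mono-≤ (ℕ.*-monoʳ-≤ N (ℕ.^-monoʳ-≤ m mR≤n)) (goodness-≥ d d≤n) ⟩
      N * m ^ n * (suc n * suc n * (goodness d * (P * p ^ m)))      ≡⟨ eq₂ N (m ^ n) (suc n) (goodness d) P (p ^ m) ⟩
      N * goodness d * K                                            ∎)
      where
      open ℕ.≤-Reasoning
      K = suc n * suc n * (P * p ^ m * m ^ n)
      eq₁ : ∀ s u v P q x → s * (u * v) * (s * s * (P * q * x)) ≡ s * (s * (s * (q * v))) * (u * P) * x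
      eq₁ = solve-∀
      eq₂ : ∀ N x s g P q → N * x * (s * s * (g * (P * q))) ≡ N * g * (s * s * (P * q * x))
      eq₂ = solve-∀
      2^n≤ : 2 ^ n ≤ 2 ^ (m * R) * 2 ^ m
      2^n≤ = ℕ.≤-trans (ℕ.^-monoʳ-≤ 2 (ℕ.≤-trans n≤mR+p (ℕ.+-monoʳ-≤ (m * R) (ℕ.n≤1+n p))))
        (ℕ.≤-reflexive (ℕ.^-distribˡ-+-* 2 (m * R) m))

    -- The opposite estimate, for the running time: here C(n, R) p ^ (n - R) ≤ m ^ n is enough, and
    -- `stages-≤` controls the rounding.
    few-trials : (n choose R) * N ≤ (H + X) * m ^ m * 2 ^ n
    few-trials = ℕ.*-cancelʳ-≤ _ _ (m ^ (m * R)) {{ℕ.m^n≢0 m (m * R)}} (begin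
      (n choose R) * N * m ^ (m * R)                      ≡⟨ ℕ.*-assoc (n choose R) N _ ⟩
      (n choose R) * (N * m ^ (m * R))                    ≡⟨ cong₂ (λ x y → (n choose R) * (x * y)) (sym N≡) (sym (B^ R)) ⟩
      (n choose R) * (stages b A R H * suc b ^ R)         ≤⟨ ℕ.*-monoʳ-≤ (n choose R) (ℕ.*-monoˡ-≤ (suc b ^ R) (ℕ.m≤m+n (stages b A R H) X)) ⟩
      (n choose R) * ((stages b A R H + X) * suc b ^ R)   ≤⟨ ℕ.*-monoʳ-≤ (n choose R) (stages-≤ R H) ⟩
      (n choose R) * ((H + X) * A ^ R)                    ≡⟨ cong (λ x → (n choose R) * ((H + X) * x)) (A^ R) ⟩
      (n choose R) * ((H + X) * (2 ^ (m * R) * P))        ≡⟨ eq₁ (n choose R) (H + X) (2 ^ (m * R)) P ⟩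
      (H + X) * 2 ^ (m * R) * ((n choose R) * P)          ≤⟨ ℕ.*-mono-≤ (ℕ.*-monoʳ-≤ (H + X) (ℕ.^-monoʳ-≤ 2 mR≤n))
                                                              (ℕ.*-monoʳ-≤ (n choose R) (ℕ.^-monoʳ-≤ p pR≤)) ⟩
      (H + X) * 2 ^ n * ((n choose R) * p ^ (n ∸ R))      ≤⟨ ℕ.*-monoʳ-≤ ((H + X) * 2 ^ n) (binomial-term p n R) ⟩
      (H + X) * 2 ^ n * m ^ n                             ≤⟨ ℕ.*-monoʳ-≤ ((H + X) * 2 ^ n) m^n≤ ⟩
      (H + X) * 2 ^ n * (m ^ (m * R) * m ^ m)             ≡⟨ eq₂ (H + X) (2 ^ n) (m ^ (m * R)) (m ^ m) ⟩
      (H + X) * m ^ m * 2 ^ n * m ^ (m * R)               ∎)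
      where
      open ℕ.≤-Reasoning
      eq₁ : ∀ c h u P → c * (h * (u * P)) ≡ h * u * (c * P)
      eq₁ = solve-∀
      eq₂ : ∀ h u v w → h * u * (v * w) ≡ h * w * u * v
      eq₂ = solve-∀
      pR≤ : p * R ≤ n ∸ R
      pR≤ = ℕ.+-cancelˡ-≤ R _ _ (ℕ.≤-trans mR≤n (ℕ.≤-reflexive (sym (ℕ.m+[n∸m]≡n
        (ℕ.≤-trans (ℕ.m≤m+n R (p * R)) mR≤n)))))
      m^n≤ : m ^ n ≤ m ^ (m * R) * m ^ m
      m^n≤ = ℕ.≤-trans (ℕ.^-monoʳ-≤ m (ℕ.≤-trans n≤mR+p (ℕ.+-monoʳ-≤ (m * R) (ℕ.n≤1+n p))))
        (ℕ.≤-reflexive (ℕ.^-distribˡ-+-* m (m * R) m))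

-- Probability of failure

-- If each of N trials succeeds with probability g / (h + g), and N is at
-- least n times the expected waiting time, then all fail with probability at
-- most 1 / n.
failure-bound : ∀ n g h N → 0 < h + g → n * (h + g) ≤ N * g → n * h ^ N ≤ (h + g) ^ N
failure-bound n g (suc h) N M>0 le = ℕ.*-cancelˡ-≤ (suc h) (begin
  suc h * (n * suc h ^ N)               ≡⟨ eq (suc h) n (suc h ^ N) ⟩
  suc h ^ N * (n * suc h)               ≤⟨ ℕ.*-monoʳ-≤ (suc h ^ N) (ℕ.≤-trans (ℕ.*-monoʳ-≤ n (ℕ.m≤m+n (suc h) g))
                                             (ℕ.≤-trans le (ℕ.m≤n+m (N * g) (suc h)))) ⟩
  suc h ^ N * (suc h + N * g)           ≤⟨ bernoulli (suc h) g N ⟩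
  suc h * (suc h + g) ^ N               ∎)
  where
  open ℕ.≤-Reasoning
  eq : ∀ h n x → h * (n * x) ≡ x * (n * h)
  eq = solve-∀
failure-bound n g zero    (suc N) M>0 le = ℕ.≤-trans (ℕ.≤-reflexive (ℕ.*-zeroʳ n)) z≤n
-- Here 0 ^ 0 = 1, but with N = 0 the hypothesis forces n = 0.
failure-bound n g zero    zero    M>0 le = ℕ.≤-trans (ℕ.*-monoʳ-≤ n M>0) (ℕ.≤-trans le z≤n)

success-bound : ∀ n g h N c → 0 < h + g → n * (h + g) ≤ N * g →
  (h + g) ^ (N + N) ≤ c + (h ^ N * (h + g) ^ N + (h + g) ^ N * h ^ N) →
  n * (h + g) ^ (N + N) ≤ n * c + 2 * (h + g) ^ (N + N)
success-bound n g h N c M>0 le bound = begin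
  n * M ^ (N + N)                                           ≤⟨ ℕ.*-monoʳ-≤ n bound ⟩
  n * (c + (h ^ N * M ^ N + M ^ N * h ^ N))                 ≡⟨ eq₁ n c (h ^ N) (M ^ N) ⟩
  n * c + 2 * (n * h ^ N * M ^ N)                           ≤⟨ ℕ.+-monoʳ-≤ (n * c) (ℕ.*-monoʳ-≤ 2 (ℕ.*-monoˡ-≤ (M ^ N) (failure-bound n g h N M>0 le))) ⟩
  n * c + 2 * (M ^ N * M ^ N)                               ≡⟨ cong (λ x → n * c + 2 * x) (sym (ℕ.^-distribˡ-+-* M N N)) ⟩
  n * c + 2 * M ^ (N + N)                                   ∎
  where
  open ℕ.≤-Reasoning
  M = h + g
  eq₁ : ∀ n c x y → n * (c + (x * y + y * x)) ≡ n * c + 2 * (n * x * y)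
  eq₁ = solve-∀

-- Comparisons of fractions

/-≤ : ∀ a b c d → a ℤ.* (ℤ.+ suc d) ℤ.≤ c ℤ.* (ℤ.+ suc b) → a ℚ./ suc b ℚ.≤ c ℚ./ suc d
/-≤ a b c d le = ℚ.toℚᵘ-cancel-≤ (ℚᵘ.≤-trans (ℚᵘ.≤-reflexive (ℚ.toℚᵘ-fromℚᵘ (mkℚᵘ a b)))
  (ℚᵘ.≤-trans (ℚᵘ.*≤* le) (ℚᵘ.≤-reflexive (ℚᵘ.≃-sym (ℚ.toℚᵘ-fromℚᵘ (mkℚᵘ c d))))))

/-≤⁻ : ∀ a b c d → a ℚ./ suc b ℚ.≤ c ℚ./ suc d → a ℤ.* (ℤ.+ suc d) ℤ.≤ c ℤ.* (ℤ.+ suc b)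
/-≤⁻ a b c d le = ℚᵘ.drop-*≤* (ℚᵘ.≤-trans (ℚᵘ.≤-reflexive (ℚᵘ.≃-sym (ℚ.toℚᵘ-fromℚᵘ (mkℚᵘ a b))))
  (ℚᵘ.≤-trans (ℚ.toℚᵘ-mono-≤ le) (ℚᵘ.≤-reflexive (ℚ.toℚᵘ-fromℚᵘ (mkℚᵘ c d)))))

pos-*-≤ : ∀ a b c d → a * b ≤ c * d → (ℤ.+ a) ℤ.* (ℤ.+ b) ℤ.≤ (ℤ.+ c) ℤ.* (ℤ.+ d)
pos-*-≤ a b c d le = ℤ.≤-trans (ℤ.≤-reflexive (sym (ℤ.pos-* a b))) (ℤ.≤-trans (ℤ.+≤+ le) (ℤ.≤-reflexive (ℤ.pos-* c d)))

/-≤ℕ : ∀ a b c d → a * suc d ≤ c * suc b → (ℤ.+ a) ℚ./ suc b ℚ.≤ (ℤ.+ c) ℚ./ suc d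
/-≤ℕ a b c d le = /-≤ (ℤ.+ a) b (ℤ.+ c) d (pos-*-≤ a (suc d) c (suc b) le)

/-≤ℕ⁻ : ∀ a b c d → (ℤ.+ a) ℚ./ suc b ℚ.≤ (ℤ.+ c) ℚ./ suc d → a * suc d ≤ c * suc b
/-≤ℕ⁻ a b c d le = ℤ.drop‿+≤+ (ℤ.≤-trans (ℤ.≤-reflexive (ℤ.pos-* a (suc d)))
  (ℤ.≤-trans (/-≤⁻ (ℤ.+ a) b (ℤ.+ c) d le) (ℤ.≤-reflexive (sym (ℤ.pos-* c (suc b))))))

four/ : ℕ → ℚ
four/ t = (ℤ.+ 4) ℚ./ suc t

four/-antitone : ∀ {s t} → s ≤ t → four/ t ℚ.≤ four/ s
four/-antitone {s} {t} s≤t = /-≤ℕ 4 t 4 s (ℕ.*-monoʳ-≤ 4 (s≤s s≤t))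

archimedes : ∀ q → 0ℚ ℚ.< q → ∃ λ T → four/ T ℚ.≤ q
-- T + 1 = 4 (d + 1), so `four/ T` is 1 / (d + 1).
archimedes q@(mkℚ (ℤ.+ suc a) d _) _ = pred (4 * suc d) , subst (_ ℚ.≤_) (ℚ.↥p/↧p≡p q)
  (/-≤ℕ 4 (d + 3 * suc d) (suc a) d (ℕ.m≤m+n (4 * suc d) (a * (4 * suc d))))
archimedes (mkℚ (ℤ.+ zero) d _) (ℚ.*<* (ℤ.+<+ ()))
archimedes (mkℚ ℤ.-[1+ _ ] d _) (ℚ.*<* ())

-- Locating δ between consecutive fractions

module _ (δ : ℝ) (f : ℕ → ℚ) (antitone : ∀ {s t} → s ≤ t → f t ℚ.≤ f s) where

  -- Walk upwards from t to the first index whose successor satisfies `f (suc t) ≤ʳ δ`, which is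
  -- reached by T at the latest. The cut is decidable and downward closed, so a failed test gives
  -- the upper bound δ ≤ f (suc t) for the next index.
  refine : ∀ T → f T ≤ʳ δ → ∀ fuel t → T ≤ suc t + fuel → δ ʳ≤ f t →
    ∃ λ t′ → t ≤ t′ × δ ʳ≤ f t′ × f (suc t′) ≤ʳ δ
  refine T T≤δ zero t T≤ δ≤ = t , ℕ.≤-refl , δ≤ ,
    ℝ.lower δ (antitone (ℕ.≤-trans T≤ (ℕ.≤-reflexive (ℕ.+-identityʳ (suc t))))) T≤δ
  refine T T≤δ (suc fuel) t T≤ δ≤ with T? (ℝ.cut δ (f (suc t)))
  ... | yes stop = t , ℕ.≤-refl , δ≤ , stop
  ... | no  ¬le =
    let t′ , t≤ , found = refine T T≤δ fuel (suc t) (ℕ.≤-trans T≤ (ℕ.≤-reflexive (ℕ.+-suc (suc t) fuel))) above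
    in t′ , ℕ.≤-trans (ℕ.n≤1+n t) t≤ , found
    where
    above : δ ʳ≤ f (suc t)
    above q q≤δ with q ℚ.≤? f (suc t)
    ... | yes le = le
    ... | no  gt = ⊥-elim (¬le (ℝ.lower δ (ℚ.<⇒≤ (ℚ.≰⇒> gt)) q≤δ))

approximation : ∀ δ k (2≤k : 2 ≤ k) → Positive δ → δ ʳ≤ min[1,4/[ k -1]] 2≤k →
  ∃ λ t → k ≤ 2 + t × δ ʳ≤ four/ t × four/ (suc t) ≤ʳ δ
approximation δ (suc (suc k)) (s≤s (s≤s z≤n)) (q , 0<q , q≤δ) δ≤ =
  let T , T≤q = archimedes q 0<q
      -- After the match k has been lowered by 2, so `four/ k` is the 4 / (k - 1) of the hypothesis,
      -- and `four/ 3` is 1. The minimum of both is `four/ (k ⊔ 3)`.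
      t , start≤t , bounds = refine δ four/ four/-antitone T (ℝ.lower δ T≤q q≤δ) T (k ⊔ 3) (ℕ.m≤n+m T _) (below (ℕ.≤-total k 3))
  in t , s≤s (s≤s (ℕ.≤-trans (ℕ.m≤m⊔n k 3) start≤t)) , bounds
  where
  below : k ≤ 3 ⊎ 3 ≤ k → δ ʳ≤ four/ (k ⊔ 3)
  below (inj₁ k≤3) r r≤ = ℚ.≤-trans (δ≤ r r≤) (ℚ.≤-trans (ℚ.p⊓q≤p 1ℚ (four/ k))
    (ℚ.≤-reflexive (cong four/ (sym (ℕ.m≤n⇒m⊔n≡n k≤3)))))
  below (inj₂ 3≤k) r r≤ = ℚ.≤-trans (δ≤ r r≤) (ℚ.≤-trans (ℚ.p⊓q≤q 1ℚ (four/ k))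
    (ℚ.≤-reflexive (cong four/ (sym (ℕ.m≥n⇒m⊔n≡m 3≤k)))))

largest-correct : ∀ {P : ℕ → Set} (P? : Decidable P) n → largest P? n ≡ 0 ⊎ P (largest P? n)
largest-correct P? zero = inj₁ refl
largest-correct P? (suc n) with P? (suc n)
... | yes p = inj₂ p
... | no  _ = largest-correct P? n

-- From 4 R ≤ δ (n - 2 R) and δ ≤ 4 / (t + 1) follows R (t + 1) ≤ n - 2 R. This is the origin of the
-- modulus m = t + 3.
R₁-≤ : ∀ δ t n → δ ʳ≤ four/ t → R₁ δ n * (3 + t) ≤ n
R₁-≤ δ t n δ≤ with largest-correct (λ R → (ℤ.+ (4 * R)) ≤[ δ · n ∸ 2 * R ]?) n
... | inj₁ eq = ℕ.≤-trans (ℕ.≤-reflexive (cong (_* (3 + t)) eq)) z≤n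
... | inj₂ le = go (R₁ δ n) le
  where
  go : ∀ R → (ℤ.+ (4 * R)) ≤[ δ · n ∸ 2 * R ] → R * (3 + t) ≤ n
  go R le with n ∸ 2 * R in eq
  go zero le | zero = z≤n
  go (suc R) (ℤ.+≤+ ()) | zero
  ... | suc x = begin
    R * (3 + t)                ≡⟨ eq₁ R t ⟩
    2 * R + R * suc t          ≤⟨ ℕ.+-monoʳ-≤ (2 * R) Rs≤ ⟩
    2 * R + suc x              ≡⟨ cong (2 * R +_) eq ⟨
    2 * R + (n ∸ 2 * R)        ≡⟨ ℕ.m+[n∸m]≡n (ℕ.<⇒≤ (ℕ.m∸n≢0⇒n<m {n} {2 * R} (λ e → case trans (sym eq) e of λ ()))) ⟩
    n                          ∎
    where
    open ℕ.≤-Reasoning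
    eq₁ : ∀ R t → R * (3 + t) ≡ 2 * R + R * (1 + t)
    eq₁ = solve-∀
    Rs≤ : R * suc t ≤ suc x
    Rs≤ = ℕ.*-cancelˡ-≤ 4 (ℕ.≤-trans (ℕ.≤-reflexive (sym (ℕ.*-assoc 4 R (suc t))))
      (/-≤ℕ⁻ (4 * R) x 4 t (δ≤ _ le)))

-- The approximation ratio

ratio : ∀ δ p D d → four/ p ≤ʳ δ → D * suc p ≤ 4 * D + 2 * d * suc p → (D ⊖ 2 * d) ≤[ δ · D ]
ratio δ p D d p≤δ le = go D le
  where
  ⊖-≤ : ∀ a b → a ⊖ b ℤ.≤ ℤ.+ (a ∸ b)
  ⊖-≤ a b with ℕ.≤-total b a
  ... | inj₁ b≤a = ℤ.≤-reflexive (ℤ.⊖-≥ b≤a)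
  ... | inj₂ a≤b = ℤ.≤-trans (ℤ.≤-reflexive (ℤ.⊖-≤ a≤b)) (ℤ.≤-trans ℤ.neg-≤-pos (ℤ.+≤+ z≤n))

  go : ∀ D → D * suc p ≤ 4 * D + 2 * d * suc p → (D ⊖ 2 * d) ≤[ δ · D ]
  go zero    le = ℤ.≤-trans (⊖-≤ 0 (2 * d)) (ℤ.≤-reflexive (cong ℤ.+_ (ℕ.0∸n≡0 (2 * d))))
  go (suc D) le = ℝ.lower δ (/-≤ (suc D ⊖ 2 * d) D (ℤ.+ 4) p (ℤ.≤-trans
      (ℤ.*-monoʳ-≤-nonNeg (ℤ.+ suc p) (⊖-≤ (suc D) (2 * d)))
      (pos-*-≤ (suc D ∸ 2 * d) (suc p) 4 (suc D) nat))) p≤δ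
    where
    nat : (suc D ∸ 2 * d) * suc p ≤ 4 * suc D
    nat = ℕ.≤-trans (ℕ.≤-reflexive (ℕ.*-distribʳ-∸ (suc p) (suc D) (2 * d)))
      (ℕ.m≤n+o⇒m∸n≤o _ _ (ℕ.≤-trans le (ℕ.≤-reflexive (ℕ.+-comm (4 * suc D) _))))

module _ {n} (F : CNF n) where

  ∈-Ω : ∀ z → z ⊨ F → z ∈ Ω F
  ∈-Ω z z⊨F = ∈-filter⁺ (_⊨? F) (∈-assignments z) z⊨F

  d-H≤Diam : ∀ y z → y ⊨ F → z ⊨ F → d-H y z ≤ Diam F
  d-H≤Diam y z y⊨F z⊨F = All.lookup (xs≤max 0 (cartesianProductWith d-H (Ω F) (Ω F)))
    (∈-cartesianProductWith⁺ d-H (∈-Ω y y⊨F) (∈-Ω z z⊨F))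

-- Fractions

fraction-* : ∀ x c → (ℤ.+ x) ℚ./ suc c ℚ.* ι (suc c) ≡ ι x
fraction-* x c = ℚ.toℚᵘ-injective (ℚᵘ.≃-trans (ℚ.toℚᵘ-homo-* ((ℤ.+ x) ℚ./ suc c) (ι (suc c)))
  (ℚᵘ.≃-trans (ℚᵘ.*-cong (ℚ.toℚᵘ-fromℚᵘ (mkℚᵘ (ℤ.+ x) c)) (ℚ.toℚᵘ-fromℚᵘ (mkℚᵘ (ℤ.+ suc c) 0)))
  (ℚᵘ.≃-trans (ℚᵘ.*≡* (trans (ℤ.*-identityʳ _) (cong (ℤ._*_ (ℤ.+ x)) (sym (ℤ.*-identityʳ (ℤ.+ suc c))))))
    (ℚᵘ.≃-sym (ℚ.toℚᵘ-fromℚᵘ (mkℚᵘ (ℤ.+ x) 0))))))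

ι-pos : ∀ c → ℚ.Positive (ι (suc c))
ι-pos c = ℚ.normalize-pos (suc c) 1

fraction : ∀ t P x c .{{_ : NonZero c}} → t * c ≤ P * x → ι t ℚ.≤ ι P ℚ.* ((ℤ.+ x) ℚ./ c)
fraction t P x (suc c) le = ℚ.*-cancelʳ-≤-pos (ι (suc c)) {{ι-pos c}} (begin
  ι t ℚ.* ι (suc c)                                    ≡⟨ ι-* t (suc c) ⟨
  ι (t * suc c)                                        ≤⟨ ι-mono le ⟩
  ι (P * x)                                            ≡⟨ ι-* P x ⟩
  ι P ℚ.* ι x                                          ≡⟨ cong (ι P ℚ.*_) (fraction-* x c) ⟨
  ι P ℚ.* ((ℤ.+ x) ℚ./ suc c ℚ.* ι (suc c))            ≡⟨ ℚ.*-assoc (ι P) _ _ ⟨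
  ι P ℚ.* ((ℤ.+ x) ℚ./ suc c) ℚ.* ι (suc c)            ∎)
  where open ℚ.≤-Reasoning

-- Asymptotics

-- f is O*(W). The combinators below follow the syntax of the cost functions, so that the estimate
-- of the running time is a term of the same shape.
record Dom (W f : ℕ → ℕ) : Set where
  constructor dom
  field
    factor exponent : ℕ
    bound           : ∀ n → f n ≤ factor * suc n ^ exponent * W n

Poly : (ℕ → ℕ) → Set
Poly = Dom (λ _ → 1)

pow-mono : ∀ n {d e} → d ≤ e → suc n ^ d ≤ suc n ^ e
pow-mono n = ℕ.^-monoʳ-≤ (suc n)

con : ∀ c → Poly (λ _ → c)
con c = dom c 0 λ n → ℕ.≤-reflexive (eq c)
  where
  eq : ∀ c → c ≡ c * 1 * 1
  eq = solve-∀

arg : Poly (λ n → n)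
arg = dom 1 1 λ n → ℕ.≤-trans (ℕ.n≤1+n n) (ℕ.≤-reflexive (eq n))
  where
  eq : ∀ n → suc n ≡ 1 * (suc n * 1) * 1
  eq = solve-∀

infixl 6 _⊕_
infixl 7 _⊗_ _⊛_

_⊕_ : ∀ {W f g} → Dom W f → Dom W g → Dom W (λ n → f n + g n)
_⊕_ {W} (dom c d f≤) (dom c′ d′ g≤) = dom (c + c′) (d + d′) λ n → ℕ.≤-trans
  (ℕ.+-mono-≤ (ℕ.≤-trans (f≤ n) (ℕ.*-monoˡ-≤ (W n) (ℕ.*-monoʳ-≤ c (pow-mono n (ℕ.m≤m+n d d′)))))
              (ℕ.≤-trans (g≤ n) (ℕ.*-monoˡ-≤ (W n) (ℕ.*-monoʳ-≤ c′ (pow-mono n (ℕ.m≤n+m d′ d))))))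
  (ℕ.≤-reflexive (eq c c′ (suc n ^ (d + d′)) (W n)))
  where
  eq : ∀ c c′ x w → c * x * w + c′ * x * w ≡ (c + c′) * x * w
  eq = solve-∀

_⊛_ : ∀ {V W f g} → Dom V f → Dom W g → Dom (λ n → V n * W n) (λ n → f n * g n)
_⊛_ {V} {W} (dom c d f≤) (dom c′ d′ g≤) = dom (c * c′) (d + d′) λ n → ℕ.≤-trans
  (ℕ.*-mono-≤ (f≤ n) (g≤ n))
  (ℕ.≤-reflexive (trans (eq c (suc n ^ d) (V n) c′ (suc n ^ d′) (W n))
    (cong (λ x → c * c′ * x * (V n * W n)) (sym (ℕ.^-distribˡ-+-* (suc n) d d′)))))
  where
  eq : ∀ c x v c′ x′ w → c * x * v * (c′ * x′ * w) ≡ c * c′ * (x * x′) * (v * w)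
  eq = solve-∀

weaken : ∀ {V W f} → (∀ n → V n ≤ W n) → Dom V f → Dom W f
weaken V≤W (dom c d f≤) = dom c d λ n → ℕ.≤-trans (f≤ n) (ℕ.*-monoʳ-≤ (c * suc n ^ d) (V≤W n))

shrink : ∀ {W f g} → (∀ n → f n ≤ g n) → Dom W g → Dom W f
shrink f≤g (dom c d g≤) = dom c d λ n → ℕ.≤-trans (f≤g n) (g≤ n)

_⊗_ : ∀ {W f g} → Poly f → Dom W g → Dom W (λ n → f n * g n)
F ⊗ G = weaken (λ n → ℕ.≤-reflexive (ℕ.*-identityˡ _)) (F ⊛ G)

poly-Poly : ∀ c → Poly (poly c)
poly-Poly c = dom c c λ n → ℕ.≤-reflexive (sym (ℕ.*-identityʳ _))

Poly-poly : ∀ {f} → Poly f → ∃ λ c → ∀ n → f n ≤ poly c n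
Poly-poly (dom c d f≤) = c + d , λ n → ℕ.≤-trans (f≤ n) (ℕ.≤-trans (ℕ.≤-reflexive (ℕ.*-identityʳ _))
  (ℕ.*-mono-≤ (ℕ.m≤m+n c d) (pow-mono n (ℕ.m≤n+m d c))))

module Time (k p c : ℕ) (2≤k : 2 ≤ k) (2≤p : 2 ≤ p) (k≤p : k ≤ p) where
  private
    L = poly c

  open Parameters p 2≤p

  W : ℕ → ℕ
  W n = trials p b A c₀ n * k ^ radius p n

  private
    K N : ℕ → ℕ
    K n = k ^ radius p n
    N n = trials p b A c₀ n

    1≤K : ∀ n → 1 ≤ K n
    1≤K n = ℕ.m^n>0 k {{>-nonZero (ℕ.≤-trans (s≤s z≤n) 2≤k)}} (radius p n)

    initial-Poly : Poly (initial c₀)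
    initial-Poly = (con 1 ⊕ arg) ⊗ ((con 1 ⊕ arg) ⊗ ((con 1 ⊕ arg) ⊗ con c₀))

    1≤initial : ∀ n → 1 ≤ initial c₀ n
    1≤initial n = ℕ.*-mono-≤ (s≤s (z≤n {n})) (ℕ.*-mono-≤ (s≤s (z≤n {n})) (ℕ.*-mono-≤ (s≤s (z≤n {n}))
      (ℕ.*-mono-≤ (ℕ.m^n>0 p m) (ℕ.m^n>0 2 m))))

    stages-increase : ∀ i h → h ≤ stages b A i h
    stages-increase zero    h = ℕ.≤-refl
    stages-increase (suc i) h = ℕ.≤-trans (stage-increases h) (stages-increase i (stage b A h))

    1≤N : ∀ n → 1 ≤ N n
    1≤N n = ℕ.≤-trans (1≤initial n) (stages-increase (radius p n) (initial c₀ n))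

    N≤W : ∀ n → N n ≤ W n
    N≤W n = ℕ.≤-trans (ℕ.≤-reflexive (sym (ℕ.*-identityʳ _))) (ℕ.*-monoʳ-≤ (N n) (1≤K n))

    self : ∀ f → Dom f f
    self f = dom 1 0 λ n → ℕ.≤-reflexive (sym (ℕ.*-identityˡ _))

    N-Dom : Dom W N
    N-Dom = weaken N≤W (self N)

    K-Dom : Dom K (λ n → 1 * k ^ suc (radius p n))
    K-Dom = con 1 ⊗ (con k ⊗ self K)

    lift : ∀ {f} → Poly f → Dom W f
    lift = weaken λ n → ℕ.≤-trans (1≤N n) (N≤W n)

    liftᴷ : ∀ {f} → Poly f → Dom K f
    liftᴷ = weaken 1≤K

    literal : Poly literalCost
    literal = con 11 ⊕ (con 1 ⊕ arg ⊗ con 10 ⊕ con 15)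

    clause : Poly (clauseCost k)
    clause = con 4 ⊕ (con 1 ⊕ con k ⊗ (con 7 ⊕ (con 2 ⊕ (literal ⊕ con 6))))

    falsified′ : Poly (λ n → falsifiedCost k (L n) n)
    falsified′ = con 6 ⊕ (con 1 ⊕ poly-Poly c ⊗ (con 7 ⊕ (con 6 ⊕ (clause ⊕ con 2))))

    assign′ : Poly assignCost
    assign′ = con 3 ⊕ (con 10 ⊕ (con 1 ⊕ arg ⊗ con 26) ⊕ (con 16 ⊕ (con 1 ⊕ arg ⊗ con 12)))

    expand′ : Poly (λ n → expandCost k n 3)
    expand′ = con 3 ⊕ con 3 ⊕ (con 1 ⊕ con k ⊗ (con 7 ⊕ (con 3 ⊕ (assign′ ⊕ con 1))))

    distance : Poly distanceCost
    distance = con 10 ⊕ (con 1 ⊕ arg ⊗ con 48)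

    recording : Poly recordCost
    recording = con 18 ⊕ (distance ⊕ (con 3 ⊕ (distance ⊕ (con 6 ⊕ (con 1 ⊕ arg ⊗ con 10 ⊕ con 6)))) ⊕ con 5)

    visiting : Poly (λ n → visitCost k (L n) n)
    visiting = con 3 ⊕ (falsified′ ⊕ (con 9 ⊕ (con 4 ⊕ expand′ ⊕ (con 3 ⊕ (recording ⊕ con 3)))))

    level : Dom K (λ n → levelCost k (L n) n (1 * k ^ suc (radius p n)))
    level = liftᴷ (con 12) ⊕ (liftᴷ (con 1) ⊕
      weaken (λ n → ℕ.≤-reflexive (ℕ.*-identityʳ _)) (K-Dom ⊛ (con 7 ⊕ visiting)))

    radius≤n : ∀ n → radius p n ≤ n
    radius≤n n = ℕ.≤-trans (ℕ.≤-reflexive (radius≡ n)) (ℕ.≤-trans (ℕ.m≤m*n (quota n) m) (floor-≤ p n))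

    radius′ : Poly (radius p)
    radius′ = shrink radius≤n arg

    grouping : ∀ b c e → Poly (groupsCost b c e)
    grouping b c e = con (8 + (c * 4 + 1 + 1)) ⊕ (con 1 ⊕ arg ⊗ con (7 + (16 + (3 + ((b * 4 + 1) + (e * 4 + 3))))))

    searching : Dom K (λ n → searchCost k (L n) p n)
    searching = liftᴷ (con 14) ⊕ (liftᴷ (grouping p p 1 ⊕ con 9) ⊕
      (liftᴷ (con 1) ⊕ (con 1 ⊕ radius′) ⊗ (liftᴷ (con 7) ⊕ level)))

    trial′ : Dom K (λ n → trialTime k (L n) p n)
    trial′ = liftᴷ (con 7 ⊕ arg ⊗ con 6) ⊕ (searching ⊕ liftᴷ (con 4))

    product : ∀ {f g} → Poly f → Poly g → Poly (λ n → productCost (f n) (g n))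
    product F G = con 4 ⊕ (con 1 ⊕ F ⊗ (con 7 ⊕ (con 4 ⊕ (con 1 ⊕ G ⊗ con 12))))

    stages-cost : Dom W (λ n → groupsCost b 0 A (N n))
    stages-cost = lift (con 10) ⊕ (lift (con 1) ⊕
      weaken (λ n → ℕ.≤-reflexive (ℕ.*-identityʳ _)) (N-Dom ⊛ con (7 + (16 + (3 + ((b * 4 + 1) + (A * 4 + 3)))))))

    successor : Poly suc
    successor = con 1 ⊕ arg

    product₁ : Poly (λ n → productCost (suc n) c₀)
    product₁ = product {suc} {λ _ → c₀} successor (con c₀)

    product₂ : Poly (λ n → productCost (suc n) (suc n * c₀))
    product₂ = product {suc} {λ n → suc n * c₀} successor (successor ⊗ con c₀)

    product₃ : Poly (λ n → productCost (suc n) (suc n * (suc n * c₀)))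
    product₃ = product {suc} {λ n → suc n * (suc n * c₀)} successor (successor ⊗ (successor ⊗ con c₀))

    sequence : ∀ {x₀ x₁ x₂ x₃ x₄ x₅ x₆} → Dom W x₀ → Dom W x₁ → Dom W x₂ → Dom W x₃ → Dom W x₄ → Dom W x₅ → Dom W x₆ →
      Dom W (λ n → 17 + (x₀ n + (3 + (x₁ n + (3 + (x₂ n + (3 + (x₃ n + (3 + (x₄ n + (3 + (x₅ n + x₆ n))))))))))))
    sequence X₀ X₁ X₂ X₃ X₄ X₅ X₆ = lift (con 17) ⊕ (X₀ ⊕ (lift (con 3) ⊕ (X₁ ⊕ (lift (con 3) ⊕ (X₂ ⊕
      (lift (con 3) ⊕ (X₃ ⊕ (lift (con 3) ⊕ (X₄ ⊕ (lift (con 3) ⊕ (X₅ ⊕ X₆)))))))))))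

    stages-fold : Dom W (λ n → 4 + (1 + radius p n * (7 + groupsCost b 0 A (N n))))
    stages-fold = lift (con 4) ⊕ (lift (con 1) ⊕ radius′ ⊗ (lift (con 7) ⊕ stages-cost))

    double-cost : Dom W (λ n → 4 + (1 + N n * (7 + 9)))
    double-cost = lift (con 4) ⊕ (lift (con 1) ⊕ weaken (λ n → ℕ.≤-reflexive (ℕ.*-identityʳ _)) (N-Dom ⊛ con 16))

    trials′ : Dom W (trialsCost p b A c₀)
    trials′ = sequence {λ _ → c₀ * 4 + 1} {λ n → productCost (suc n) c₀} {λ n → productCost (suc n) (suc n * c₀)}
      {λ n → productCost (suc n) (suc n * (suc n * c₀))} {groupsCost p p 1}
      {λ n → 4 + (1 + radius p n * (7 + groupsCost b 0 A (N n)))} {λ n → 4 + (1 + N n * (7 + 9))} (lift (con (c₀ * 4 + 1))) (lift product₁) (lift product₂) (lift product₃)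
      (lift (grouping p p 1)) stages-fold double-cost

  time : ℕ → ℕ
  time n = programTime k (L n) p b A c₀ n

  private
    total : ∀ {x y z} → Dom W x → Dom N y → Dom K z → Dom W (λ n → 1 + (x n + (4 + (y n + y n) * z n + 1)))
    total X Y Z = lift (con 1) ⊕ (X ⊕ (lift (con 4) ⊕ ((Y ⊕ Y) ⊛ Z) ⊕ lift (con 1)))

  time-Dom : Dom W time
  time-Dom = total trials′ (self N) trial′

  module _ (δ : ℝ) (R₁≤ : ∀ n → R₁ δ n * m ≤ n) where

    -- `few-trials` compares N with 2 ^ n / C(n, quota n). Since k + 1 ≤ m, the quota is at most n /
    -- (k + 1), the range in which `choose-ratio` allows passing down to R₁.
    trials-τ₁ : ∀ n → (n choose R₁ δ n) * W n ≤ (initial c₀ n + X) * m ^ m * (2 ^ n * k ^ R₁ δ n)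
    trials-τ₁ n = begin
      (n choose R) * (N n * k ^ radius p n)                   ≡⟨ cong (λ r → (n choose R) * (N n * k ^ r)) (radius≡ n) ⟩
      (n choose R) * (N n * k ^ quota n)                      ≡⟨ eq₁ (n choose R) (N n) (k ^ quota n) ⟩
      N n * (k ^ quota n * (n choose R))                      ≤⟨ ℕ.*-monoʳ-≤ (N n) ratio′ ⟩
      N n * (k ^ R * (n choose quota n))                      ≡⟨ eq₂ (N n) (k ^ R) (n choose quota n) ⟩
      (n choose quota n) * N n * k ^ R                        ≤⟨ ℕ.*-monoˡ-≤ (k ^ R) (few-trials n) ⟩
      (initial c₀ n + X) * m ^ m * 2 ^ n * k ^ R              ≡⟨ ℕ.*-assoc ((initial c₀ n + X) * m ^ m) (2 ^ n) (k ^ R) ⟩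
      (initial c₀ n + X) * m ^ m * (2 ^ n * k ^ R)            ∎
      where
      open ℕ.≤-Reasoning
      R = R₁ δ n
      eq₁ : ∀ x y z → x * (y * z) ≡ y * (z * x)
      eq₁ = solve-∀
      eq₂ : ∀ x y z → x * (y * z) ≡ z * x * y
      eq₂ = solve-∀
      R≤ : R ≤ quota n
      R≤ = ℕ.≤-pred (ℕ.*-cancelʳ-< m R (suc (quota n)) (ℕ.≤-<-trans (R₁≤ n) (floor-< p n)))
      R≡ : R + (quota n ∸ R) ≡ quota n
      R≡ = ℕ.m+[n∸m]≡n R≤
      ratio′ : k ^ quota n * (n choose R) ≤ k ^ R * (n choose quota n)
      ratio′ = subst (λ q → k ^ q * (n choose R) ≤ k ^ R * (n choose q)) R≡
        (choose-ratio k n R (quota n ∸ R) (ℕ.≤-trans (ℕ.≤-reflexive (cong (_* suc k) R≡))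
          (ℕ.≤-trans (ℕ.*-monoʳ-≤ (quota n) (s≤s k≤p)) (floor-≤ p n))))

    Dom-O* : ∀ {f} → Dom W f → f ∈O* τ₁ δ k
    Dom-O* {f} (dom a d f≤) = c′ , λ n → fraction (f n) (poly c′ n) (2 ^ n * k ^ R₁ δ n) (n choose R₁ δ n)
        {{>-nonZero (0<nCr (largest≤ _ n))}} (begin
      f n * (n choose R₁ δ n)                                               ≤⟨ ℕ.*-monoˡ-≤ (n choose R₁ δ n) (f≤ n) ⟩
      a * suc n ^ d * W n * (n choose R₁ δ n)                               ≡⟨ eq (a * suc n ^ d) (W n) (n choose R₁ δ n) ⟩
      a * suc n ^ d * ((n choose R₁ δ n) * W n)                             ≤⟨ ℕ.*-monoʳ-≤ (a * suc n ^ d) (trials-τ₁ n) ⟩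
      a * suc n ^ d * ((initial c₀ n + X) * m ^ m * (2 ^ n * k ^ R₁ δ n))   ≡⟨ ℕ.*-assoc (a * suc n ^ d) ((initial c₀ n + X) * m ^ m) (2 ^ n * k ^ R₁ δ n) ⟨
      a * suc n ^ d * ((initial c₀ n + X) * m ^ m) * (2 ^ n * k ^ R₁ δ n)   ≤⟨ ℕ.*-monoˡ-≤ (2 ^ n * k ^ R₁ δ n) (proj₂ polynomial n) ⟩
      poly c′ n * (2 ^ n * k ^ R₁ δ n)                                      ∎)
      where
      open ℕ.≤-Reasoning
      eq : ∀ x y z → x * y * z ≡ x * (z * y)
      eq = solve-∀
      polynomial : ∃ λ c′ → ∀ n → a * suc n ^ d * ((initial c₀ n + X) * m ^ m) ≤ poly c′ n
      polynomial = Poly-poly (dom {f = λ n → a * suc n ^ d} a d (λ n → ℕ.≤-reflexive (sym (ℕ.*-identityʳ (a * suc n ^ d))))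
        ⊗ ((initial-Poly ⊕ con X) ⊗ con (m ^ m)))
      c′ = proj₁ polynomial

    time-O* : time ∈O* τ₁ δ k
    time-O* = Dom-O* time-Dom

-- Probabilities

-- 1 / (n + 1) for each half of the trials.
failure : ℕ → ℚ
failure n = (ℤ.+ 2) ℚ./ suc n

failure-o1 : failure ∈o1
failure-o1 η@(mkℚ (ℤ.+ suc a) d _) 0<η = 2 * suc d , λ n n₀≤n → ℚ.≤-trans
  (ℚ.≤-reflexive (ℚ.0≤p⇒∣p∣≡p (ℚ.nonNegative⁻¹ (failure n) {{ℚ.normalize-nonNeg 2 (suc n)}})))
  (subst (failure n ℚ.≤_) (ℚ.↥p/↧p≡p η) (/-≤ℕ 2 n (suc a) d (ℕ.≤-trans n₀≤n (ℕ.≤-trans (ℕ.n≤1+n n) (ℕ.m≤m+n (suc n) (a * suc n))))))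
failure-o1 (mkℚ (ℤ.+ zero) d _) (ℚ.*<* (ℤ.+<+ ()))
failure-o1 (mkℚ ℤ.-[1+ _ ] d _) (ℚ.*<* ())

success-probability : ∀ n M c q → 0 < M → suc n * M ≤ suc n * c + 2 * M → ι c ℚ.≤ ι M ℚ.* q → 1ℚ ℚ.- failure n ℚ.≤ q
success-probability n (suc M) c q _ le c≤ = begin
  1ℚ ℚ.- failure n              ≤⟨ ℚ.+-monoˡ-≤ (ℚ.- failure n) 1≤ ⟩
  q ℚ.+ failure n ℚ.- failure n      ≡⟨ ℚ.+-assoc q (failure n) (ℚ.- failure n) ⟩
  q ℚ.+ (failure n ℚ.- failure n)    ≡⟨ cong (q ℚ.+_) (ℚ.+-inverseʳ (failure n)) ⟩
  q ℚ.+ 0ℚ                 ≡⟨ ℚ.+-identityʳ q ⟩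
  q                        ∎
  where
  open ℚ.≤-Reasoning
  s = ι (suc n)
  u = ι (suc M)
  1≤ : 1ℚ ℚ.≤ q ℚ.+ failure n
  1≤ = ℚ.*-cancelˡ-≤-pos s {{ι-pos n}} (ℚ.*-cancelˡ-≤-pos u {{ι-pos M}} (begin
    u ℚ.* (s ℚ.* 1ℚ)                           ≡⟨ cong (u ℚ.*_) (ℚ.*-identityʳ s) ⟩
    u ℚ.* s                                    ≡⟨ trans (ℚ.*-comm u s) (sym (ι-* (suc n) (suc M))) ⟩
    ι (suc n * suc M)                          ≤⟨ ι-mono le ⟩
    ι (suc n * c + 2 * suc M)                  ≡⟨ trans (ι-+ (suc n * c) (2 * suc M)) (cong₂ ℚ._+_ (ι-* (suc n) c) (ι-* 2 (suc M))) ⟩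
    s ℚ.* ι c ℚ.+ ι 2 ℚ.* u                    ≤⟨ ℚ.+-monoˡ-≤ (ι 2 ℚ.* u) (ℚ.*-monoˡ-≤-nonNeg s {{ι-nonNeg (suc n)}} c≤) ⟩
    s ℚ.* (u ℚ.* q) ℚ.+ ι 2 ℚ.* u              ≡⟨ cong₂ ℚ._+_ left-part right-part ⟩
    u ℚ.* (s ℚ.* q) ℚ.+ u ℚ.* (s ℚ.* failure n)     ≡⟨ ℚ.*-distribˡ-+ u (s ℚ.* q) (s ℚ.* failure n) ⟨
    u ℚ.* (s ℚ.* q ℚ.+ s ℚ.* failure n)             ≡⟨ cong (u ℚ.*_) (ℚ.*-distribˡ-+ s q (failure n)) ⟨
    u ℚ.* (s ℚ.* (q ℚ.+ failure n))                 ∎))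
    where
    left-part : s ℚ.* (u ℚ.* q) ≡ u ℚ.* (s ℚ.* q)
    left-part = trans (sym (ℚ.*-assoc s u q)) (trans (cong (ℚ._* q) (ℚ.*-comm s u)) (ℚ.*-assoc u s q))
    right-part : ι 2 ℚ.* u ≡ u ℚ.* (s ℚ.* failure n)
    right-part = trans (ℚ.*-comm (ι 2) u) (cong (u ℚ.*_) (trans (sym (fraction-* 2 n)) (ℚ.*-comm (failure n) s)))

-- Diameters

d-H-triangle : ∀ {n} (x y z : Assignment n) → d-H y z ≤ d-H x y + d-H x z
d-H-triangle []      []      []      = z≤n
d-H-triangle (a ∷ x) (b ∷ y) (c ∷ z) rewrite d-H-∷ b c y z | d-H-∷ a b x y | d-H-∷ a c x z =
  ℕ.≤-trans (ℕ.+-mono-≤ (bits a b c) (d-H-triangle x y z))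
    (ℕ.≤-reflexive (interchange (bit (a xor b)) (bit (a xor c)) (d-H x y) (d-H x z)))
  where
  bits : ∀ a b c → bit (b xor c) ≤ bit (a xor b) + bit (a xor c)
  bits false b     c = ℕ.≤-trans (bits₀ b c) ℕ.≤-refl
    where
    bits₀ : ∀ b c → bit (b xor c) ≤ bit b + bit c
    bits₀ false c     = ℕ.≤-refl
    bits₀ true  false = ℕ.≤-refl
    bits₀ true  true  = z≤n
  bits true false c     = ℕ.≤-trans (bit≤1 c) (ℕ.m≤m+n 1 _)
  bits true true  c     = ℕ.≤-refl

module _ {n} (F : CNF n) (z₀ : Assignment n) (z₀⊨F : z₀ ⊨ F) where

  diametral : ∃ λ z₁ → ∃ λ z₂ → z₁ ⊨ F × z₂ ⊨ F × Diam F ≤ d-H z₁ z₂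
  diametral with argmax-sel (λ x → x) 0 (cartesianProductWith d-H (Ω F) (Ω F))
  -- The maximum is the default value 0, so z₀ paired with itself attains it.
  ... | inj₁ eq = z₀ , z₀ , z₀⊨F , z₀⊨F , ℕ.≤-trans (ℕ.≤-reflexive eq) z≤n
  ... | inj₂ D∈ with ∈-cartesianProductWith⁻ d-H (Ω F) (Ω F) D∈
  ...   | z₁ , z₂ , z₁∈ , z₂∈ , eq = z₁ , z₂ , proj₂ (∈-filter⁻ (_⊨? F) {xs = assignments n} z₁∈) , proj₂ (∈-filter⁻ (_⊨? F) {xs = assignments n} z₂∈) , ℕ.≤-reflexive eq

  -- By the triangle inequality through r, the farther end of a diametral pair is at least half the
  -- diameter away.
  half-diameter : ∀ r → ∃ λ z → z ⊨ F × Diam F ≤ 2 * d-H r z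
  half-diameter r with diametral
  ... | z₁ , z₂ , z₁⊨F , z₂⊨F , D≤ with ℕ.≤-total (d-H r z₁) (d-H r z₂)
  ...   | inj₁ le = z₂ , z₂⊨F , ℕ.≤-trans D≤ (ℕ.≤-trans (d-H-triangle r z₁ z₂)
                      (ℕ.≤-trans (ℕ.+-monoˡ-≤ _ le) (ℕ.≤-reflexive (cong (d-H r z₂ +_) (sym (ℕ.+-identityʳ _))))))
  ...   | inj₂ le = z₁ , z₁⊨F , ℕ.≤-trans D≤ (ℕ.≤-trans (d-H-triangle r z₁ z₂)
                      (ℕ.≤-trans (ℕ.+-monoʳ-≤ (d-H r z₁) le) (ℕ.≤-reflexive (cong (d-H r z₁ +_) (sym (ℕ.+-identityʳ _))))))

-- Success

decAssignment-enc : ∀ {n} (z : Assignment n) → decAssignment n (encAssignment z) ≡ just z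
decAssignment-enc []      = refl
decAssignment-enc (b ∷ z) rewrite decAssignment-enc z | decBool-encBool b = refl

decPair-enc : ∀ {n} (y z : Assignment n) → decPair n (encAssignment y ∙ encAssignment z) ≡ just (y , z)
decPair-enc y z rewrite decAssignment-enc y | decAssignment-enc z = refl

module _ {n} (δ : ℝ) (F : CNF n) where

  weight : State n → ℕ
  weight st = if does (success? δ F (encState st)) then 1 else 0

  weight-far : ∀ r b → FarApart δ F (r , b) → 1 ≤ weight (just (r , b))
  weight-far r b apart = ℕ.≤-reflexive (sym (cong (if_then 1 else 0)
    (dec-true (success? δ F (encAssignment r ∙ encAssignment b))
      (subst (Maybe.Any (FarApart δ F)) (sym (decPair-enc r b)) (Maybe.just apart)))))

  leaf-probability : ∀ δ′ st σ → σ 0 ≡ encState st →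
    Judgement.J (probability δ′ (success? δ F)) 0 (weight st) 0 ([] , σ)
  leaf-probability δ′ st σ eq rewrite eq with does (success? δ F (encState st))
  ... | true  = ℚ.≤-refl
  ... | false = ℚ.≤-refl

module _ (δ : ℝ) (p : ℕ) (p≤δ : four/ p ≤ʳ δ) {n} (F : CNF n) (z₀ : Assignment n) (z₀⊨F : z₀ ⊨ F) where

  far-away : ∀ r → r ⊨ F → ∃ λ z → z ⊨ F × (∀ b → b ⊨ F →
    d-H r z ≤ d-H r b + groups (suc p) (suc p) (d-H r z) → 1 ≤ weight δ F (just (r , b)))
  far-away r r⊨F with half-diameter F z₀ z₀⊨F r
  ... | z , z⊨F , D≤ = z , z⊨F , λ b b⊨F close → weight-far δ F r b (r⊨F , b⊨F , ratio δ p D (d-H r b) p≤δ (begin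
    D * suc p                               ≤⟨ ℕ.*-monoˡ-≤ (suc p) D≤ ⟩
    2 * a * suc p                           ≤⟨ ℕ.*-monoˡ-≤ (suc p) (ℕ.*-monoʳ-≤ 2 close) ⟩
    2 * (d-H r b + q) * suc p               ≡⟨ eq₁ (d-H r b) q p ⟩
    2 * (q * suc p) + 2 * d-H r b * suc p   ≤⟨ ℕ.+-monoˡ-≤ _ (ℕ.*-monoʳ-≤ 2 (ℕ.≤-trans (ℕ.*-monoʳ-≤ q (ℕ.n≤1+n (suc p))) (floor-≤ (suc p) a))) ⟩
    -- The loss is at most 2 D / (p + 1), half of what `four/ p` allows.
    2 * a + 2 * d-H r b * suc p             ≤⟨ ℕ.+-monoˡ-≤ _ (ℕ.*-mono-≤ {2} {4} (s≤s (s≤s z≤n)) (d-H≤Diam F r z r⊨F z⊨F)) ⟩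
    4 * D + 2 * d-H r b * suc p             ∎))
    where
    open ℕ.≤-Reasoning
    D = Diam F
    a = d-H r z
    q = groups (suc p) (suc p) a
    eq₁ : ∀ d q p → 2 * (d + q) * (1 + p) ≡ 2 * (q * (1 + p)) + 2 * d * (1 + p)
    eq₁ = solve-∀

-- Correctness of the program

module _ (p : ℕ) (2≤p : 2 ≤ p) where
  open Parameters p 2≤p

  program-succeeds : ∀ {n} (F : CNF n) (w : State n → ℕ) z₀ → z₀ ⊨ F →
    (∀ r → r ⊨ F → ∃ λ z → z ⊨ F × (∀ b → b ⊨ F → d-H r z ≤ d-H r b + groups p p (d-H r z) → 1 ≤ w (just (r , b)))) →
    let N = trials p b A c₀ n in
    suc n * 2 ^ ((N + N) * n) ≤ suc n * count p F w (N + N) nothing + 2 * 2 ^ ((N + N) * n)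
  program-succeeds {n} F w z₀ z₀⊨F apart with argmin (goodness n) n
  -- d₀ is the least favourable distance; its number of good points serves as g for every reference
  -- point.
  ... | d₀ , d₀≤n , least = subst (λ M → suc n * M ≤ suc n * c + 2 * M) power
    (success-bound (suc n) g h N c (subst (0 <_) M≡h (ℕ.m^n>0 2 n))
      (ℕ.≤-trans (ℕ.≤-reflexive (cong (suc n *_) (sym M≡h))) (enough-trials n d₀ d₀≤n))
      (subst (λ M → M ^ (N + N) ≤ c + (h ^ N * M ^ N + M ^ N * h ^ N)) M≡h
        (count-valid p F w z₀ z₀⊨F quota-sum apart g h M≡g least N N nothing (inj₁ refl))))
    where
    N = trials p b A c₀ n
    c = count p F w (N + N) nothing
    g = goodness n d₀
    h = 2 ^ n ∸ g
    subset : ∀ d i → d choose i ≤ 2 ^ d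
    subset d i = ℕ.≤-trans (ℕ.≤-reflexive (sym (trans (cong ((d choose i) *_) (ℕ.^-zeroˡ (d ∸ i))) (ℕ.*-identityʳ _))))
      (binomial-term 1 d i)
    g≤M : g ≤ 2 ^ n
    g≤M = ℕ.≤-trans (ℕ.*-mono-≤ (subset d₀ (quota d₀)) (subset (n ∸ d₀) (quota (n ∸ d₀))))
      (ℕ.≤-reflexive (trans (sym (ℕ.^-distribˡ-+-* 2 d₀ (n ∸ d₀))) (cong (2 ^_) (ℕ.m+[n∸m]≡n d₀≤n))))
    M≡g : 2 ^ n ≡ g + h
    M≡g = sym (ℕ.m+[n∸m]≡n g≤M)
    M≡h : 2 ^ n ≡ h + g
    M≡h = trans M≡g (ℕ.+-comm g h)
    power : (h + g) ^ (N + N) ≡ 2 ^ ((N + N) * n)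
    power = trans (cong (_^ (N + N)) (sym M≡h)) (trans (ℕ.^-*-assoc 2 n (N + N)) (cong (2 ^_) (ℕ.*-comm n (N + N))))

  module _ (k : ℕ) (2≤k : 2 ≤ k) (k≤p : k ≤ p) (δ : Presentation)
           (R₁≤ : ∀ n → R₁ (value δ) n * m ≤ n)
           (apart : ∀ {n} (F : CNF n) z₀ → z₀ ⊨ F → ∀ r → r ⊨ F → ∃ λ z → z ⊨ F × (∀ b → b ⊨ F →
             d-H r z ≤ d-H r b + groups p p (d-H r z) → 1 ≤ weight (value δ) F (just (r , b)))) where

    algorithm-correct : ∃ λ (prog : Cmd) → ∀ (c : ℕ) → ∃ λ (t : ℕ → ℕ) → ∃ λ (ε : ℕ → ℚ) →
      t ∈O* τ₁ (value δ) k × ε ∈o1 ×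
      (∀ n (F : CNF n) → IsKCNF k F → length F ≤ poly c n →
        HaltsWithin δ (t n) (start prog (encCNF F)) ×
        (Satisfiable F → (1ℚ ℚ.- ε n) ℚ.≤ Pr δ (t n) (start prog (encCNF F)) (success? (value δ) F)))
    algorithm-correct = program p b A c₀ , λ c →
      let open Time k p c 2≤k 2≤p k≤p in
      time , failure , time-O* (value δ) R₁≤ , failure-o1 , λ n F kF F≤L →
        Loop.program-judgement (halting δ) p F kF F≤L 1≤k (weight (value δ) F) b A c₀ stage-increases (λ _ _ _ → tt) ,
        λ (z₀ , z₀⊨F) → success-probability n (2 ^ ((trials p b A c₀ n + trials p b A c₀ n) * n))
          (count p F (weight (value δ) F) (trials p b A c₀ n + trials p b A c₀ n) nothing)
          (Pr δ (time n) (start (program p b A c₀) (encCNF F)) (success? (value δ) F))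
          (ℕ.m^n>0 2 ((trials p b A c₀ n + trials p b A c₀ n) * n))
          (program-succeeds F (weight (value δ) F) z₀ z₀⊨F (apart F z₀ z₀⊨F))
          (Loop.program-judgement (probability δ (success? (value δ) F)) p F kF F≤L 1≤k (weight (value δ) F)
            b A c₀ stage-increases (leaf-probability (value δ) F δ))
      where
      1≤k : 1 ≤ k
      1≤k = ℕ.≤-trans (s≤s z≤n) 2≤k

theorem41 : ∀ (k : ℕ) (2≤k : 2 ≤ k) (δ : Presentation) →
    Positive (value δ) → value δ ʳ≤ min[1,4/[ k -1]] 2≤k →
    ∃ λ (p : Cmd) →
    ∀ (c : ℕ) → ∃ λ (t : ℕ → ℕ) → ∃ λ (ε : ℕ → ℚ) →
    t ∈O* τ₁ (value δ) k × ε ∈o1 ×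
    (∀ n (F : CNF n) → IsKCNF k F → length F ≤ poly c n →
    HaltsWithin δ (t n) (start p (encCNF F)) ×
    (Satisfiable F → (1ℚ - ε n) ≤ℚ Pr δ (t n) (start p (encCNF F)) (success? (value δ) F)))
theorem41 k 2≤k δ pos δ≤ =
  let t , k≤ , below , above = approximation (value δ) k 2≤k pos δ≤ in
  -- As `four/ t` is 4 / (t + 1), s is t + 1 and m is t + 3; the argument 2 + t is p = m - 1, and k
  -- ≤ 2 + t gives k + 1 ≤ m.
  algorithm-correct (2 + t) (s≤s (s≤s z≤n)) k 2≤k k≤ δ (λ n → R₁-≤ (value δ) t n below)
    (far-away (value δ) (suc t) above)
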